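{- Let $m$ be a positive integer. For every $\delta>0$ there exists $N\in\mathbb{N}$ such that every $N$-partitioned hypergraph with density at least $4/27+\delta$ embeds the tight $3$-uniform cycle $C_{3m+4}^{(3)}$.
   Context: An $N$-partitioned hypergraph $H$ is a $3$-uniform hypergraph whose vertex set is partitioned into nonempty finite sets $V_{ij}$, $1\le i<j\le N$ (we also write $V_{ji}=V_{ij}$), such that every edge has one vertex in each of $V_{ij},V_{ik},V_{jk}$ for some $1\le i<j<k\le N$. For $i<j<k$, the $(i,j,k)$-triad is the set of edges with one vertex in each of $V_{ij},V_{ik},V_{jk}$; its density is its number of edges divided by $|V_{ij}||V_{ik}||V_{jk}|$, and the density of $H$ is the minimum density over all triads. $H$ embeds a $3$-uniform hypergraph $H_0$ with vertex set $[n]$ if there are distinct $a_1,\dots,a_n\in[N]$ and vertices $v_{ij}\in V_{a_ia_j}$ for $1\le i<j\le n$ such that whenever $\{i,j,k\}$ ($i<j<k$) is an edge of $H_0$, the set $\{v_{ij},v_{ik},v_{jk}\}$ is an edge of $H$ (in the triad on the indices $a_i,a_j,a_k$). The tight cycle $C_\ell^{(3)}$ ($\ell\ge5$) has vertices $v_1,\dots,v_\ell$ and edges $\{v_i,v_{i+1},v_{i+2}\}$, indices modulo $\ell$. -}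

module Defs where

open import Data.Nat as ℕ using (ℕ; zero; suc; _+_; _*_; _%_; NonZero)
open import Data.Fin as Fin using (Fin; toℕ; _≟_)
open import Data.Bool using (Bool; true; false; _∧_; if_then_else_)
open import Data.Product using (Σ; ∃; ∃-syntax; _×_; _,_; proj₁; proj₂)
open import Data.Sum using (_⊎_)
open import Data.Integer using (+_)
open import Data.Rational as ℚ using (ℚ; _/_)
open import Relation.Nullary.Decidable using (⌊_⌋)
open import Relation.Binary.PropositionalEquality using (_≡_)
open import Function.Definitions using (Injective)

∑ : (n : ℕ) → (Fin n → ℕ) → ℕ
∑ zero    f = 0
∑ (suc n) f = f Fin.zero + ∑ n (λ i → f (Fin.suc i))

ℕ→ℚ : ℕ → ℚ
ℕ→ℚ n = (+ n) / 1

-- An N-partitioned 3-uniform hypergraph.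
-- Vertices are Fin M; part x = (i , j) with i < j means x ∈ V_ij.
-- Edges are recorded as triples (x , y , z) with x ∈ V_ij, y ∈ V_ik, z ∈ V_jk,
-- i < j < k (so each edge {x,y,z} is recorded exactly once, in this order).
record PartHypergraph (N : ℕ) : Set where
  field
    M            : ℕ
    part         : Fin M → Fin N × Fin N
    part-ordered : ∀ x → proj₁ (part x) Fin.< proj₂ (part x)
    nonempty     : ∀ (i j : Fin N) → i Fin.< j → ∃[ x ] part x ≡ (i , j)
    edge         : Fin M → Fin M → Fin M → Bool
    edge-triad   : ∀ x y z → edge x y z ≡ true →
                   ∃[ i ] ∃[ j ] ∃[ k ] (i Fin.< j × j Fin.< k ×
                     part x ≡ (i , j) × part y ≡ (i , k) × part z ≡ (j , k))

module _ {N : ℕ} (H : PartHypergraph N) where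
  open PartHypergraph H

  inPartᵇ : Fin M → Fin N → Fin N → Bool
  inPartᵇ x i j = ⌊ proj₁ (part x) ≟ i ⌋ ∧ ⌊ proj₂ (part x) ≟ j ⌋

  partSize : Fin N → Fin N → ℕ
  partSize i j = ∑ M (λ x → if inPartᵇ x i j then 1 else 0)

  triadEdges : Fin N → Fin N → Fin N → ℕ
  triadEdges i j k =
    ∑ M (λ x → ∑ M (λ y → ∑ M (λ z →
      if inPartᵇ x i j ∧ inPartᵇ y i k ∧ inPartᵇ z j k ∧ edge x y z
      then 1 else 0)))

  -- density of the (i,j,k)-triad is at least d, i.e.
  -- #edges ≥ d · |V_ij| |V_ik| |V_jk|   (the product is positive)
  TriadDensityAtLeast : Fin N → Fin N → Fin N → ℚ → Set
  TriadDensityAtLeast i j k d =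
    d ℚ.* ℕ→ℚ (partSize i j * partSize i k * partSize j k) ℚ.≤ ℕ→ℚ (triadEdges i j k)

  DensityAtLeast : ℚ → Set
  DensityAtLeast d = ∀ i j k → i Fin.< j → j Fin.< k → TriadDensityAtLeast i j k d

  InPart : Fin M → Fin N → Fin N → Set
  InPart x i j = part x ≡ (i , j) ⊎ part x ≡ (j , i)

  IsEdge : Fin M → Fin M → Fin M → Set
  IsEdge x y z =
    edge x y z ≡ true ⊎ edge x z y ≡ true ⊎ edge y x z ≡ true ⊎
    edge y z x ≡ true ⊎ edge z x y ≡ true ⊎ edge z y x ≡ true

  -- H embeds the 3-graph H₀ on vertex set Fin n whose edge relation E₀ i j k
  -- is meaningful for i < j < k ({i,j,k} is an edge).
  Embeds : (n : ℕ) → (Fin n → Fin n → Fin n → Set) → Set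
  Embeds n E₀ =
    Σ (Fin n → Fin N) λ a → Injective _≡_ _≡_ a ×
    Σ ((i j : Fin n) → i Fin.< j → Fin M) λ v →
      (∀ i j (p : i Fin.< j) → InPart (v i j p) (a i) (a j)) ×
      (∀ i j k (p : i Fin.< j) (q : j Fin.< k) (r : i Fin.< k) →
         E₀ i j k → IsEdge (v i j p) (v i k r) (v j k q))

InConsec : (ℓ : ℕ) → .{{NonZero ℓ}} → Fin ℓ → Fin ℓ → Set
InConsec ℓ t i = toℕ i ≡ toℕ t % ℓ ⊎ toℕ i ≡ (toℕ t + 1) % ℓ ⊎ toℕ i ≡ (toℕ t + 2) % ℓ

-- the tight cycle C_ℓ^(3) on vertices Fin ℓ: {i,j,k} is an edge iff
-- {i,j,k} = {t, t+1, t+2} (mod ℓ) as sets for some t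
TightCycleEdge : (ℓ : ℕ) → .{{NonZero ℓ}} → Fin ℓ → Fin ℓ → Fin ℓ → Set
TightCycleEdge ℓ i j k =
  ∃[ t ] (InConsec ℓ t i × InConsec ℓ t j × InConsec ℓ t k ×
          ((toℕ t % ℓ ≡ toℕ i ⊎ toℕ t % ℓ ≡ toℕ j ⊎ toℕ t % ℓ ≡ toℕ k) ×
           ((toℕ t + 1) % ℓ ≡ toℕ i ⊎ (toℕ t + 1) % ℓ ≡ toℕ j ⊎ (toℕ t + 1) % ℓ ≡ toℕ k) ×
           ((toℕ t + 2) % ℓ ≡ toℕ i ⊎ (toℕ t + 2) % ℓ ≡ toℕ j ⊎ (toℕ t + 2) % ℓ ≡ toℕ k)))

{-# OPTIONS --safe #-}

-- Colouring pairs. A copy of the tight cycle is a closed walk of triangles in which consecutive triangles share a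
-- vertex of H, so it suffices to find q vertices ("colours") in every part V_ij and many indices such that all triads
-- on these indices induce one and the same set T of colour triples (a palette), with |T| > (4/27) q³. The colours are
-- sampled in q stages. When a vertex of V_ij is drawn, averaging gives one whose expected total contribution to the
-- final edge count, summed over its three possible roles in a triad (third index to the right, between, to the left),
-- does not decrease; Ramsey's theorem on tuples of indices makes these contributions uniform. Only triples with a
-- repeated stage escape control, and their proportion is O(1/q). A last application of Ramsey makes the triads equal.
--
-- Dense palettes. Let D(x) be the number of triples of T through x, over all three roles. Since the sum of
-- D(g) + D(d) + D(f) over (g,d,f) ∈ T is Σ D² ≥ 9 |T|² / q, some base triple has D(g) + D(d) + D(f) > (4/3) q².
-- A second triple through g, d or f is a wing; a colour u of a wing determines a bijection between the three vertices
-- of the base and the two ends of u and a third vertex. If two wings give the same u bijections differing by a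
-- rotation, then the base and the wings can be traversed by a closed tight walk of length 7, which becomes one of
-- length 3m + 4 by going around one triangle again. Otherwise the colours fall into three disjoint classes for each
-- parity of the bijection, D(g) + D(d) + D(f) is at most a quadratic form in the class sizes, and that form is at
-- most (4/3) q².

module Submission where

open import Defs
open import Data.Bool as Bool using (Bool; true; false; not; if_then_else_; _∧_)
open import Data.Empty using (⊥-elim)
open import Data.Fin as Fin using (Fin; toℕ; fromℕ<)
open import Data.Fin.Patterns
import Data.Fin.Properties as Finₚ
open import Data.List using (List; []; _∷_; _++_; length; take; drop; filter; map; upTo; allFin; lookup; cartesianProduct)
open import Data.List.Membership.Propositional using (_∈_; find)
open import Data.List.Membership.Propositional.Properties using (∈-filter⁺; ∈-filter⁻; ∈-map⁺; ∈-upTo⁺; ∈-cartesianProduct⁺; ∈-++⁻; ∈-allFin; ∈-lookup)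
open import Data.List.Properties using (length-take; length-map; length-++; length-tabulate; filter-all; filter-accept; filter-reject; ++-assoc)
open import Data.List.Relation.Binary.Sublist.Propositional using (_⊆_; []; _∷_; _∷ʳ_; ⊆-refl; ⊆-trans; minimum; from∈)
open import Data.List.Relation.Binary.Sublist.Propositional.Properties using (take-⊆; filter-⊆; All-resp-⊆; Any-resp-⊆; length-mono-≤; ++⁺; ++⁺ˡ; ++⁺ʳ)
open import Data.List.Relation.Unary.All as All using (All; []; _∷_; all?)
import Data.List.Relation.Unary.All.Properties as Allₚ
open import Data.List.Relation.Unary.AllPairs using (AllPairs; []; _∷_)
import Data.List.Relation.Unary.AllPairs.Properties as AllPairsₚ
open import Data.List.Relation.Unary.Any as Any using (Any; here; there)
open import Data.Nat using (ℕ; zero; suc; _+_; _*_; _^_; _∸_; _≤_; _<_; z≤n; s≤s; _≤?_; _<?_; _<ᵇ_; _%_; NonZero; >-nonZero; ≢-nonZero) renaming (_/_ to _div_)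
open import Data.Nat.Coprimality using (Coprime)
open import Data.Nat.DivMod using (/-mono-≤; m*n/n≡m; m/n*n≤m; m≡m%n+[m/n]*n; m%n<n; m<n⇒m%n≡m; n%n≡0; [m+n]%n≡m%n)
open import Data.Nat.ListAction using (sum)
open import Data.Nat.Properties
open import Data.Nat.Tactic.RingSolver using (solve-∀)
open import Data.Product using (Σ; ∃; ∃-syntax; _×_; _,_; proj₁; proj₂)
open import Data.Sum using (_⊎_; inj₁; inj₂)
open import Data.Unit using (⊤)
open import Relation.Binary.Definitions using (Tri; tri<; tri≈; tri>)
open import Relation.Binary.PropositionalEquality
open import Relation.Nullary using (Dec; yes; no; ¬_)
open import Relation.Nullary.Decidable using (⌊_⌋; map′; _×-dec_; _→-dec_; ¬?; from-yes)

-- Ramsey's theorem for sublists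

-- A chosen vertex serves triads in three roles, while each triad combines three different vertices,
-- one in each role. A good total for every chosen vertex therefore bounds no single triad. The
-- selection asks for more: three thresholds, one per role, common to all pairs, so that their sum
-- controls every triad at once. Ramsey's theorem can find them only among finitely many candidates,
-- whose number must not depend on the sizes of the parts. This is why gains are divided by the
-- volume of the triad, scaled by `K` and rounded to natural numbers, and why the loss of a stage
-- contains a constant for rounding besides the term for repeated stages. The constant 4/27 is
-- (4/3)/9: the 9 comes from Cauchy-Schwarz on the degrees, whose sum is 3 |T|, and the quadratic
-- form does reach (4/3) q², for instance when the classes of either parity have sizes 2q/3, 0, q/3.

SublistOfLength : {A : Set} → ℕ → List A → List A → Set
SublistOfLength n xs ys = ys ⊆ xs × length ys ≡ n

take-sublist : {A : Set} (n : ℕ) (xs : List A) → n ≤ length xs → SublistOfLength n xs (take n xs)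
take-sublist n xs n≤ = take-⊆ n xs , trans (length-take n xs) (m≤n⇒m⊓n≡m n≤)

Constant : {A : Set} → ℕ → (List A → Bool) → List A → Bool → Set
Constant r c ys b = ∀ zs → zs ⊆ ys → length zs ≡ r → c zs ≡ b

Homogeneous : {A : Set} → ℕ → List A → (List A → Bool) → Set
Homogeneous r ys c = ∃[ b ] Constant r c ys b

Homogeneous-⊆ : {A : Set} {r : ℕ} {ys zs : List A} {c : List A → Bool} →
  zs ⊆ ys → Homogeneous r ys c → Homogeneous r zs c
Homogeneous-⊆ zs⊆ys (b , h) = b , λ ws ws⊆zs → h ws (⊆-trans ws⊆zs zs⊆ys)

iterateBound : (ℕ → ℕ) → ℕ → ℕ
iterateBound f zero    = 0
iterateBound f (suc t) = suc (f (iterateBound f t))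

ramseyBound : ℕ → ℕ → ℕ
ramseyBound zero    n = n
ramseyBound (suc r) n = iterateBound (ramseyBound r) (n + n)

-- The usual intermediate notion in the proof of Ramsey's theorem: the colour of a sublist of length
-- r + 1 depends on its first element only.
EndHomogeneous : {A : Set} → ℕ → (List A → Bool) → List A → Set
EndHomogeneous r c []       = ⊤
EndHomogeneous r c (y ∷ ys) = Homogeneous r ys (λ zs → c (y ∷ zs)) × EndHomogeneous r c ys

splitByColour : {A : Set} (r : ℕ) (c : List A → Bool) (ys : List A) → EndHomogeneous r c ys →
  ∃[ ts ] ∃[ fs ] (ts ⊆ ys × fs ⊆ ys × length ys ≡ length ts + length fs ×
    Constant (suc r) c ts true × Constant (suc r) c fs false)
splitByColour r c [] _ = [] , [] , [] , [] , refl , (λ { .[] [] () }) , (λ { .[] [] () })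
splitByColour r c (y ∷ ys) ((b , hom) , eh) with splitByColour r c ys eh
... | ts , fs , ts⊆ , fs⊆ , len , ct , cf = add b hom
  where
  extend : ∀ {b ws} → Constant r (λ zs → c (y ∷ zs)) ys b → ws ⊆ ys →
           Constant (suc r) c ws b → Constant (suc r) c (y ∷ ws) b
  extend hom ws⊆ cw zs (.y ∷ʳ sub) l = cw zs sub l
  extend hom ws⊆ cw (.y ∷ zs) (refl ∷ sub) l = hom zs (⊆-trans sub ws⊆) (suc-injective l)

  add : ∀ b → Constant r (λ zs → c (y ∷ zs)) ys b →
    ∃[ ts ] ∃[ fs ] (ts ⊆ y ∷ ys × fs ⊆ y ∷ ys × length (y ∷ ys) ≡ length ts + length fs ×
      Constant (suc r) c ts true × Constant (suc r) c fs false)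
  add true hom = y ∷ ts , fs , refl ∷ ts⊆ , y ∷ʳ fs⊆ , cong suc len , extend hom ts⊆ ct , cf
  add false hom = ts , y ∷ fs , y ∷ʳ ts⊆ , refl ∷ fs⊆ ,
    trans (cong suc len) (sym (+-suc (length ts) (length fs))) , ct , extend hom fs⊆ cf

half≤ : ∀ n a b → n + n ≤ a + b → (n ≤ a) ⊎ (n ≤ b)
half≤ n a b le with ≤-total n a
... | inj₁ n≤a = inj₁ n≤a
... | inj₂ a≤n = inj₂ (+-cancelˡ-≤ n n b (≤-trans le (+-monoˡ-≤ b a≤n)))

-- Induction on the uniformity r. An end-homogeneous sublist of length 2n colours its own elements
-- with two colours, and one of the two colours is used n times. Both functions call each other,
-- with r decreasing from `ramsey` to `endHomogeneous`.
ramsey : {A : Set} (r n : ℕ) (c : List A → Bool) (xs : List A) → ramseyBound r n ≤ length xs →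
  ∃[ ys ] (SublistOfLength n xs ys × Homogeneous r ys c)
endHomogeneous : {A : Set} (r t : ℕ) (c : List A → Bool) (xs : List A) →
  iterateBound (ramseyBound r) t ≤ length xs →
  ∃[ ys ] (SublistOfLength t xs ys × EndHomogeneous r c ys)

ramsey zero n c xs n≤ = take n xs , take-sublist n xs n≤ , c [] , λ { [] _ _ → refl }
ramsey (suc r) n c xs le
  with ys , (ys⊆ , len) , eh ← endHomogeneous r (n + n) c xs le
  with ts , fs , ts⊆ , fs⊆ , split , ct , cf ← splitByColour r c ys eh
  with half≤ n (length ts) (length fs) (≤-reflexive (trans (sym len) split))
... | inj₁ n≤ = take n ts , (⊆-trans (take-⊆ n ts) (⊆-trans ts⊆ ys⊆) , proj₂ (take-sublist n ts n≤)) ,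
      true , λ zs sub → ct zs (⊆-trans sub (take-⊆ n ts))
... | inj₂ n≤ = take n fs , (⊆-trans (take-⊆ n fs) (⊆-trans fs⊆ ys⊆) , proj₂ (take-sublist n fs n≤)) ,
      false , λ zs sub → cf zs (⊆-trans sub (take-⊆ n fs))

endHomogeneous r zero c xs le = [] , (minimum xs , refl) , _
endHomogeneous r (suc t) c (x ∷ xs) (s≤s le)
  with ys , (ys⊆ , len) , hom ← ramsey r (iterateBound (ramseyBound r) t) (λ zs → c (x ∷ zs)) xs le
  with zs , (zs⊆ , len′) , eh ← endHomogeneous r t c ys (≤-reflexive (sym len))
  = x ∷ zs , (refl ∷ ⊆-trans zs⊆ ys⊆ , cong suc len′) , Homogeneous-⊆ zs⊆ hom , eh

multiRamseyBound : ℕ → ℕ → ℕ → ℕ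
multiRamseyBound zero    r n = n
multiRamseyBound (suc m) r n = ramseyBound r (multiRamseyBound m r n)

multiRamsey : {A : Set} (r n : ℕ) (cs : List (List A → Bool)) (xs : List A) →
  multiRamseyBound (length cs) r n ≤ length xs →
  ∃[ ys ] (SublistOfLength n xs ys × All (Homogeneous r ys) cs)
multiRamsey r n [] xs le = take n xs , take-sublist n xs le , []
multiRamsey r n (c ∷ cs) xs le
  with ys , (ys⊆ , len) , hom ← ramsey r (multiRamseyBound (length cs) r n) c xs le
  with zs , (zs⊆ , len′) , homs ← multiRamsey r n cs ys (≤-reflexive (sym len))
  = zs , (⊆-trans zs⊆ ys⊆ , len′) , Homogeneous-⊆ zs⊆ hom ∷ homs

-- Finite sums, thresholds and spaced sublists

∑-cong : ∀ {n} {f g : Fin n → ℕ} → (∀ i → f i ≡ g i) → ∑ n f ≡ ∑ n g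
∑-cong {zero}  eq = refl
∑-cong {suc n} eq = cong₂ _+_ (eq Fin.zero) (∑-cong (λ i → eq (Fin.suc i)))

∑-mono : ∀ {n} {f g : Fin n → ℕ} → (∀ i → f i ≤ g i) → ∑ n f ≤ ∑ n g
∑-mono {zero}  le = z≤n
∑-mono {suc n} le = +-mono-≤ (le Fin.zero) (∑-mono (λ i → le (Fin.suc i)))

interchange : ∀ a b c d → (a + b) + (c + d) ≡ (a + c) + (b + d)
interchange = solve-∀

∑-+ : ∀ {n} (f g : Fin n → ℕ) → ∑ n (λ i → f i + g i) ≡ ∑ n f + ∑ n g
∑-+ {zero}  f g = refl
∑-+ {suc n} f g = trans (cong (f Fin.zero + g Fin.zero +_) (∑-+ (λ i → f (Fin.suc i)) (λ i → g (Fin.suc i))))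
  (interchange (f Fin.zero) (g Fin.zero) _ _)

∑-*ˡ : ∀ {n} c (f : Fin n → ℕ) → ∑ n (λ i → c * f i) ≡ c * ∑ n f
∑-*ˡ {zero}  c f = sym (*-zeroʳ c)
∑-*ˡ {suc n} c f = trans (cong (c * f Fin.zero +_) (∑-*ˡ c (λ i → f (Fin.suc i))))
  (sym (*-distribˡ-+ c (f Fin.zero) _))

∑-*ʳ : ∀ {n} c (f : Fin n → ℕ) → ∑ n (λ i → f i * c) ≡ ∑ n f * c
∑-*ʳ c f = trans (∑-cong (λ i → *-comm (f i) c)) (trans (∑-*ˡ c f) (*-comm c _))

∑-const : ∀ n c → ∑ n (λ _ → c) ≡ n * c
∑-const zero    c = refl
∑-const (suc n) c = cong (c +_) (∑-const n c)

∑-swap : ∀ {m n} (f : Fin m → Fin n → ℕ) →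
  ∑ m (λ i → ∑ n (λ j → f i j)) ≡ ∑ n (λ j → ∑ m (λ i → f i j))
∑-swap {zero}  {n} f = sym (trans (∑-const n 0) (*-zeroʳ n))
∑-swap {suc m} {n} f = trans (cong (∑ n (f Fin.zero) +_) (∑-swap (λ i → f (Fin.suc i))))
  (sym (∑-+ (f Fin.zero) _))

-- If every point of positive weight had `f x < c`, then `w x * f x + w x ≤ c * w x` would hold
-- everywhere. The extra `w x` keeps the strictness through the summation.
weightedAverage : ∀ {n} (w f : Fin n → ℕ) (c : ℕ) → 0 < ∑ n w →
  c * ∑ n w ≤ ∑ n (λ x → w x * f x) → ∃[ x ] (0 < w x × c ≤ f x)
weightedAverage {n} w f c 0<w le with Finₚ.any? (λ x → (0 <? w x) ×-dec (c ≤? f x))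
... | yes p = p
... | no ¬p = ⊥-elim (<⇒≱ 0<w (+-cancelˡ-≤ (∑ n (λ x → w x * f x)) _ _ (begin
    ∑ n (λ x → w x * f x) + ∑ n w ≡⟨ sym (∑-+ _ w) ⟩
    ∑ n (λ x → w x * f x + w x) ≤⟨ ∑-mono below ⟩
    ∑ n (λ x → c * w x) ≡⟨ ∑-*ˡ c w ⟩
    c * ∑ n w ≤⟨ le ⟩
    ∑ n (λ x → w x * f x) ≡⟨ sym (+-identityʳ _) ⟩
    ∑ n (λ x → w x * f x) + 0 ∎)))
  where
  open ≤-Reasoning
  below : ∀ x → w x * f x + w x ≤ c * w x
  below x with w x in eq
  ... | zero  = z≤n
  ... | suc k = begin
    suc k * f x + suc k ≡⟨ trans (+-comm _ (suc k)) (sym (*-suc (suc k) (f x))) ⟩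
    suc k * suc (f x) ≤⟨ *-monoʳ-≤ (suc k) (≰⇒> (λ c≤ → ¬p (x , subst (0 <_) (sym eq) (s≤s z≤n) , c≤))) ⟩
    suc k * c ≡⟨ *-comm (suc k) c ⟩
    c * suc k ∎

∑-sum : ∀ {n} {A : Set} (w : Fin n → ℕ) (f : Fin n → A → ℕ) (c : ℕ) (L : List A) →
  All (λ k → c * ∑ n w ≤ ∑ n (λ x → w x * f x k)) L →
  length L * c * ∑ n w ≤ ∑ n (λ x → w x * sum (map (f x) L))
∑-sum w f c [] [] = z≤n
∑-sum {n} w f c (k ∷ L) (p ∷ ps) = begin
  (c + length L * c) * ∑ n w ≡⟨ *-distribʳ-+ (∑ n w) c _ ⟩
  c * ∑ n w + length L * c * ∑ n w ≤⟨ +-mono-≤ p (∑-sum w f c L ps) ⟩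
  ∑ n (λ x → w x * f x k) + ∑ n (λ x → w x * sum (map (f x) L)) ≡⟨ sym (∑-+ (λ x → w x * f x k) _) ⟩
  ∑ n (λ x → w x * f x k + w x * sum (map (f x) L)) ≡⟨ ∑-cong (λ x → sym (*-distribˡ-+ (w x) _ _)) ⟩
  ∑ n (λ x → w x * sum (map (f x) (k ∷ L))) ∎
  where open ≤-Reasoning

module _ {A : Set} where

  sum≤count : (C t : ℕ) (f : A → ℕ) (L : List A) → All (λ k → f k ≤ C) L →
    sum (map f L) ≤ length (filter (λ k → suc t ≤? f k) L) * C + t * length L
  sum≤count C t f [] [] = z≤n
  sum≤count C t f (k ∷ L) (p ∷ ps) with suc t ≤? f k
  ... | yes q rewrite filter-accept (λ k → suc t ≤? f k) {xs = L} q = begin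
    f k + sum (map f L) ≤⟨ +-mono-≤ p (sum≤count C t f L ps) ⟩
    C + (c * C + t * length L) ≡⟨ sym (+-assoc C (c * C) _) ⟩
    (C + c * C) + t * length L ≤⟨ +-monoʳ-≤ (C + c * C) (*-monoʳ-≤ t (n≤1+n _)) ⟩
    (C + c * C) + t * suc (length L) ∎
    where open ≤-Reasoning
          c = length (filter (λ k → suc t ≤? f k) L)
  ... | no ¬q rewrite filter-reject (λ k → suc t ≤? f k) {xs = L} ¬q = begin
    f k + sum (map f L) ≤⟨ +-mono-≤ (≤-pred (≰⇒> ¬q)) (sum≤count C t f L ps) ⟩
    t + (c * C + t * length L) ≡⟨ lemma t (c * C) (length L) ⟩
    c * C + t * suc (length L) ∎
    where open ≤-Reasoning
          c = length (filter (λ k → suc t ≤? f k) L)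
          lemma : ∀ t x l → t + (x + t * l) ≡ x + t * suc l
          lemma = solve-∀

  -- The largest θ reached by at least n elements works: fewer than n elements exceed it, each by
  -- value at most C, and all others contribute at most θ. The search descends from C, and its
  -- failure at one level is exactly the estimate required at the next.
  threshold : (n C : ℕ) (f : A → ℕ) (L : List A) → All (λ k → f k ≤ C) L → n ≤ length L →
    ∃[ θ ] ∃[ L′ ] (θ ≤ C × SublistOfLength n L L′ × All (λ k → θ ≤ f k) L′ ×
      sum (map f L) ≤ n * C + θ * length L)
  threshold n C f L bounded n≤ = descend C ≤-refl (trivial L bounded)
    where
    trivial : ∀ L → All (λ k → f k ≤ C) L → sum (map f L) ≤ n * C + C * length L
    trivial L b = ≤-trans (go L b) (m≤n+m _ (n * C))
      where
      go : ∀ L → All (λ k → f k ≤ C) L → sum (map f L) ≤ C * length L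
      go [] [] = z≤n
      go (k ∷ L) (p ∷ ps) = ≤-trans (+-mono-≤ p (go L ps)) (≤-reflexive (sym (*-suc C (length L))))
    descend : ∀ t → t ≤ C → sum (map f L) ≤ n * C + t * length L →
      ∃[ θ ] ∃[ L′ ] (θ ≤ C × SublistOfLength n L L′ × All (λ k → θ ≤ f k) L′ ×
        sum (map f L) ≤ n * C + θ * length L)
    descend t t≤C inv with n ≤? length (filter (λ k → t ≤? f k) L)
    ... | yes n≤t = t , take n L′ , t≤C ,
          (⊆-trans (take-⊆ n L′) (filter-⊆ (λ k → t ≤? f k) L) , proj₂ (take-sublist n L′ n≤t)) ,
          All-resp-⊆ (take-⊆ n L′) (Allₚ.all-filter (λ k → t ≤? f k) L) , inv
      where L′ = filter (λ k → t ≤? f k) L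
    descend zero t≤C inv | no ¬p =
      ⊥-elim (¬p (subst (n ≤_) (cong length (sym (filter-all (λ k → 0 ≤? f k) (All.universal (λ _ → z≤n) L)))) n≤))
    descend (suc t) t≤C inv | no ¬p = descend t (≤-trans (n≤1+n t) t≤C)
      (≤-trans (sum≤count C t f L bounded) (+-monoˡ-≤ (t * length L) (*-monoˡ-≤ C (<⇒≤ (≰⇒> ¬p)))))

  pad : ∀ {xs P : List A} n → xs ⊆ P → length xs ≤ n → n ≤ length P →
    ∃[ ys ] (xs ⊆ ys × SublistOfLength n P ys)
  pad zero [] _ _ = [] , [] , [] , refl
  pad {P = y ∷ P} n (.y ∷ʳ s) l u with n ≤? length P
  ... | yes u′ with ys , s₁ , s₂ , eq ← pad n s l u′ = ys , s₁ , y ∷ʳ s₂ , eq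
  ... | no ¬u′ = y ∷ P , y ∷ʳ s , ⊆-refl , ≤-antisym (≰⇒> ¬u′) u
  pad (suc n) (refl ∷ s) (s≤s l) (s≤s u) with ys , s₁ , s₂ , eq ← pad n s l u =
    _ ∷ ys , refl ∷ s₁ , refl ∷ s₂ , cong suc eq

  carve : (p k : ℕ) (xs : List A) → p + suc k ≤ length xs →
    ∃[ L ] ∃[ i ] ∃[ rest ] (xs ≡ L ++ i ∷ rest × length L ≡ p × k ≤ length rest)
  carve zero    k (x ∷ xs) (s≤s le) = [] , x , xs , refl , refl , le
  carve (suc p) k (x ∷ xs) (s≤s le) with L , i , rest , eq , l , r ← carve p k xs le =
    x ∷ L , i , rest , cong (x ∷_) eq , cong suc l , r

  -- Before, between and after the elements of the first list there are at least n elements of the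
  -- second. These gaps allow an incomplete tuple of indices to be filled up to the fixed length
  -- that Ramsey's theorem speaks about.
  data Spaced (n : ℕ) : List A → List A → Set where
    end  : ∀ {B} → n ≤ length B → Spaced n [] B
    step : ∀ {B i J Ms} → n ≤ length B → Spaced n J Ms → Spaced n (i ∷ J) (B ++ i ∷ Ms)

  spacedLength : ∀ n t → n + suc (t * suc n + n) ≡ suc t * suc n + n
  spacedLength = solve-∀

  spacedSublist : (n t : ℕ) (Ms : List A) → t * suc n + n ≤ length Ms → ∃[ J ] (Spaced n J Ms × length J ≡ t)
  spacedSublist n zero Ms le = [] , end le , refl
  spacedSublist n (suc t) Ms le
    with B , i , rest , refl , lB , lr ← carve n (t * suc n + n) Ms (≤-trans (≤-reflexive (spacedLength n t)) le)
    with J , sp , lJ ← spacedSublist n t rest lr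
    = i ∷ J , step (≤-reflexive (sym lB)) sp , cong suc lJ

  spaced⇒⊆ : ∀ {n J Ms} → Spaced n J Ms → J ⊆ Ms
  spaced⇒⊆ (end _) = minimum _
  spaced⇒⊆ (step {B} _ sp) = ++⁺ˡ B (refl ∷ spaced⇒⊆ sp)

  spaced⇒≤ : ∀ {n J Ms} → Spaced n J Ms → n ≤ length Ms
  spaced⇒≤ (end le) = le
  spaced⇒≤ (step {B} le _) = ≤-trans le (≤-trans (m≤m+n _ _) (≤-reflexive (sym (length-++ B))))

  spaced-split : ∀ {n} ls {i rest Ms} → Spaced n (ls ++ i ∷ rest) Ms →
    ∃[ P ] ∃[ Q ] (Ms ≡ P ++ i ∷ Q × ls ⊆ P × n ≤ length P × Spaced n rest Q)
  spaced-split [] (step {B} {Ms = Ms} le sp) = B , Ms , refl , minimum B , le , sp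
  spaced-split (l ∷ ls) {i} (step {B} le sp) with P , Q , refl , s , _ , sp′ ← spaced-split ls sp =
    B ++ l ∷ P , Q , sym (++-assoc B (l ∷ P) (i ∷ Q)) , ++⁺ˡ B (refl ∷ s) ,
    ≤-trans le (≤-trans (m≤m+n _ _) (≤-reflexive (sym (length-++ B)))) , sp′

  take-length-++ : (xs ys : List A) → take (length xs) (xs ++ ys) ≡ xs
  take-length-++ []       ys = refl
  take-length-++ (x ∷ xs) ys = cong (x ∷_) (take-length-++ xs ys)

  drop-length-++ : (xs ys : List A) → drop (length xs) (xs ++ ys) ≡ ys
  drop-length-++ []       ys = refl
  drop-length-++ (x ∷ xs) ys = drop-length-++ xs ys

  secondPivot : (List A → A → List A → Bool) → List A → List A → Bool
  secondPivot f cs []       = false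
  secondPivot f cs (j ∷ rs) = f cs j rs

  firstPivot : ℕ → (List A → A → List A → A → List A → Bool) → List A → List A → Bool
  firstPivot n f ls []       = false
  firstPivot n f ls (i ∷ ys) = secondPivot (f ls i) (take n ys) (drop n ys)

  -- Reads a list as n elements, a pivot, n elements, a pivot and the rest. A property of a pair
  -- together with index sets to its left, inside it and to its right thus becomes a colouring of
  -- sublists; lists that are too short receive `false`.
  atPivots : ℕ → (List A → A → List A → A → List A → Bool) → List A → Bool
  atPivots n f zs = firstPivot n f (take n zs) (drop n zs)

  atPivots-≡ : ∀ f ls i cs j rs n → length ls ≡ n → length cs ≡ n →
    atPivots n f (ls ++ i ∷ cs ++ j ∷ rs) ≡ f ls i cs j rs
  atPivots-≡ f ls i cs j rs n refl l₂
    rewrite take-length-++ ls (i ∷ cs ++ j ∷ rs) | drop-length-++ ls (i ∷ cs ++ j ∷ rs)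
          | sym l₂ | take-length-++ cs (j ∷ rs) | drop-length-++ cs (j ∷ rs) = refl

Sorted : ∀ {N} → List (Fin N) → Set
Sorted = AllPairs Fin._<_

Sorted-⊆ : ∀ {N} {xs ys : List (Fin N)} → xs ⊆ ys → Sorted ys → Sorted xs
Sorted-⊆ [] [] = []
Sorted-⊆ (y ∷ʳ s) (_ ∷ ss) = Sorted-⊆ s ss
Sorted-⊆ (refl ∷ s) (a ∷ ss) = All-resp-⊆ s a ∷ Sorted-⊆ s ss

splitSorted : ∀ {N} {J : List (Fin N)} {i} → Sorted J → i ∈ J →
  ∃[ ls ] ∃[ rs ] (J ≡ ls ++ i ∷ rs × All (Fin._< i) ls × All (i Fin.<_) rs × Sorted rs)
splitSorted (a ∷ s) (here refl) = [] , _ , refl , [] , a , s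
splitSorted (a ∷ s) (there i∈) with ls , rs , refl , al , ar , s′ ← splitSorted s i∈ =
  _ ∷ ls , rs , refl , All.lookup a i∈ ∷ al , ar , s′

-- Makes a choice into a total function. Vertices are guaranteed only for pairs from the selected
-- index list, but a single function on all pairs is wanted; elsewhere the value is the default
-- `x₀`.
search : ∀ {n} {P : Fin n → Set} → (∀ x → Dec (P x)) → Fin n → Fin n
search P? x₀ with Finₚ.any? P?
... | yes (x , _) = x
... | no _ = x₀

search-correct : ∀ {n} {P : Fin n → Set} (P? : ∀ x → Dec (P x)) (x₀ : Fin n) → ∃ P → P (search P? x₀)
search-correct P? x₀ ex with Finₚ.any? P?
... | yes (_ , p) = p
... | no ¬p = ⊥-elim (¬p ex)

-- Selecting one vertex per pair

sorted-split : ∀ {N} (ls : List (Fin N)) {i rs} → Sorted (ls ++ i ∷ rs) →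
  All (Fin._< i) ls × All (i Fin.<_) rs × Sorted rs
sorted-split [] (a ∷ s) = [] , a , s
sorted-split (l ∷ ls) (a ∷ s) with al , ar , s′ ← sorted-split ls s =
  All.head (Allₚ.++⁻ʳ ls a) ∷ al , ar , s′

∈-right : ∀ {N} {i j : Fin N} {ls rest} → i Fin.< j → All (Fin._< i) ls → j ∈ ls ++ i ∷ rest → j ∈ rest
∈-right {ls = ls} i<j al j∈ with ∈-++⁻ ls j∈
... | inj₁ j∈ls        = ⊥-elim (<-asym i<j (All.lookup al j∈ls))
... | inj₂ (here refl) = ⊥-elim (<-irrefl refl i<j)
... | inj₂ (there j∈)  = j∈

∈-left : ∀ {N} {i j : Fin N} {ls rest} → j Fin.< i → All (i Fin.<_) rest → j ∈ ls ++ i ∷ rest → j ∈ ls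
∈-left {ls = ls} j<i ar j∈ with ∈-++⁻ ls j∈
... | inj₁ j∈ls        = j∈ls
... | inj₂ (here refl) = ⊥-elim (<-irrefl refl j<i)
... | inj₂ (there j∈)  = ⊥-elim (<-asym j<i (All.lookup ar j∈))

-- More than 3nC, so that the error nC of `threshold` in each of the three pools is lost in the
-- integer average, and more than n, so that each pool can supply n indices.
poolSize : ℕ → ℕ → ℕ
poolSize n C = suc (3 * (n * C) + n)

thresholds : ℕ → List (ℕ × ℕ × ℕ)
thresholds C = cartesianProduct (upTo (suc C)) (cartesianProduct (upTo (suc C)) (upTo (suc C)))

-- The homogeneous list is used twice: it must hold three pools with two pivots, where the
-- thresholds are found, and also a spaced sublist of n elements, which becomes the result.
homogeneousLength : ℕ → ℕ → ℕ
homogeneousLength n C = (poolSize n C + suc (poolSize n C + suc (poolSize n C))) + (n * suc n + n)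

selectionBound : ℕ → ℕ → ℕ
selectionBound n C = multiRamseyBound (length (thresholds C)) (n + suc (n + suc n)) (homogeneousLength n C)

average-threshold : ∀ p e c θ → e < p → p * c ≤ e + θ * p → c ≤ θ
average-threshold p e c θ e<p le = ≮⇒≥ λ θ<c → <⇒≱ e<p (+-cancelʳ-≤ (θ * p) p e (begin
  suc θ * p ≤⟨ *-monoˡ-≤ p θ<c ⟩
  c * p ≡⟨ *-comm c p ⟩
  p * c ≤⟨ le ⟩
  e + θ * p ∎))
  where open ≤-Reasoning

sumOfThresholds : ∀ e a b c p → (e + c * p + (e + b * p)) + (e + a * p) ≡ 3 * e + (a + b + c) * p
sumOfThresholds = solve-∀

withLength : ∀ {l p} s e θ → l ≡ p → s ≤ e + θ * l → s ≤ e + θ * p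
withLength s e θ refl le = le

isYes-true : ∀ {P : Set} (d : Dec P) → P → ⌊ d ⌋ ≡ true
isYes-true (yes _) p = refl
isYes-true (no ¬p) p = ⊥-elim (¬p p)

true-isYes : ∀ {P : Set} (d : Dec P) → ⌊ d ⌋ ≡ true → P
true-isYes (yes p) _ = p

module _ {N M : ℕ} (w : Fin N → Fin N → Fin M → ℕ) (v₁ v₂ v₃ : Fin N → Fin N → Fin M → Fin N → ℕ) where

  -- The subscript is the role of the pair in the sorted triad: `v₁` applies when the third index
  -- lies to the right of the pair, `v₂` when it lies inside, `v₃` when it lies to the left. Hence
  -- `ls` is tested against θ₃ and `rs` against θ₁.
  Fits : ℕ × ℕ × ℕ → List (Fin N) → Fin N → List (Fin N) → Fin N → List (Fin N) → Fin M → Set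
  Fits (θ₁ , θ₂ , θ₃) ls i cs j rs x = 0 < w i j x × All (λ k → θ₃ ≤ v₃ i j x k) ls ×
    All (λ k → θ₂ ≤ v₂ i j x k) cs × All (λ k → θ₁ ≤ v₁ i j x k) rs

  Selected : ℕ → ℕ → List (Fin N) → Set
  Selected n c I = ∃[ J ] Σ (Fin N → Fin N → Fin M) λ x → (SublistOfLength n I J ×
    (∀ {i j} → i ∈ J → j ∈ J → i Fin.< j → 0 < w i j (x i j)) ×
    (∀ {i j k} → i ∈ J → j ∈ J → k ∈ J → i Fin.< j → j Fin.< k →
      3 * c ≤ v₁ i j (x i j) k + v₂ i k (x i k) j + v₃ j k (x j k) i))

  fits? : ∀ θ ls i cs j rs x → Dec (Fits θ ls i cs j rs x)
  fits? (θ₁ , θ₂ , θ₃) ls i cs j rs x = (0 <? w i j x) ×-dec (all? (λ k → θ₃ ≤? v₃ i j x k) ls) ×-dec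
    (all? (λ k → θ₂ ≤? v₂ i j x k) cs) ×-dec (all? (λ k → θ₁ ≤? v₁ i j x k) rs)

  fittable? : ∀ θ ls i cs j rs → Dec (∃ (Fits θ ls i cs j rs))
  fittable? θ ls i cs j rs = Finₚ.any? (fits? θ ls i cs j rs)

  fittable : ℕ → ℕ × ℕ × ℕ → List (Fin N) → Bool
  fittable n θ = atPivots n (λ ls i cs j rs → ⌊ fittable? θ ls i cs j rs ⌋)

  fittable⁺ : ∀ {n θ} ls i cs j rs → length ls ≡ n → length cs ≡ n → ∃ (Fits θ ls i cs j rs) →
    fittable n θ (ls ++ i ∷ cs ++ j ∷ rs) ≡ true
  fittable⁺ {n} {θ} ls i cs j rs lls lcs fit =
    trans (atPivots-≡ (λ ls i cs j rs → ⌊ fittable? θ ls i cs j rs ⌋) ls i cs j rs n lls lcs)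
      (isYes-true (fittable? θ ls i cs j rs) fit)

  fittable⁻ : ∀ {n θ} ls i cs j rs → length ls ≡ n → length cs ≡ n →
    fittable n θ (ls ++ i ∷ cs ++ j ∷ rs) ≡ true → ∃ (Fits θ ls i cs j rs)
  fittable⁻ {n} {θ} ls i cs j rs lls lcs eq = true-isYes (fittable? θ ls i cs j rs)
    (trans (sym (atPivots-≡ (λ ls i cs j rs → ⌊ fittable? θ ls i cs j rs ⌋) ls i cs j rs n lls lcs)) eq)

  module _ (n C c : ℕ)
    (bounded₁ : ∀ {i j k} → i Fin.< j → j Fin.< k → ∀ x → v₁ i j x k ≤ C)
    (bounded₂ : ∀ {i j k} → i Fin.< j → j Fin.< k → ∀ x → v₂ i k x j ≤ C)
    (bounded₃ : ∀ {i j k} → i Fin.< j → j Fin.< k → ∀ x → v₃ j k x i ≤ C)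
    (average₁ : ∀ {i j k} → i Fin.< j → j Fin.< k → c * ∑ M (w i j) ≤ ∑ M (λ x → w i j x * v₁ i j x k))
    (average₂ : ∀ {i j k} → i Fin.< j → j Fin.< k → c * ∑ M (w i k) ≤ ∑ M (λ x → w i k x * v₂ i k x j))
    (average₃ : ∀ {i j k} → i Fin.< j → j Fin.< k → c * ∑ M (w j k) ≤ ∑ M (λ x → w j k x * v₃ j k x i))
    (positive : ∀ {i j} → i Fin.< j → 0 < ∑ M (w i j))
    where

    -- All 3p averages are taken over the same weighted set `w i j`, so they may be added before a
    -- vertex is chosen. The bound concerns only the total over the three roles; nothing is claimed
    -- for a single role.
    poolVertex : ∀ p i j L Cs R → i Fin.< j → length L ≡ p → length Cs ≡ p → length R ≡ p →
      All (Fin._< i) L → All (λ k → i Fin.< k × k Fin.< j) Cs → All (j Fin.<_) R →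
      ∃[ x ] (0 < w i j x ×
        p * (3 * c) ≤ sum (map (v₃ i j x) L) + sum (map (v₂ i j x) Cs) + sum (map (v₁ i j x) R))
    poolVertex p i j L Cs R i<j lL lC lR aL aC aR = weightedAverage (w i j) _ (p * (3 * c)) (positive i<j) (begin
      p * (3 * c) * W ≡⟨ lemma p c W ⟩
      (p * c * W + p * c * W) + p * c * W
        ≤⟨ +-mono-≤ (+-mono-≤ (avg v₃ L lL (All.map (λ k<i → average₃ k<i i<j) aL))
                              (avg v₂ Cs lC (All.map (λ { (i<k , k<j) → average₂ i<k k<j }) aC)))
                    (avg v₁ R lR (All.map (λ j<k → average₁ i<j j<k) aR)) ⟩
      (∑ M (λ x → w i j x * s₃ x) + ∑ M (λ x → w i j x * s₂ x)) + ∑ M (λ x → w i j x * s₁ x)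
        ≡⟨ cong (_+ ∑ M (λ x → w i j x * s₁ x)) (sym (∑-+ (λ x → w i j x * s₃ x) _)) ⟩
      ∑ M (λ x → w i j x * s₃ x + w i j x * s₂ x) + ∑ M (λ x → w i j x * s₁ x)
        ≡⟨ sym (∑-+ (λ x → w i j x * s₃ x + w i j x * s₂ x) _) ⟩
      ∑ M (λ x → w i j x * s₃ x + w i j x * s₂ x + w i j x * s₁ x)
        ≡⟨ ∑-cong (λ x → distrib (w i j x) (s₃ x) (s₂ x) (s₁ x)) ⟩
      ∑ M (λ x → w i j x * (s₃ x + s₂ x + s₁ x)) ∎)
      where
      open ≤-Reasoning
      W = ∑ M (w i j)
      s₁ s₂ s₃ : Fin M → ℕ
      s₁ x = sum (map (v₁ i j x) R)
      s₂ x = sum (map (v₂ i j x) Cs)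
      s₃ x = sum (map (v₃ i j x) L)
      lemma : ∀ p c W → p * (3 * c) * W ≡ (p * c * W + p * c * W) + p * c * W
      lemma = solve-∀
      distrib : ∀ a x y z → a * x + a * y + a * z ≡ a * (x + y + z)
      distrib = solve-∀
      avg : ∀ v (Ks : List (Fin N)) → length Ks ≡ p →
        All (λ k → c * W ≤ ∑ M (λ x → w i j x * v i j x k)) Ks →
        p * c * W ≤ ∑ M (λ x → w i j x * sum (map (v i j x) Ks))
      avg v Ks len a = subst (λ l → l * c * W ≤ _) len (∑-sum (w i j) (v i j) c Ks a)

    n≤pool : ∀ {l p} → 3 * (n * C) + n < p → l ≡ p → n ≤ l
    n≤pool large len = ≤-trans (m≤n+m n (3 * (n * C))) (≤-trans (<⇒≤ large) (≤-reflexive (sym len)))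

    SomeFit : Fin N → Fin N → List (Fin N) → List (Fin N) → List (Fin N) → Set
    SomeFit i j L Cs R =
      ∃[ θ ] ∃[ ls ] ∃[ cs ] ∃[ rs ] (θ ∈ thresholds C × 3 * c ≤ proj₁ θ + proj₁ (proj₂ θ) + proj₂ (proj₂ θ) ×
        SublistOfLength n L ls × SublistOfLength n Cs cs × SublistOfLength n R rs × ∃ (Fits θ ls i cs j rs))

    someFits : ∀ p → 3 * (n * C) + n < p → ∀ i j L Cs R → i Fin.< j → length L ≡ p → length Cs ≡ p → length R ≡ p →
      All (Fin._< i) L → All (λ k → i Fin.< k × k Fin.< j) Cs → All (j Fin.<_) R →
      SomeFit i j L Cs R
    someFits p large i j L Cs R i<j lL lC lR aL aC aR
      with x , 0<w , le ← poolVertex p i j L Cs R i<j lL lC lR aL aC aR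
      with θ₃ , ls , θ₃≤ , sls , als , sum₃ ← threshold n C (v₃ i j x) L (All.map (λ k<i → bounded₃ k<i i<j x) aL) (n≤pool large lL)
      with θ₂ , cs , θ₂≤ , scs , acs , sum₂ ← threshold n C (v₂ i j x) Cs (All.map (λ { (i<k , k<j) → bounded₂ i<k k<j x }) aC) (n≤pool large lC)
      with θ₁ , rs , θ₁≤ , srs , ars , sum₁ ← threshold n C (v₁ i j x) R (All.map (λ j<k → bounded₁ i<j j<k x) aR) (n≤pool large lR)
      = (θ₁ , θ₂ , θ₃) , ls , cs , rs ,
        ∈-cartesianProduct⁺ (∈-upTo⁺ (s≤s θ₁≤)) (∈-cartesianProduct⁺ (∈-upTo⁺ (s≤s θ₂≤)) (∈-upTo⁺ (s≤s θ₃≤))) ,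
        average-threshold p (3 * (n * C)) (3 * c) (θ₁ + θ₂ + θ₃) (≤-<-trans (m≤m+n _ n) large) (≤-trans le (≤-trans
          (+-mono-≤ (+-mono-≤ (withLength _ (n * C) θ₃ lL sum₃) (withLength _ (n * C) θ₂ lC sum₂)) (withLength _ (n * C) θ₁ lR sum₁))
          (≤-reflexive (sumOfThresholds (n * C) θ₁ θ₂ θ₃ p)))) ,
        sls , scs , srs , x , 0<w , als , acs , ars

    tuple-length : ∀ ls {i} cs {j} (rs : List (Fin N)) → length ls ≡ n → length cs ≡ n → length rs ≡ n →
      length (ls ++ i ∷ cs ++ j ∷ rs) ≡ n + suc (n + suc n)
    tuple-length ls cs rs lls lcs lrs =
      trans (length-++ ls) (cong₂ _+_ lls (cong suc (trans (length-++ cs) (cong₂ _+_ lcs (cong suc lrs)))))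

    -- Homogeneity alone leaves the colour unknown. One fitting tuple, supplied by the pools,
    -- settles it for all tuples.
    constant-true : ∀ {θ Ms} → Homogeneous (n + suc (n + suc n)) Ms (fittable n θ) →
      ∀ ls i cs j rs → length ls ≡ n → length cs ≡ n → length rs ≡ n → ls ++ i ∷ cs ++ j ∷ rs ⊆ Ms →
      ∃ (Fits θ ls i cs j rs) → Constant (n + suc (n + suc n)) (fittable n θ) Ms true
    constant-true (b , hom) ls i cs j rs lls lcs lrs sub fit zs zs⊆ l =
      trans (hom zs zs⊆ l) (trans (sym (hom (ls ++ i ∷ cs ++ j ∷ rs) sub (tuple-length ls cs rs lls lcs lrs)))
        (fittable⁺ ls i cs j rs lls lcs fit))

    HomogeneousThreshold : List (Fin N) → Set
    HomogeneousThreshold Ms = ∃[ θ ] (3 * c ≤ proj₁ θ + proj₁ (proj₂ θ) + proj₂ (proj₂ θ) ×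
      Constant (n + suc (n + suc n)) (fittable n θ) Ms true)

    homogeneousFit : ∀ {Ms} → All (Homogeneous (n + suc (n + suc n)) Ms) (map (fittable n) (thresholds C)) →
      ∀ {i j L Cs R} → L ++ i ∷ Cs ++ j ∷ R ⊆ Ms → SomeFit i j L Cs R → HomogeneousThreshold Ms
    homogeneousFit homs sub (θ , ls , cs , rs , θ∈ , le , (ls⊆ , lls) , (cs⊆ , lcs) , (rs⊆ , lrs) , fit) =
      θ , le , constant-true (All.lookup homs (∈-map⁺ (fittable n) θ∈)) ls _ cs _ rs lls lcs lrs
        (⊆-trans (++⁺ ls⊆ (refl ∷ ++⁺ cs⊆ (refl ∷ rs⊆))) sub) fit

    pools : ∀ p → 3 * (n * C) + n < p → (Ms : List (Fin N)) → Sorted Ms →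
      p + suc (p + suc p) ≤ length Ms →
      ∃[ i ] ∃[ j ] ∃[ L ] ∃[ Cs ] ∃[ R ] (L ++ i ∷ Cs ++ j ∷ R ⊆ Ms × SomeFit i j L Cs R)
    pools p large Ms sorted long
      with L , i , rest , refl , lL , long₂ ← carve p (p + suc p) Ms long
      with Cs , j , rest₂ , refl , lC , long₃ ← carve p p rest long₂
      with aL , aR₀ , sorted₂ ← sorted-split L sorted
      with aC , aR₁ , _ ← sorted-split Cs sorted₂
      = i , j , L , Cs , take p rest₂ , ++⁺ (⊆-refl {x = L}) (refl ∷ ++⁺ (⊆-refl {x = Cs}) (refl ∷ take-⊆ p rest₂)) ,
        someFits p large i j L Cs (take p rest₂) (All.head (Allₚ.++⁻ʳ Cs aR₀)) lL lC
          (proj₂ (take-sublist p rest₂ long₃)) aL (All.zip (Allₚ.++⁻ˡ Cs aR₀ , aC))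
          (All-resp-⊆ (take-⊆ p rest₂) aR₁)

    homogeneousThreshold : ∀ p → 3 * (n * C) + n < p → (Ms : List (Fin N)) → Sorted Ms →
      p + suc (p + suc p) ≤ length Ms →
      All (Homogeneous (n + suc (n + suc n)) Ms) (map (fittable n) (thresholds C)) → HomogeneousThreshold Ms
    homogeneousThreshold p large Ms sorted long homs = go (pools p large Ms sorted long)
      where
      go : ∃[ i ] ∃[ j ] ∃[ L ] ∃[ Cs ] ∃[ R ] (L ++ i ∷ Cs ++ j ∷ R ⊆ Ms × SomeFit i j L Cs R) → HomogeneousThreshold Ms
      go (_ , _ , _ , _ , _ , sub , fit) = homogeneousFit homs sub fit

    below between above : List (Fin N) → Fin N → Fin N → List (Fin N)
    below   J i j = filter (λ k → k Finₚ.<? i) J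
    between J i j = filter (λ k → (i Finₚ.<? k) ×-dec (k Finₚ.<? j)) J
    above   J i j = filter (λ k → j Finₚ.<? k) J

    PaddedTuple : List (Fin N) → Fin N → List (Fin N) → Fin N → List (Fin N) → List (Fin N) → Set
    PaddedTuple ls i cs j rs Ms = ∃[ ls′ ] ∃[ cs′ ] ∃[ rs′ ] (ls ⊆ ls′ × cs ⊆ cs′ × rs ⊆ rs′ ×
      length ls′ ≡ n × length cs′ ≡ n × length rs′ ≡ n × ls′ ++ i ∷ cs′ ++ j ∷ rs′ ⊆ Ms)

    -- The selected indices to the left of, inside and to the right of a pair vary in number, at
    -- most n each. The missing ones are taken from the gaps of `Ms`; the thresholds at these
    -- additional indices are simply forgotten afterwards.
    paddedTuple : ∀ ls {i} cs {j} rs {Ms} → Spaced n (ls ++ i ∷ cs ++ j ∷ rs) Ms →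
      length ls ≤ n → length cs ≤ n → length rs ≤ n → PaddedTuple ls i cs j rs Ms
    paddedTuple ls cs rs sp ls≤ cs≤ rs≤
      with P , Ms₂ , refl , ls⊆ , n≤P , sp₂ ← spaced-split ls sp
      with P₂ , Ms₃ , refl , cs⊆ , n≤P₂ , sp₃ ← spaced-split cs sp₂
      with ls′ , ls⊆ls′ , ls′⊆ , lls ← pad n ls⊆ ls≤ n≤P
      with cs′ , cs⊆cs′ , cs′⊆ , lcs ← pad n cs⊆ cs≤ n≤P₂
      with rs′ , rs⊆rs′ , rs′⊆ , lrs ← pad n (spaced⇒⊆ sp₃) rs≤ (spaced⇒≤ sp₃)
      = ls′ , cs′ , rs′ , ls⊆ls′ , cs⊆cs′ , rs⊆rs′ , lls , lcs , lrs ,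
        ++⁺ ls′⊆ (refl ∷ ++⁺ cs′⊆ (refl ∷ rs′⊆))

    Fits-⊆ : ∀ {θ ls ls′ i cs cs′ j rs rs′} → ls ⊆ ls′ → cs ⊆ cs′ → rs ⊆ rs′ →
      ∃ (Fits θ ls′ i cs′ j rs′) → ∃ (Fits θ ls i cs j rs)
    Fits-⊆ ls⊆ cs⊆ rs⊆ (x , 0<w , all₃ , all₂ , all₁) =
      x , 0<w , All-resp-⊆ ls⊆ all₃ , All-resp-⊆ cs⊆ all₂ , All-resp-⊆ rs⊆ all₁

    splitFits : ∀ {θ Ms} → Constant (n + suc (n + suc n)) (fittable n θ) Ms true →
      ∀ {ls i cs j rs} → PaddedTuple ls i cs j rs Ms → ∃ (Fits θ ls i cs j rs)
    splitFits const {i = i} {j = j} (ls′ , cs′ , rs′ , ls⊆ , cs⊆ , rs⊆ , lls , lcs , lrs , tuple⊆) =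
      Fits-⊆ ls⊆ cs⊆ rs⊆ (fittable⁻ ls′ i cs′ j rs′ lls lcs
        (const (ls′ ++ i ∷ cs′ ++ j ∷ rs′) tuple⊆ (tuple-length ls′ cs′ rs′ lls lcs lrs)))

    restrictFits : ∀ {θ} ls {i} cs {j rs} → All (Fin._< i) ls → All (i Fin.<_) (cs ++ j ∷ rs) →
      All (Fin._< j) cs → All (j Fin.<_) rs → i Fin.< j → let J = ls ++ i ∷ cs ++ j ∷ rs in
      ∃ (Fits θ ls i cs j rs) → ∃ (Fits θ (below J i j) i (between J i j) j (above J i j))
    restrictFits ls {i} cs {j} al ar ac ar₂ i<j (x , 0<w , all₃ , all₂ , all₁) = x , 0<w ,
      All.tabulate (λ k∈ → let k∈J , k<i = ∈-filter⁻ (λ k → k Finₚ.<? i) k∈ in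
        All.lookup all₃ (∈-left k<i ar k∈J)) ,
      All.tabulate (λ k∈ → let k∈J , i<k , k<j = ∈-filter⁻ (λ k → (i Finₚ.<? k) ×-dec (k Finₚ.<? j)) k∈ in
        All.lookup all₂ (∈-left k<j ar₂ (∈-right i<k al k∈J))) ,
      All.tabulate (λ k∈ → let k∈J , j<k = ∈-filter⁻ (λ k → j Finₚ.<? k) k∈ in
        All.lookup all₁ (∈-right j<k ac (∈-right (Finₚ.<-trans i<j j<k) al k∈J)))

    spacedFits : ∀ {J Ms} → Spaced n J Ms → length J ≡ n → Sorted J → ∀ {i j} → i ∈ J → j ∈ J → i Fin.< j →
      ∀ {θ} → Constant (n + suc (n + suc n)) (fittable n θ) Ms true →
      ∃ (Fits θ (below J i j) i (between J i j) j (above J i j))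
    spacedFits sp lJ sorted {i} {j} i∈ j∈ i<j
      with ls , rest , refl , al , ar , sorted₂ ← splitSorted sorted i∈
      with cs , rs , refl , ac , ar₂ , _ ← splitSorted sorted₂ (∈-right i<j al j∈)
      = λ const → restrictFits ls cs al ar ac ar₂ i<j (splitFits const (paddedTuple ls cs rs sp
            (≤-trans (length-mono-≤ (++⁺ʳ (i ∷ cs ++ j ∷ rs) (⊆-refl {x = ls}))) (≤-reflexive lJ))
            (≤-trans (length-mono-≤ (++⁺ˡ ls (i ∷ʳ ++⁺ʳ (j ∷ rs) (⊆-refl {x = cs})))) (≤-reflexive lJ))
            (≤-trans (length-mono-≤ (++⁺ˡ ls (i ∷ʳ ++⁺ˡ cs (j ∷ʳ ⊆-refl {x = rs})))) (≤-reflexive lJ))))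

    selection : (x₀ : Fin M) (I : List (Fin N)) → Sorted I → selectionBound n C ≤ length I →
      Selected n c I
    selection x₀ I sorted long = chooseHomogeneous
      (multiRamsey (n + suc (n + suc n)) (homogeneousLength n C) (map (fittable n) (thresholds C)) I
        (subst (λ l → multiRamseyBound l (n + suc (n + suc n)) (homogeneousLength n C) ≤ length I)
          (sym (length-map (fittable n) (thresholds C))) long))
      where
      chooseSpaced : ∀ {Ms} → Ms ⊆ I → HomogeneousThreshold Ms → ∃[ J ] (Spaced n J Ms × length J ≡ n) → Selected n c I
      chooseSpaced Ms⊆ (θ@(θ₁ , θ₂ , θ₃) , 3c≤ , const) (J , sp , lJ) = J , x , (⊆-trans (spaced⇒⊆ sp) Ms⊆ , lJ) ,
        (λ i∈ j∈ i<j → proj₁ (fits i∈ j∈ i<j)) ,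
        -- Three different vertices contribute: that of ij gives θ₁ at k, that of ik gives θ₂ at j,
        -- that of jk gives θ₃ at i. The sum is useful only because θ is the same for all three
        -- pairs.
        λ {i} {j} {k} i∈ j∈ k∈ i<j j<k → ≤-trans 3c≤ (+-mono-≤ (+-mono-≤
          (All.lookup (proj₂ (proj₂ (proj₂ (fits i∈ j∈ i<j)))) (∈-filter⁺ (λ l → j Finₚ.<? l) k∈ j<k))
          (All.lookup (proj₁ (proj₂ (proj₂ (fits i∈ k∈ (Finₚ.<-trans i<j j<k)))))
            (∈-filter⁺ (λ l → (i Finₚ.<? l) ×-dec (l Finₚ.<? k)) j∈ (i<j , j<k))))
          (All.lookup (proj₁ (proj₂ (fits j∈ k∈ j<k))) (∈-filter⁺ (λ l → l Finₚ.<? j) i∈ i<j)))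
        where
        fitting? : ∀ i j x → Dec (Fits θ (below J i j) i (between J i j) j (above J i j) x)
        fitting? i j = fits? θ (below J i j) i (between J i j) j (above J i j)
        x : Fin N → Fin N → Fin M
        x i j = search (fitting? i j) x₀
        fits : ∀ {i j} → i ∈ J → j ∈ J → i Fin.< j → Fits θ (below J i j) i (between J i j) j (above J i j) (x i j)
        fits {i} {j} i∈ j∈ i<j = search-correct (fitting? i j) x₀
          (spacedFits sp lJ (Sorted-⊆ (⊆-trans (spaced⇒⊆ sp) Ms⊆) sorted) i∈ j∈ i<j const)

      chooseHomogeneous : ∃[ Ms ] (SublistOfLength (homogeneousLength n C) I Ms ×
        All (Homogeneous (n + suc (n + suc n)) Ms) (map (fittable n) (thresholds C))) → Selected n c I
      chooseHomogeneous (Ms , (Ms⊆ , lMs) , homs) = chooseSpaced Ms⊆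
        (homogeneousThreshold (poolSize n C) ≤-refl Ms (Sorted-⊆ Ms⊆ sorted)
          (≤-trans (m≤m+n (poolSize n C + suc (poolSize n C + suc (poolSize n C))) _) (≤-reflexive (sym lMs))) homs)
        (spacedSublist n n Ms (≤-trans (m≤n+m (n * suc n + n) (poolSize n C + suc (poolSize n C + suc (poolSize n C)))) (≤-reflexive (sym lMs))))

-- Trilinear forms

-- The integral of `f` against the measure `α`. Measures are left unnormalised so that all
-- computations stay in ℕ.
pairing : ∀ {n} → (Fin n → ℕ) → (Fin n → ℕ) → ℕ
pairing {n} α f = ∑ n (λ x → α x * f x)

pairing-cong : ∀ {n} {α α′ f f′ : Fin n → ℕ} → (∀ x → α x ≡ α′ x) → (∀ x → f x ≡ f′ x) →
  pairing α f ≡ pairing α′ f′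
pairing-cong p q = ∑-cong (λ x → cong₂ _*_ (p x) (q x))

pairing-+ˡ : ∀ {n} (α β f : Fin n → ℕ) → pairing (λ x → α x + β x) f ≡ pairing α f + pairing β f
pairing-+ˡ α β f = trans (∑-cong (λ x → *-distribʳ-+ (f x) (α x) (β x))) (∑-+ (λ x → α x * f x) (λ x → β x * f x))

pairing-bound : ∀ {n} (α f : Fin n → ℕ) c → (∀ x → f x ≤ c) → pairing α f ≤ ∑ n α * c
pairing-bound {n} α f c le = ≤-trans (∑-mono (λ x → *-monoʳ-≤ (α x) (le x))) (≤-reflexive (∑-*ʳ c α))

pairing-swap : ∀ {m n} (α : Fin m → ℕ) (β : Fin n → ℕ) (g : Fin m → Fin n → ℕ) →
  pairing α (λ x → pairing β (g x)) ≡ pairing β (λ y → pairing α (λ x → g x y))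
pairing-swap {m} {n} α β g = begin
  ∑ m (λ x → α x * ∑ n (λ y → β y * g x y)) ≡⟨ ∑-cong (λ x → sym (∑-*ˡ (α x) (λ y → β y * g x y))) ⟩
  ∑ m (λ x → ∑ n (λ y → α x * (β y * g x y))) ≡⟨ ∑-swap (λ x y → α x * (β y * g x y)) ⟩
  ∑ n (λ y → ∑ m (λ x → α x * (β y * g x y))) ≡⟨ ∑-cong (λ y → ∑-cong (λ x → comm (α x) (β y) (g x y))) ⟩
  ∑ n (λ y → ∑ m (λ x → β y * (α x * g x y))) ≡⟨ ∑-cong (λ y → ∑-*ˡ (β y) (λ x → α x * g x y)) ⟩
  ∑ n (λ y → β y * ∑ m (λ x → α x * g x y)) ∎
  where
  open ≡-Reasoning
  comm : ∀ a b c → a * (b * c) ≡ b * (a * c)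
  comm = solve-∀

point : ∀ {n} → Fin n → Fin n → ℕ
point Fin.zero    Fin.zero    = 1
point Fin.zero    (Fin.suc y) = 0
point (Fin.suc x) Fin.zero    = 0
point (Fin.suc x) (Fin.suc y) = point x y

pairing-point : ∀ {n} (x : Fin n) (f : Fin n → ℕ) → pairing (point x) f ≡ f x
pairing-point {suc n} Fin.zero f = trans (cong₂ _+_ (+-identityʳ (f Fin.zero)) (trans (∑-const n 0) (*-zeroʳ n)))
  (+-identityʳ (f Fin.zero))
pairing-point (Fin.suc x) f = pairing-point x (λ y → f (Fin.suc y))

∑-point : ∀ {n} (x : Fin n) → ∑ n (point x) ≡ 1
∑-point x = trans (∑-cong (λ y → sym (*-identityʳ (point x y)))) (pairing-point x (λ _ → 1))

module _ {M : ℕ} (e : Fin M → Fin M → Fin M → ℕ) where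

  slice₁ slice₂ slice₃ : (Fin M → ℕ) → (Fin M → ℕ) → Fin M → ℕ
  slice₁ β γ x = pairing β (λ y → pairing γ (λ z → e x y z))
  slice₂ α γ y = pairing α (λ x → pairing γ (λ z → e x y z))
  slice₃ α β z = pairing α (λ x → pairing β (λ y → e x y z))

  form : (Fin M → ℕ) → (Fin M → ℕ) → (Fin M → ℕ) → ℕ
  form α β γ = pairing α (slice₁ β γ)

  form≡slice₂ : ∀ α β γ → form α β γ ≡ pairing β (slice₂ α γ)
  form≡slice₂ α β γ = pairing-swap α β (λ x y → pairing γ (e x y))

  form≡slice₃ : ∀ α β γ → form α β γ ≡ pairing γ (slice₃ α β)
  form≡slice₃ α β γ = trans (pairing-cong {α = α} (λ _ → refl) (λ x → pairing-swap β γ (e x)))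
    (pairing-swap α γ (λ x z → pairing β (λ y → e x y z)))

  form-cong : ∀ {α α′ β β′ γ γ′} → (∀ x → α x ≡ α′ x) → (∀ x → β x ≡ β′ x) → (∀ x → γ x ≡ γ′ x) →
    form α β γ ≡ form α′ β′ γ′
  form-cong p q r = pairing-cong p (λ x → pairing-cong q (λ y → pairing-cong r (λ z → refl)))

  form-+₁ : ∀ α α′ β γ → form (λ x → α x + α′ x) β γ ≡ form α β γ + form α′ β γ
  form-+₁ α α′ β γ = pairing-+ˡ α α′ (slice₁ β γ)

  form-+₂ : ∀ α β β′ γ → form α (λ x → β x + β′ x) γ ≡ form α β γ + form α β′ γ
  form-+₂ α β β′ γ = trans (form≡slice₂ α (λ x → β x + β′ x) γ) (trans (pairing-+ˡ β β′ (slice₂ α γ))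
    (sym (cong₂ _+_ (form≡slice₂ α β γ) (form≡slice₂ α β′ γ))))

  form-+₃ : ∀ α β γ γ′ → form α β (λ x → γ x + γ′ x) ≡ form α β γ + form α β γ′
  form-+₃ α β γ γ′ = trans (form≡slice₃ α β (λ x → γ x + γ′ x)) (trans (pairing-+ˡ γ γ′ (slice₃ α β))
    (sym (cong₂ _+_ (form≡slice₃ α β γ) (form≡slice₃ α β γ′))))

  -- Grouped by degree in the primed measures: degrees 0 and 1 first, then 2 and 3. The linear terms
  -- are those that a sampling stage controls, the last group is its error.
  form-expand : ∀ α α′ β β′ γ γ′ →
    form (λ x → α x + α′ x) (λ x → β x + β′ x) (λ x → γ x + γ′ x) ≡
    (form α β γ + (form α′ β γ + form α β′ γ + form α β γ′)) +
    (form α β′ γ′ + form α′ β γ′ + form α′ β′ γ + form α′ β′ γ′)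
  form-expand α α′ β β′ γ γ′ = begin
    form (λ x → α x + α′ x) (λ x → β x + β′ x) (λ x → γ x + γ′ x) ≡⟨ form-+₁ α α′ (λ x → β x + β′ x) (λ x → γ x + γ′ x) ⟩
    form α (λ x → β x + β′ x) (λ x → γ x + γ′ x) + form α′ (λ x → β x + β′ x) (λ x → γ x + γ′ x)
      ≡⟨ cong₂ _+_ (inner α) (inner α′) ⟩
    ((form α β γ + form α β γ′) + (form α β′ γ + form α β′ γ′)) +
    ((form α′ β γ + form α′ β γ′) + (form α′ β′ γ + form α′ β′ γ′))
      ≡⟨ rearrange (form α β γ) (form α β γ′) (form α β′ γ) (form α β′ γ′)
                   (form α′ β γ) (form α′ β γ′) (form α′ β′ γ) (form α′ β′ γ′) ⟩
    _ ∎
    where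
    open ≡-Reasoning
    inner : ∀ α → form α (λ x → β x + β′ x) (λ x → γ x + γ′ x) ≡
      (form α β γ + form α β γ′) + (form α β′ γ + form α β′ γ′)
    inner α = trans (form-+₂ α β β′ (λ x → γ x + γ′ x)) (cong₂ _+_ (form-+₃ α β γ γ′) (form-+₃ α β′ γ γ′))
    rearrange : ∀ a b c d e f g h → ((a + b) + (c + d)) + ((e + f) + (g + h)) ≡
      (a + (e + c + b)) + (d + f + g + h)
    rearrange = solve-∀

  module _ (e≤1 : ∀ x y z → e x y z ≤ 1) where

    slice₁-bound : ∀ β γ x → slice₁ β γ x ≤ ∑ M β * ∑ M γ
    slice₁-bound β γ x = pairing-bound β _ (∑ M γ) (λ y →
      ≤-trans (pairing-bound γ _ 1 (λ z → e≤1 x y z)) (≤-reflexive (*-identityʳ _)))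

    slice₂-bound : ∀ α γ y → slice₂ α γ y ≤ ∑ M α * ∑ M γ
    slice₂-bound α γ y = pairing-bound α _ (∑ M γ) (λ x →
      ≤-trans (pairing-bound γ _ 1 (λ z → e≤1 x y z)) (≤-reflexive (*-identityʳ _)))

    slice₃-bound : ∀ α β z → slice₃ α β z ≤ ∑ M α * ∑ M β
    slice₃-bound α β z = pairing-bound α _ (∑ M β) (λ x →
      ≤-trans (pairing-bound β _ 1 (λ y → e≤1 x y z)) (≤-reflexive (*-identityʳ _)))

    form-bound : ∀ α β γ → form α β γ ≤ ∑ M α * (∑ M β * ∑ M γ)
    form-bound α β γ = pairing-bound α _ _ (slice₁-bound β γ)

-- Rounded gains of a single vertex

floorDiv : ℕ → ℕ → ℕ
floorDiv m zero    = 0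
floorDiv m (suc n) = m div suc n

floorDiv-lower : ∀ m n → 0 < n → m ≤ suc (floorDiv m n) * n
floorDiv-lower m (suc n) _ = begin
  m ≡⟨ m≡m%n+[m/n]*n m (suc n) ⟩
  m % suc n + m div suc n * suc n ≤⟨ +-monoˡ-≤ _ (<⇒≤ (m%n<n m (suc n))) ⟩
  suc n + m div suc n * suc n ∎
  where open ≤-Reasoning

floorDiv-upper : ∀ m n → floorDiv m n * n ≤ m
floorDiv-upper m zero    = z≤n
floorDiv-upper m (suc n) = m/n*n≤m m (suc n)

floorDiv-bound : ∀ m n c → m ≤ c * n → floorDiv m n ≤ c
floorDiv-bound m zero    c le = z≤n
floorDiv-bound m (suc n) c le = ≤-trans (/-mono-≤ le (≤-refl {suc n})) (≤-reflexive (m*n/n≡m c (suc n)))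

-- The gain of replacing one copy of w by a point mass at x of the same total mass, shifted by E * S so that it is
-- nonnegative.
module _ {M : ℕ} (K E S : ℕ) (w f : Fin M → ℕ) where

  gain : Fin M → ℕ
  gain x = f x * ∑ M w + (E * S ∸ pairing w f)

  roundedGain : Fin M → ℕ
  roundedGain x = floorDiv (K * gain x) S

  module _ (bounded : ∀ x → f x * ∑ M w ≤ E * S) where

    -- The bound depends on K and E alone. Without the division by S the number of possible
    -- thresholds would grow with the parts, and no Ramsey bound uniform in the hypergraph could be
    -- given.
    roundedGain-bound : ∀ x → roundedGain x ≤ K * (E + E)
    roundedGain-bound x = floorDiv-bound _ S _ (≤-trans
      (*-monoʳ-≤ K (+-mono-≤ (bounded x) (m∸n≤m (E * S) (pairing w f))))
      (≤-reflexive (lemma K E S)))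
      where
      lemma : ∀ K E S → K * (E * S + E * S) ≡ K * (E + E) * S
      lemma = solve-∀

    pairing≤ : 0 < ∑ M w → pairing w f ≤ E * S
    pairing≤ 0<w = *-cancelʳ-≤ (pairing w f) (E * S) (∑ M w) {{>-nonZero 0<w}} (begin
      pairing w f * ∑ M w ≡⟨ sym (∑-*ʳ (∑ M w) (λ x → w x * f x)) ⟩
      ∑ M (λ x → w x * f x * ∑ M w) ≡⟨ ∑-cong (λ x → *-assoc (w x) (f x) (∑ M w)) ⟩
      pairing w (λ x → f x * ∑ M w) ≤⟨ pairing-bound w _ (E * S) bounded ⟩
      ∑ M w * (E * S) ≡⟨ *-comm (∑ M w) (E * S) ⟩
      E * S * ∑ M w ∎)
      where open ≤-Reasoning

    -- Under w the mean of `f x * ∑ M w` is `pairing w f`, which is exactly what the shift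
    -- subtracts; `pairing≤` makes the truncated subtraction a true one. On average, then, replacing
    -- a copy of w by a point mass changes nothing.
    gain-total : 0 < ∑ M w → pairing w gain ≡ E * S * ∑ M w
    gain-total 0<w = begin
      ∑ M (λ x → w x * (f x * W + c)) ≡⟨ ∑-cong (λ x → lemma (w x) (f x) W c) ⟩
      ∑ M (λ x → w x * f x * W + w x * c) ≡⟨ ∑-+ (λ x → w x * f x * W) (λ x → w x * c) ⟩
      ∑ M (λ x → w x * f x * W) + ∑ M (λ x → w x * c) ≡⟨ cong₂ _+_ (∑-*ʳ W (λ x → w x * f x)) (∑-*ʳ c w) ⟩
      pairing w f * W + W * c ≡⟨ lemma₂ (pairing w f) W c ⟩
      (pairing w f + c) * W ≡⟨ cong (_* W) (m+[n∸m]≡n (pairing≤ 0<w)) ⟩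
      E * S * W ∎
      where
      open ≡-Reasoning
      W = ∑ M w
      c = E * S ∸ pairing w f
      lemma : ∀ a b W c → a * (b * W + c) ≡ a * b * W + a * c
      lemma = solve-∀
      lemma₂ : ∀ p W c → p * W + W * c ≡ (p + c) * W
      lemma₂ = solve-∀

    roundedGain-average : 0 < ∑ M w → 0 < S → (K * E ∸ 1) * ∑ M w ≤ pairing w roundedGain
    roundedGain-average 0<w 0<S = begin
      (K * E ∸ 1) * W ≡⟨ *-distribʳ-∸ W (K * E) 1 ⟩
      K * E * W ∸ 1 * W ≤⟨ ∸-monoˡ-≤ (1 * W) (*-cancelʳ-≤ (K * E * W) _ S {{>-nonZero 0<S}} scaled) ⟩
      pairing w roundedGain + W ∸ 1 * W ≡⟨ cong (pairing w roundedGain + W ∸_) (*-identityˡ W) ⟩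
      pairing w roundedGain + W ∸ W ≡⟨ m+n∸n≡m _ W ⟩
      pairing w roundedGain ∎
      where
      open ≤-Reasoning
      W = ∑ M w
      lemma : ∀ K E W S → K * E * W * S ≡ K * (E * S * W)
      lemma = solve-∀
      lemma₂ : ∀ a v S → a * (suc v * S) ≡ (a * v + a) * S
      lemma₂ = solve-∀
      lemma₃ : ∀ K a b → K * (a * b) ≡ a * (K * b)
      lemma₃ = solve-∀
      scaled : K * E * W * S ≤ (pairing w roundedGain + W) * S
      scaled = begin
        K * E * W * S ≡⟨ lemma K E W S ⟩
        K * (E * S * W) ≡⟨ cong (K *_) (sym (gain-total 0<w)) ⟩
        K * pairing w gain ≡⟨ sym (∑-*ˡ K (λ x → w x * gain x)) ⟩
        ∑ M (λ x → K * (w x * gain x)) ≡⟨ ∑-cong (λ x → lemma₃ K (w x) (gain x)) ⟩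
        ∑ M (λ x → w x * (K * gain x)) ≤⟨ ∑-mono (λ x → *-monoʳ-≤ (w x) (floorDiv-lower (K * gain x) S 0<S)) ⟩
        ∑ M (λ x → w x * (suc (roundedGain x) * S)) ≡⟨ ∑-cong (λ x → lemma₂ (w x) (roundedGain x) S) ⟩
        ∑ M (λ x → (w x * roundedGain x + w x) * S) ≡⟨ ∑-*ʳ S (λ x → w x * roundedGain x + w x) ⟩
        ∑ M (λ x → w x * roundedGain x + w x) * S ≡⟨ cong (_* S) (∑-+ (λ x → w x * roundedGain x) w) ⟩
        (pairing w roundedGain + W) * S ∎

    roundedGain-upper : 0 < ∑ M w → ∀ x →
      roundedGain x * S + K * pairing w f ≤ K * (f x * ∑ M w) + K * (E * S)
    roundedGain-upper 0<w x = begin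
      roundedGain x * S + K * G ≤⟨ +-monoˡ-≤ (K * G) (floorDiv-upper (K * gain x) S) ⟩
      K * gain x + K * G ≡⟨ lemma K (f x * ∑ M w) (E * S ∸ G) G ⟩
      K * (f x * ∑ M w) + K * (G + (E * S ∸ G)) ≡⟨ cong (λ t → K * (f x * ∑ M w) + K * t) (m+[n∸m]≡n (pairing≤ 0<w)) ⟩
      K * (f x * ∑ M w) + K * (E * S) ∎
      where
      open ≤-Reasoning
      G = pairing w f
      lemma : ∀ K a c G → K * (a + c) + K * G ≡ K * a + K * (G + c)
      lemma = solve-∀

-- One sampling stage

-- The shift `E * S` enters once per role and cancels against the lower bound for the three rounded
-- gains. What remains of the rounding is one unit S per role.
cancelShift : ∀ K E S G₁ G₂ G₃ F₁ F₂ F₃ v₁ v₂ v₃ → 0 < K * E → 3 * (K * E ∸ 1) ≤ v₁ + v₂ + v₃ →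
  v₁ * S + K * G₁ ≤ K * F₁ + K * (E * S) → v₂ * S + K * G₂ ≤ K * F₂ + K * (E * S) →
  v₃ * S + K * G₃ ≤ K * F₃ + K * (E * S) → K * (G₁ + G₂ + G₃) ≤ K * (F₁ + F₂ + F₃) + 3 * S
cancelShift K E S G₁ G₂ G₃ F₁ F₂ F₃ v₁ v₂ v₃ 0<KE 3c≤ b₁ b₂ b₃ =
  +-cancelˡ-≤ (3 * (K * E) * S) _ _ (begin
    3 * (K * E) * S + K * (G₁ + G₂ + G₃) ≤⟨ +-monoˡ-≤ _ (*-monoˡ-≤ S 3KE≤) ⟩
    (v₁ + v₂ + v₃ + 3) * S + K * (G₁ + G₂ + G₃) ≡⟨ lemma K G₁ G₂ G₃ v₁ v₂ v₃ S ⟩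
    (v₁ * S + K * G₁) + (v₂ * S + K * G₂) + (v₃ * S + K * G₃) + 3 * S
      ≤⟨ +-monoˡ-≤ (3 * S) (+-mono-≤ (+-mono-≤ b₁ b₂) b₃) ⟩
    (K * F₁ + K * (E * S)) + (K * F₂ + K * (E * S)) + (K * F₃ + K * (E * S)) + 3 * S
      ≡⟨ lemma₂ K E S F₁ F₂ F₃ ⟩
    3 * (K * E) * S + (K * (F₁ + F₂ + F₃) + 3 * S) ∎)
  where
  open ≤-Reasoning
  3KE≤ : 3 * (K * E) ≤ v₁ + v₂ + v₃ + 3
  3KE≤ = begin
    3 * (K * E) ≡⟨ cong (3 *_) (sym (m∸n+n≡m 0<KE)) ⟩
    3 * (K * E ∸ 1 + 1) ≡⟨ *-distribˡ-+ 3 (K * E ∸ 1) 1 ⟩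
    3 * (K * E ∸ 1) + 3 ≤⟨ +-monoˡ-≤ 3 3c≤ ⟩
    v₁ + v₂ + v₃ + 3 ∎
  lemma : ∀ K G₁ G₂ G₃ v₁ v₂ v₃ S → (v₁ + v₂ + v₃ + 3) * S + K * (G₁ + G₂ + G₃) ≡
    (v₁ * S + K * G₁) + (v₂ * S + K * G₂) + (v₃ * S + K * G₃) + 3 * S
  lemma = solve-∀
  lemma₂ : ∀ K E S F₁ F₂ F₃ →
    (K * F₁ + K * (E * S)) + (K * F₂ + K * (E * S)) + (K * F₃ + K * (E * S)) + 3 * S ≡
    3 * (K * E) * S + (K * (F₁ + F₂ + F₃) + 3 * S)
  lemma₂ = solve-∀

Samples : ℕ → ℕ → ℕ → Set
Samples N M h = Fin h → Fin N → Fin N → Fin M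

addSample : ∀ {N M h} → (Fin N → Fin N → Fin M) → Samples N M h → Samples N M (suc h)
addSample x xs Fin.zero    = x
addSample x xs (Fin.suc a) = xs a

counting : ∀ {N M h} → Samples N M h → Fin N → Fin N → Fin M → ℕ
counting {h = h} xs i j x = ∑ h (λ a → point (xs a i j) x)

∑-counting : ∀ {N M h} (xs : Samples N M h) i j → ∑ M (counting xs i j) ≡ h
∑-counting {h = h} xs i j = trans (∑-swap (λ x a → point (xs a i j) x))
  (trans (∑-cong (λ a → ∑-point (xs a i j))) (trans (∑-const h 1) (*-identityʳ h)))

module _ {N M : ℕ} (w : Fin N → Fin N → Fin M → ℕ) where

  size : Fin N → Fin N → ℕ
  size i j = ∑ M (w i j)

  volume : Fin N → Fin N → Fin N → ℕ
  volume i j k = size i j * size i k * size j k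

  -- The sampled vertices, each of mass |V_ij|, plus r copies of the uniform measure on V_ij.
  mixture : ∀ {h} → Samples N M h → ℕ → Fin N → Fin N → Fin M → ℕ
  mixture xs r i j x = size i j * counting xs i j x + r * w i j x

  energy : (Fin M → Fin M → Fin M → ℕ) → ∀ {h} → Samples N M h → ℕ → Fin N → Fin N → Fin N → ℕ
  energy e xs r i j k = form e (mixture xs r i j) (mixture xs r i k) (mixture xs r j k)

  ∑-mixture : ∀ {h} (xs : Samples N M h) r i j → ∑ M (mixture xs r i j) ≡ (h + r) * size i j
  ∑-mixture {h} xs r i j = begin
    ∑ M (λ x → size i j * counting xs i j x + r * w i j x)
      ≡⟨ ∑-+ (λ x → size i j * counting xs i j x) (λ x → r * w i j x) ⟩
    ∑ M (λ x → size i j * counting xs i j x) + ∑ M (λ x → r * w i j x)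
      ≡⟨ cong₂ _+_ (∑-*ˡ (size i j) (counting xs i j)) (∑-*ˡ r (w i j)) ⟩
    size i j * ∑ M (counting xs i j) + r * size i j ≡⟨ cong (λ t → size i j * t + r * size i j) (∑-counting xs i j) ⟩
    size i j * h + r * size i j ≡⟨ lemma (size i j) h r ⟩
    (h + r) * size i j ∎
    where
    open ≡-Reasoning
    lemma : ∀ s h r → s * h + r * s ≡ (h + r) * s
    lemma = solve-∀

module _ {N M : ℕ} (w : Fin N → Fin N → Fin M → ℕ) (e : Fin M → Fin M → Fin M → ℕ)
  (e≤1 : ∀ x y z → e x y z ≤ 1) (positive : ∀ {i j} → i Fin.< j → 0 < ∑ M (w i j)) where

  private
    V : Fin N → Fin N → Fin N → ℕ
    V = volume w
    s : Fin N → Fin N → ℕ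
    s = size w

  volume>0 : ∀ {i j k} → i Fin.< j → j Fin.< k → 0 < volume w i j k
  volume>0 i<j j<k = *-mono-≤ (*-mono-≤ (positive i<j) (positive (Finₚ.<-trans i<j j<k))) (positive j<k)

  module _ {h : ℕ} (xs : Samples N M h) (r q : ℕ) (h+r<q : h + r < q) where

    private
      R : Fin N → Fin N → Fin M → ℕ
      R = mixture w xs r

    ∑-R≤ : ∀ i j → ∑ M (R i j) ≤ q * s i j
    ∑-R≤ i j = ≤-trans (≤-reflexive (∑-mixture w xs r i j)) (*-monoˡ-≤ (s i j) (<⇒≤ h+r<q))

    f₁ f₂ f₃ : Fin N → Fin N → Fin N → Fin M → ℕ
    f₁ i j k = slice₁ e (R i k) (R j k)
    f₂ i j k = slice₂ e (R i j) (R j k)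
    f₃ i j k = slice₃ e (R i j) (R i k)

    baseEnergy linearPart : Fin N → Fin N → Fin N → ℕ
    baseEnergy i j k = form e (R i j) (R i k) (R j k)
    linearPart i j k = pairing (w i j) (f₁ i j k) + pairing (w i k) (f₂ i j k) + pairing (w j k) (f₃ i j k)

    -- One uniform copy is split off from each of the three measures. Terms with two or three of the
    -- split-off copies come from triples with a repeated stage and are only estimated by total
    -- masses: with p = h + r they amount to at most 3p + 1 volumes, and p < q.
    energy-upper : ∀ i j k → energy w e xs (suc r) i j k ≤ baseEnergy i j k + linearPart i j k + 3 * q * V i j k
    energy-upper i j k = begin
      energy w e xs (suc r) i j k ≡⟨ form-cong e (add i j) (add i k) (add j k) ⟩
      form e (λ x → R i j x + w i j x) (λ x → R i k x + w i k x) (λ x → R j k x + w j k x)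
        ≡⟨ form-expand e (R i j) (w i j) (R i k) (w i k) (R j k) (w j k) ⟩
      (baseEnergy i j k + (form e (w i j) (R i k) (R j k) + form e (R i j) (w i k) (R j k) + form e (R i j) (R i k) (w j k)))
        + (form e (R i j) (w i k) (w j k) + form e (w i j) (R i k) (w j k) + form e (w i j) (w i k) (R j k)
          + form e (w i j) (w i k) (w j k))
        ≤⟨ +-mono-≤ (≤-reflexive (cong (baseEnergy i j k +_) (cong₂ _+_ (cong (form e (w i j) (R i k) (R j k) +_)
             (form≡slice₂ e (R i j) (w i k) (R j k))) (form≡slice₃ e (R i j) (R i k) (w j k))))) higher ⟩
      (baseEnergy i j k + linearPart i j k) + 3 * q * V i j k ∎
      where
      open ≤-Reasoning
      add : ∀ i j x → mixture w xs (suc r) i j x ≡ R i j x + w i j x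
      add i j x = lemma (s i j * counting xs i j x) r (w i j x)
        where
        lemma : ∀ a r b → a + suc r * b ≡ a + r * b + b
        lemma = solve-∀
      a = s i j
      b = s i k
      c = s j k
      p = h + r
      collect : ∀ p a b c → p * a * (b * c) + a * (p * b * c) + a * (b * (p * c)) + a * (b * c)
        ≡ (3 * p + 1) * (a * b * c)
      collect = solve-∀
      bound : ∀ p q → p < q → 3 * p + 1 ≤ 3 * q
      bound p q p<q = ≤-trans (≤-trans (+-monoʳ-≤ (3 * p) (s≤s z≤n)) (≤-reflexive (lemma p))) (*-monoʳ-≤ 3 p<q)
        where
        lemma : ∀ p → 3 * p + 3 ≡ 3 * suc p
        lemma = solve-∀
      higher : form e (R i j) (w i k) (w j k) + form e (w i j) (R i k) (w j k) + form e (w i j) (w i k) (R j k)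
          + form e (w i j) (w i k) (w j k) ≤ 3 * q * V i j k
      higher = begin
        form e (R i j) (w i k) (w j k) + form e (w i j) (R i k) (w j k) + form e (w i j) (w i k) (R j k)
          + form e (w i j) (w i k) (w j k)
          ≤⟨ +-mono-≤ (+-mono-≤ (+-mono-≤ (form-bound e e≤1 (R i j) (w i k) (w j k)) (form-bound e e≤1 (w i j) (R i k) (w j k)))
               (form-bound e e≤1 (w i j) (w i k) (R j k))) (form-bound e e≤1 (w i j) (w i k) (w j k)) ⟩
        ∑ M (R i j) * (b * c) + a * (∑ M (R i k) * c) + a * (b * ∑ M (R j k)) + a * (b * c)
          ≡⟨ cong₂ (λ s t → s + t + a * (b * c))
               (cong₂ (λ s t → s * (b * c) + a * (t * c)) (∑-mixture w xs r i j) (∑-mixture w xs r i k))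
               (cong (λ s → a * (b * s)) (∑-mixture w xs r j k)) ⟩
        p * a * (b * c) + a * (p * b * c) + a * (b * (p * c)) + a * (b * c) ≡⟨ collect p a b c ⟩
        (3 * p + 1) * (a * b * c) ≤⟨ *-monoˡ-≤ (a * b * c) (bound p q h+r<q) ⟩
        3 * q * V i j k ∎

    -- The same expansion with point masses in place of the split-off copies. Terms involving two or
    -- three new vertices are nonnegative and are dropped, so the new vertices of a triad never have
    -- to be compared with each other.
    energy-lower : ∀ (x : Fin N → Fin N → Fin M) i j k →
      baseEnergy i j k + (f₁ i j k (x i j) * s i j + f₂ i j k (x i k) * s i k + f₃ i j k (x j k) * s j k)
        ≤ energy w e (addSample x xs) r i j k
    energy-lower x i j k = begin
      baseEnergy i j k + (f₁ i j k (x i j) * s i j + f₂ i j k (x i k) * s i k + f₃ i j k (x j k) * s j k)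
        ≡⟨ cong (baseEnergy i j k +_) (cong₂ _+_ (cong₂ _+_ (mass i j (f₁ i j k)) (mass i k (f₂ i j k))) (mass j k (f₃ i j k))) ⟩
      baseEnergy i j k + (pairing (δ i j) (f₁ i j k) + pairing (δ i k) (f₂ i j k) + pairing (δ j k) (f₃ i j k))
        ≡⟨ cong (baseEnergy i j k +_) (sym (cong₂ _+_ (cong (form e (δ i j) (R i k) (R j k) +_)
             (form≡slice₂ e (R i j) (δ i k) (R j k))) (form≡slice₃ e (R i j) (R i k) (δ j k)))) ⟩
      baseEnergy i j k + (form e (δ i j) (R i k) (R j k) + form e (R i j) (δ i k) (R j k) + form e (R i j) (R i k) (δ j k))
        ≤⟨ m≤m+n _ _ ⟩
      _ ≡⟨ sym (form-expand e (R i j) (δ i j) (R i k) (δ i k) (R j k) (δ j k)) ⟩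
      form e (λ y → R i j y + δ i j y) (λ y → R i k y + δ i k y) (λ y → R j k y + δ j k y)
        ≡⟨ form-cong e (add i j) (add i k) (add j k) ⟩
      energy w e (addSample x xs) r i j k ∎
      where
      open ≤-Reasoning
      δ : Fin N → Fin N → Fin M → ℕ
      δ i j y = s i j * point (x i j) y
      add : ∀ i j y → R i j y + δ i j y ≡ mixture w (addSample x xs) r i j y
      add i j y = lemma (s i j) (counting xs i j y) (r * w i j y) (point (x i j) y)
        where
        lemma : ∀ s c b p → s * c + b + s * p ≡ s * (p + c) + b
        lemma = solve-∀
      mass : ∀ i j f → f (x i j) * s i j ≡ pairing (δ i j) f
      mass i j f = trans (*-comm (f (x i j)) (s i j)) (trans (cong (s i j *_) (sym (pairing-point (x i j) f)))
        (trans (sym (∑-*ˡ (s i j) (λ y → point (x i j) y * f y)))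
          (∑-cong (λ y → sym (*-assoc (s i j) (point (x i j) y) (f y))))))

    module _ (K : ℕ) (0<K : 0 < K) where

      private
        E = q * q
        0<KE : 0 < K * E
        0<KE = *-mono-≤ 0<K (*-mono-≤ 0<q 0<q)
          where
          0<q : 0 < q
          0<q = ≤-trans (s≤s z≤n) h+r<q

      v₁ v₂ v₃ : Fin N → Fin N → Fin M → Fin N → ℕ
      v₁ i j x k = roundedGain K E (V i j k) (w i j) (f₁ i j k) x
      v₂ i k x j = roundedGain K E (V i j k) (w i k) (f₂ i j k) x
      v₃ j k x i = roundedGain K E (V i j k) (w j k) (f₃ i j k) x

      bounded₁ : ∀ i j k x → f₁ i j k x * s i j ≤ E * V i j k
      bounded₁ i j k x = ≤-trans (*-monoˡ-≤ (s i j) (≤-trans (slice₁-bound e e≤1 (R i k) (R j k) x)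
        (*-mono-≤ (∑-R≤ i k) (∑-R≤ j k)))) (≤-reflexive (lemma q (s i j) (s i k) (s j k)))
        where
        lemma : ∀ q a b c → q * b * (q * c) * a ≡ q * q * (a * b * c)
        lemma = solve-∀

      bounded₂ : ∀ i j k x → f₂ i j k x * s i k ≤ E * V i j k
      bounded₂ i j k x = ≤-trans (*-monoˡ-≤ (s i k) (≤-trans (slice₂-bound e e≤1 (R i j) (R j k) x)
        (*-mono-≤ (∑-R≤ i j) (∑-R≤ j k)))) (≤-reflexive (lemma q (s i j) (s i k) (s j k)))
        where
        lemma : ∀ q a b c → q * a * (q * c) * b ≡ q * q * (a * b * c)
        lemma = solve-∀

      bounded₃ : ∀ i j k x → f₃ i j k x * s j k ≤ E * V i j k
      bounded₃ i j k x = ≤-trans (*-monoˡ-≤ (s j k) (≤-trans (slice₃-bound e e≤1 (R i j) (R i k) x)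
        (*-mono-≤ (∑-R≤ i j) (∑-R≤ i k)))) (≤-reflexive (lemma q (s i j) (s i k) (s j k)))
        where
        lemma : ∀ q a b c → q * a * (q * b) * c ≡ q * q * (a * b * c)
        lemma = solve-∀

      Improved : ℕ → List (Fin N) → Set
      Improved n I = ∃[ J ] Σ (Fin N → Fin N → Fin M) λ x → (SublistOfLength n I J ×
        (∀ {i j} → i ∈ J → j ∈ J → i Fin.< j → 0 < w i j (x i j)) ×
        (∀ {i j k} → i ∈ J → j ∈ J → k ∈ J → i Fin.< j → j Fin.< k →
          K * energy w e xs (suc r) i j k ≤ K * energy w e (addSample x xs) r i j k + (3 + K * (3 * q)) * V i j k))

      sampleStep : (n : ℕ) (x₀ : Fin M) (I : List (Fin N)) → Sorted I →
        selectionBound n (K * (q * q + q * q)) ≤ length I →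
        Improved n I
      -- The cap `K * (E + E)` and the average `K * E ∸ 1` are the same for all triads and roles;
      -- the 1 is the loss from rounding down.
      sampleStep n x₀ I sorted long = finish (selection w v₁ v₂ v₃ n (K * (E + E)) (K * E ∸ 1)
        (λ {i} {j} {k} _ _ x → roundedGain-bound K E (V i j k) (w i j) (f₁ i j k) (bounded₁ i j k) x)
        (λ {i} {j} {k} _ _ x → roundedGain-bound K E (V i j k) (w i k) (f₂ i j k) (bounded₂ i j k) x)
        (λ {i} {j} {k} _ _ x → roundedGain-bound K E (V i j k) (w j k) (f₃ i j k) (bounded₃ i j k) x)
        (λ {i} {j} {k} i<j j<k → roundedGain-average K E (V i j k) (w i j) (f₁ i j k) (bounded₁ i j k)
          (positive i<j) (volume>0 i<j j<k))
        (λ {i} {j} {k} i<j j<k → roundedGain-average K E (V i j k) (w i k) (f₂ i j k) (bounded₂ i j k)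
          (positive (Finₚ.<-trans i<j j<k)) (volume>0 i<j j<k))
        (λ {i} {j} {k} i<j j<k → roundedGain-average K E (V i j k) (w j k) (f₃ i j k) (bounded₃ i j k)
          (positive j<k) (volume>0 i<j j<k))
        positive x₀ I sorted long)
        where
        improves : ∀ (x : Fin N → Fin N → Fin M) {i j k} → i Fin.< j → j Fin.< k →
          3 * (K * E ∸ 1) ≤ v₁ i j (x i j) k + v₂ i k (x i k) j + v₃ j k (x j k) i →
          K * energy w e xs (suc r) i j k ≤ K * energy w e (addSample x xs) r i j k + (3 + K * (3 * q)) * V i j k
        improves x {i} {j} {k} i<j j<k le = begin
          K * energy w e xs (suc r) i j k ≤⟨ *-monoʳ-≤ K (energy-upper i j k) ⟩
          K * (baseEnergy i j k + linearPart i j k + 3 * q * vol) ≡⟨ lemma K (baseEnergy i j k) (linearPart i j k) (3 * q) vol ⟩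
          K * baseEnergy i j k + K * linearPart i j k + K * (3 * q) * vol
            ≤⟨ +-monoˡ-≤ _ (+-monoʳ-≤ (K * baseEnergy i j k) (cancelShift K E vol G₁ G₂ G₃ F₁ F₂ F₃
                 (v₁ i j (x i j) k) (v₂ i k (x i k) j) (v₃ j k (x j k) i) 0<KE le
                 (roundedGain-upper K E vol (w i j) (f₁ i j k) (bounded₁ i j k) (positive i<j) (x i j))
                 (roundedGain-upper K E vol (w i k) (f₂ i j k) (bounded₂ i j k) (positive (Finₚ.<-trans i<j j<k)) (x i k))
                 (roundedGain-upper K E vol (w j k) (f₃ i j k) (bounded₃ i j k) (positive j<k) (x j k)))) ⟩
          K * baseEnergy i j k + (K * (F₁ + F₂ + F₃) + 3 * vol) + K * (3 * q) * vol
            ≡⟨ lemma₂ K (baseEnergy i j k) (F₁ + F₂ + F₃) vol (K * (3 * q)) ⟩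
          K * (baseEnergy i j k + (F₁ + F₂ + F₃)) + (3 + K * (3 * q)) * vol
            ≤⟨ +-monoˡ-≤ _ (*-monoʳ-≤ K (energy-lower x i j k)) ⟩
          K * energy w e (addSample x xs) r i j k + (3 + K * (3 * q)) * vol ∎
          where
          open ≤-Reasoning
          vol = V i j k
          G₁ = pairing (w i j) (f₁ i j k)
          G₂ = pairing (w i k) (f₂ i j k)
          G₃ = pairing (w j k) (f₃ i j k)
          F₁ = f₁ i j k (x i j) * s i j
          F₂ = f₂ i j k (x i k) * s i k
          F₃ = f₃ i j k (x j k) * s j k
          lemma : ∀ K a b c V → K * (a + b + c * V) ≡ K * a + K * b + K * c * V
          lemma = solve-∀
          lemma₂ : ∀ K a f V c → K * a + (K * f + 3 * V) + c * V ≡ K * (a + f) + (3 + c) * V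
          lemma₂ = solve-∀
        finish : Selected w v₁ v₂ v₃ n (K * E ∸ 1) I → Improved n I
        finish (J , x , sub , inPart , le) = J , x , sub , inPart ,
          λ i∈ j∈ k∈ i<j j<k → improves x i<j j<k (le i∈ j∈ k∈ i<j j<k)

-- Palettes

triple⊆ : ∀ {N} {J : List (Fin N)} {i j k} → Sorted J → i ∈ J → j ∈ J → k ∈ J → i Fin.< j → j Fin.< k →
  i ∷ j ∷ k ∷ [] ⊆ J
triple⊆ sorted i∈ j∈ k∈ i<j j<k
  with ls , rest , refl , al , _ , sorted₂ ← splitSorted sorted i∈
  with cs , rs , refl , ac , _ , _ ← splitSorted sorted₂ (∈-right i<j al j∈)
  = ++⁺ˡ ls (refl ∷ ++⁺ˡ cs (refl ∷ from∈ (∈-right j<k ac (∈-right (Finₚ.<-trans i<j j<k) al k∈))))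

indicator : Bool → ℕ
indicator b = if b then 1 else 0

indicator≤1 : ∀ b → indicator b ≤ 1
indicator≤1 true  = ≤-refl
indicator≤1 false = z≤n

tripleCount : ∀ {q} → (Fin q → Fin q → Fin q → Bool) → ℕ
tripleCount {q} T = ∑ q (λ a → ∑ q (λ b → ∑ q (λ c → indicator (T a b c))))

-- Counted backwards from the last stage: each selection must leave as many indices as the remaining
-- stages consume.
sampleBound : ℕ → ℕ → ℕ → ℕ → ℕ
sampleBound K q n zero    = n
sampleBound K q n (suc r) = selectionBound (sampleBound K q n r) (K * (q * q + q * q))

colourTriples : ∀ q → List (Fin q × Fin q × Fin q)
colourTriples q = cartesianProduct (allFin q) (cartesianProduct (allFin q) (allFin q))

homogeneousBound : ℕ → ℕ → ℕ
homogeneousBound q n = multiRamseyBound (length (colourTriples q)) 3 n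

module _ {N M : ℕ} (w : Fin N → Fin N → Fin M → ℕ) (edge : Fin M → Fin M → Fin M → Bool) where

  private
    e : Fin M → Fin M → Fin M → ℕ
    e x y z = indicator (edge x y z)
    En : ∀ {h} → Samples N M h → ℕ → Fin N → Fin N → Fin N → ℕ
    En = energy w e
    V : Fin N → Fin N → Fin N → ℕ
    V = volume w

  InParts : ∀ {h} → Samples N M h → List (Fin N) → Set
  InParts xs I = ∀ a {i j} → i ∈ I → j ∈ I → i Fin.< j → 0 < w i j (xs a i j)

  pairing-counting : ∀ {q} (ys : Samples N M q) i j f →
    pairing (mixture w ys 0 i j) f ≡ ∑ M (w i j) * ∑ q (λ a → f (ys a i j))
  pairing-counting {q} ys i j f = begin
    ∑ M (λ x → (s * ∑ q (λ a → point (ys a i j) x) + 0) * f x)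
      ≡⟨ ∑-cong (λ x → trans (cong (_* f x) (+-identityʳ (s * ∑ q (λ a → point (ys a i j) x))))
           (trans (*-assoc s _ (f x)) (cong (s *_) (sym (∑-*ʳ (f x) (λ a → point (ys a i j) x)))))) ⟩
    ∑ M (λ x → s * ∑ q (λ a → point (ys a i j) x * f x))
      ≡⟨ ∑-*ˡ s (λ x → ∑ q (λ a → point (ys a i j) x * f x)) ⟩
    s * ∑ M (λ x → ∑ q (λ a → point (ys a i j) x * f x))
      ≡⟨ cong (s *_) (∑-swap (λ x a → point (ys a i j) x * f x)) ⟩
    s * ∑ q (λ a → pairing (point (ys a i j)) f)
      ≡⟨ cong (s *_) (∑-cong (λ a → pairing-point (ys a i j) f)) ⟩
    s * ∑ q (λ a → f (ys a i j)) ∎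
    where
    open ≡-Reasoning
    s = ∑ M (w i j)

  finalEnergy : ∀ {q} (ys : Samples N M q) i j k →
    En ys 0 i j k ≡ V i j k * tripleCount (λ a b c → edge (ys a i j) (ys b i k) (ys c j k))
  finalEnergy {q} ys i j k = begin
    En ys 0 i j k ≡⟨ pairing-counting ys i j _ ⟩
    s₁ * ∑ q (λ a → pairing (mixture w ys 0 i k) (λ y → pairing (mixture w ys 0 j k) (e (ys a i j) y)))
      ≡⟨ cong (s₁ *_) (∑-cong (λ a → trans (pairing-counting ys i k _)
           (trans (cong (s₂ *_) (trans (∑-cong (λ b → pairing-counting ys j k (e (ys a i j) (ys b i k))))
             (∑-*ˡ s₃ (λ b → ∑ q (λ c → e (ys a i j) (ys b i k) (ys c j k)))))) (sym (*-assoc s₂ s₃ _))))) ⟩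
    s₁ * ∑ q (λ a → s₂ * s₃ * ∑ q (λ b → ∑ q (λ c → e (ys a i j) (ys b i k) (ys c j k))))
      ≡⟨ cong (s₁ *_) (∑-*ˡ (s₂ * s₃) (λ a → ∑ q (λ b → ∑ q (λ c → e (ys a i j) (ys b i k) (ys c j k))))) ⟩
    s₁ * (s₂ * s₃ * t) ≡⟨ lemma s₁ s₂ s₃ t ⟩
    s₁ * s₂ * s₃ * t ∎
    where
    open ≡-Reasoning
    s₁ = ∑ M (w i j)
    s₂ = ∑ M (w i k)
    s₃ = ∑ M (w j k)
    t = tripleCount (λ a b c → edge (ys a i j) (ys b i k) (ys c j k))
    lemma : ∀ a b c t → a * (b * c * t) ≡ a * b * c * t
    lemma = solve-∀

  noSamples : Samples N M 0
  noSamples ()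

  initialEnergy : ∀ q i j k → En noSamples q i j k ≡ q * q * q * form e (w i j) (w i k) (w j k)
  initialEnergy q i j k = begin
    pairing (m i j) (λ x → pairing (m i k) (λ y → pairing (m j k) (e x y)))
      ≡⟨ pull i j (λ x → pairing (m i k) (λ y → pairing (m j k) (e x y))) ⟩
    q * pairing (w i j) (λ x → pairing (m i k) (λ y → pairing (m j k) (e x y)))
      ≡⟨ cong (q *_) (∑-cong (λ x → cong (w i j x *_) (inner x))) ⟩
    q * pairing (w i j) (λ x → q * q * pairing (w i k) (λ y → pairing (w j k) (e x y)))
      ≡⟨ cong (q *_) (trans (∑-cong (λ x → comm (w i j x) (q * q) _)) (∑-*ˡ (q * q) (λ x → w i j x * slice₁ e (w i k) (w j k) x))) ⟩
    q * (q * q * form e (w i j) (w i k) (w j k)) ≡⟨ lemma q (form e (w i j) (w i k) (w j k)) ⟩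
    q * q * q * form e (w i j) (w i k) (w j k) ∎
    where
    open ≡-Reasoning
    m : Fin N → Fin N → Fin M → ℕ
    m = mixture w noSamples q
    comm : ∀ a b c → a * (b * c) ≡ b * (a * c)
    comm = solve-∀
    lemma : ∀ q f → q * (q * q * f) ≡ q * q * q * f
    lemma = solve-∀
    pull : ∀ i j f → pairing (m i j) f ≡ q * pairing (w i j) f
    pull i j f = trans (∑-cong (λ x → trans (cong (λ t → (t + q * w i j x) * f x) (*-zeroʳ (∑ M (w i j))))
      (*-assoc q (w i j x) (f x)))) (∑-*ˡ q (λ x → w i j x * f x))
    inner : ∀ x → pairing (m i k) (λ y → pairing (m j k) (e x y)) ≡ q * q * pairing (w i k) (λ y → pairing (w j k) (e x y))
    inner x = trans (pull i k _) (trans (cong (q *_) (trans (∑-cong (λ y → trans (cong (w i k y *_) (pull j k (e x y)))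
      (comm (w i k y) q _))) (∑-*ˡ q (λ y → w i k y * pairing (w j k) (e x y))))) (sym (*-assoc q q _)))

  IsPalette : ∀ {q} → (Fin q → Fin q → Fin q → Bool) → Samples N M q → List (Fin N) → Set
  IsPalette T ys J = InParts ys J × (∀ {i j k} → i ∈ J → j ∈ J → k ∈ J → i Fin.< j → j Fin.< k →
    ∀ a b c → edge (ys a i j) (ys b i k) (ys c j k) ≡ T a b c)

  Palette : (K Λ q n : ℕ) → List (Fin N) → Set
  Palette K Λ q n I = ∃[ J ] Σ (Samples N M q) λ ys → ∃[ T ]
    (SublistOfLength n I J × IsPalette T ys J × Λ * (q * q * q) ≤ K * tripleCount T + q * (3 + K * (3 * q)))

  module _ (positive : ∀ {i j} → i Fin.< j → 0 < ∑ M (w i j)) (K q : ℕ) (0<K : 0 < K) (x₀ : Fin M) where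

    private
      e≤1 : ∀ x y z → e x y z ≤ 1
      e≤1 x y z = indicator≤1 (edge x y z)

    Sampled : ℕ → ∀ {h} → Samples N M h → ℕ → List (Fin N) → Set
    Sampled n xs r I = ∃[ J ] Σ (Samples N M q) λ ys → SublistOfLength n I J × InParts ys J ×
      (∀ {i j k} → i ∈ J → j ∈ J → k ∈ J → i Fin.< j → j Fin.< k →
        K * En xs r i j k ≤ K * En ys 0 i j k + r * (3 + K * (3 * q)) * V i j k)

    sampleAll : ∀ n r {h} (xs : Samples N M h) → h + r ≡ q → (I : List (Fin N)) → Sorted I →
      InParts xs I → length I ≡ sampleBound K q n r → Sampled n xs r I
    sampleAll n zero {h} xs eq I sorted inParts len with refl ← trans (sym (+-identityʳ h)) eq =
      I , xs , (⊆-refl , len) , inParts , λ _ _ _ _ _ → m≤m+n _ _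
    sampleAll n (suc r) {h} xs eq I sorted inParts len =
      continue (sampleStep w e e≤1 positive xs r q h+r<q K 0<K (sampleBound K q n r) x₀ I sorted (≤-reflexive (sym len)))
      where
      h+r<q : h + r < q
      h+r<q = ≤-reflexive (trans (sym (+-suc h r)) eq)

      combine : ∀ {I} (J : List (Fin N)) x → J ⊆ I →
        (∀ {i j k} → i ∈ J → j ∈ J → k ∈ J → i Fin.< j → j Fin.< k →
          K * En xs (suc r) i j k ≤ K * En (addSample x xs) r i j k + (3 + K * (3 * q)) * V i j k) →
        Sampled n (addSample x xs) r J → Sampled n xs (suc r) I
      combine J x J⊆ le (J′ , ys , (J′⊆ , len′) , inParts′ , le′) =
        J′ , ys , (⊆-trans J′⊆ J⊆ , len′) , inParts′ , λ {i} {j} {k} i∈ j∈ k∈ i<j j<k →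
          ≤-trans (le (Any-resp-⊆ J′⊆ i∈) (Any-resp-⊆ J′⊆ j∈) (Any-resp-⊆ J′⊆ k∈) i<j j<k)
            (≤-trans (+-monoˡ-≤ _ (le′ i∈ j∈ k∈ i<j j<k))
              (≤-reflexive (lemma (K * En ys 0 i j k) r (3 + K * (3 * q)) (V i j k))))
        where
        lemma : ∀ a r c V → a + r * c * V + c * V ≡ a + suc r * c * V
        lemma = solve-∀

      continue : Improved w e e≤1 positive xs r q h+r<q K 0<K (sampleBound K q n r) I → Sampled n xs (suc r) I
      continue (J , x , (J⊆ , lenJ) , inPart , le) = combine J x J⊆ le
        (sampleAll n r (addSample x xs) (trans (sym (+-suc h r)) eq) J (Sorted-⊆ J⊆ sorted)
          (λ { Fin.zero → inPart
             ; (Fin.suc a) i∈ j∈ → inParts a (Any-resp-⊆ J⊆ i∈) (Any-resp-⊆ J⊆ j∈) }) lenJ)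

    findPalette : (Λ n : ℕ) →
      (∀ {i j k} → i Fin.< j → j Fin.< k → Λ * V i j k ≤ K * form e (w i j) (w i k) (w j k)) →
      (I : List (Fin N)) → Sorted I → length I ≡ sampleBound K q (homogeneousBound q (3 + n)) q →
      Palette K Λ q (3 + n) I
    findPalette Λ n dense I sorted len = fromSamples (sampleAll (homogeneousBound q (3 + n)) q noSamples refl I sorted (λ ()) len)
      where
      colour : Samples N M q → Fin q × Fin q × Fin q → List (Fin N) → Bool
      colour ys (a , b , c) (i ∷ j ∷ k ∷ []) = edge (ys a i j) (ys b i k) (ys c j k)
      colour ys _ _ = false

      count : ∀ {ys i j k} → i Fin.< j → j Fin.< k →
        K * En noSamples q i j k ≤ K * En ys 0 i j k + q * (3 + K * (3 * q)) * V i j k →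
        Λ * (q * q * q) ≤ K * tripleCount (λ a b c → edge (ys a i j) (ys b i k) (ys c j k)) + q * (3 + K * (3 * q))
      -- Both ends of the sampling are compared. The volume of the triad is a factor of every term
      -- and is cancelled, which leaves an inequality about colour triples in which the part sizes
      -- no longer occur.
      count {ys} {i} {j} {k} i<j j<k le = *-cancelʳ-≤ _ _ (V i j k) {{>-nonZero (volume>0 w e e≤1 positive i<j j<k)}} (begin
        Λ * (q * q * q) * V i j k ≡⟨ lemma Λ (q * q * q) (V i j k) ⟩
        q * q * q * (Λ * V i j k) ≤⟨ *-monoʳ-≤ (q * q * q) (dense i<j j<k) ⟩
        q * q * q * (K * F) ≡⟨ comm (q * q * q) K F ⟩
        K * (q * q * q * F) ≡⟨ cong (K *_) (sym (initialEnergy q i j k)) ⟩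
        K * En noSamples q i j k ≤⟨ le ⟩
        K * En ys 0 i j k + q * (3 + K * (3 * q)) * V i j k ≡⟨ cong (λ t → K * t + q * (3 + K * (3 * q)) * V i j k) (finalEnergy ys i j k) ⟩
        K * (V i j k * t) + q * (3 + K * (3 * q)) * V i j k ≡⟨ lemma₂ K (V i j k) t (q * (3 + K * (3 * q))) ⟩
        (K * t + q * (3 + K * (3 * q))) * V i j k ∎)
        where
        open ≤-Reasoning
        F = form e (w i j) (w i k) (w j k)
        t = tripleCount (λ a b c → edge (ys a i j) (ys b i k) (ys c j k))
        lemma : ∀ a b c → a * b * c ≡ b * (a * c)
        lemma = solve-∀
        comm : ∀ a b c → a * (b * c) ≡ b * (a * c)
        comm = solve-∀
        lemma₂ : ∀ K V t c → K * (V * t) + c * V ≡ (K * t + c) * V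
        lemma₂ = solve-∀

      -- All triads on the final list carry the same palette, so its density can be read off at one
      -- triad; the 3 in `3 + n` guarantees that there is one.
      threeElements : ∀ {J : List (Fin N)} → Sorted J → length J ≡ 3 + n →
        ∃[ i ] ∃[ j ] ∃[ k ] (i ∈ J × j ∈ J × k ∈ J × i Fin.< j × j Fin.< k)
      threeElements {i ∷ j ∷ k ∷ J} ((i<j ∷ _) ∷ (j<k ∷ _) ∷ _) _ =
        i , j , k , here refl , there (here refl) , there (there (here refl)) , i<j , j<k

      fromHomogeneous : ∀ {J ys} → J ⊆ I → InParts ys J →
        (∀ {i j k} → i ∈ J → j ∈ J → k ∈ J → i Fin.< j → j Fin.< k →
          K * En noSamples q i j k ≤ K * En ys 0 i j k + q * (3 + K * (3 * q)) * V i j k) →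
        ∃[ J′ ] (SublistOfLength (3 + n) J J′ × All (Homogeneous 3 J′) (map (colour ys) (colourTriples q))) → Palette K Λ q (3 + n) I
      fromHomogeneous {J} {ys} J⊆ inParts le (J′ , (J′⊆ , len′) , homs) =
        J′ , ys , T , (⊆-trans J′⊆ J⊆ , len′) ,
        ((λ a i∈ j∈ → inParts a (Any-resp-⊆ J′⊆ i∈) (Any-resp-⊆ J′⊆ j∈)) , pattern-T) ,
        density (threeElements sorted′ len′)
        where
        sorted′ : Sorted J′
        sorted′ = Sorted-⊆ (⊆-trans J′⊆ J⊆) sorted
        hom : ∀ a b c → Homogeneous 3 J′ (colour ys (a , b , c))
        hom a b c = All.lookup homs (∈-map⁺ (colour ys)
          (∈-cartesianProduct⁺ (∈-allFin a) (∈-cartesianProduct⁺ (∈-allFin b) (∈-allFin c))))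
        T : Fin q → Fin q → Fin q → Bool
        T a b c = proj₁ (hom a b c)
        pattern-T : ∀ {i j k} → i ∈ J′ → j ∈ J′ → k ∈ J′ → i Fin.< j → j Fin.< k →
          ∀ a b c → edge (ys a i j) (ys b i k) (ys c j k) ≡ T a b c
        pattern-T i∈ j∈ k∈ i<j j<k a b c = proj₂ (hom a b c) _ (triple⊆ sorted′ i∈ j∈ k∈ i<j j<k) refl
        density : ∃[ i ] ∃[ j ] ∃[ k ] (i ∈ J′ × j ∈ J′ × k ∈ J′ × i Fin.< j × j Fin.< k) →
          Λ * (q * q * q) ≤ K * tripleCount T + q * (3 + K * (3 * q))
        density (i , j , k , i∈ , j∈ , k∈ , i<j , j<k) =
          subst (λ t → Λ * (q * q * q) ≤ K * t + q * (3 + K * (3 * q)))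
            (∑-cong (λ a → ∑-cong (λ b → ∑-cong (λ c → cong indicator (pattern-T i∈ j∈ k∈ i<j j<k a b c)))))
            (count {ys} i<j j<k (le (Any-resp-⊆ J′⊆ i∈) (Any-resp-⊆ J′⊆ j∈) (Any-resp-⊆ J′⊆ k∈) i<j j<k))

      fromSamples : Sampled (homogeneousBound q (3 + n)) noSamples q I → Palette K Λ q (3 + n) I
      fromSamples (J , ys , (J⊆ , lenJ) , inParts , le) = fromHomogeneous J⊆ inParts le
        (multiRamsey 3 (3 + n) (map (colour ys) (colourTriples q)) J
          (≤-reflexive (trans (cong (λ l → multiRamseyBound l 3 (3 + n)) (length-map (colour ys) (colourTriples q))) (sym lenJ))))

-- Closed tight walks

Triple : Set → Set
Triple C = C × C × C

-- A triple lists the colours of the pairs AB, AC, BC of a triangle A < B < C. For a triangle on vertices 0, 1, 2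
-- the Booleans tell whether 0 < 1, 0 < 2 and 1 < 2; the result lists the colours of 01, 02, 12.
arrange : {C : Set} → Triple C → Bool → Bool → Bool → Triple C
arrange (x , y , z) true  true  true  = x , y , z
arrange (x , y , z) true  true  false = y , x , z
arrange (x , y , z) false true  true  = x , z , y
arrange (x , y , z) true  false false = z , x , y
arrange (x , y , z) false false true  = y , z , x
arrange (x , y , z) false false false = z , y , x
arrange (x , y , z) true  false true  = x , x , x
arrange (x , y , z) false true  false = x , x , x

first last : {C : Set} → Triple C → C
first (x , _ , _) = x
last (_ , _ , z) = z

-- Passing from the vertices 0, 1, 2 of a triangle to 1, 2, 0 keeps the comparison of 1 and 2 and
-- reverses the other two, so the pair 12 moves from last to first place. The constant values of
-- `arrange` at the two cyclic comparison patterns make this hold without a consistency hypothesis.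
rotate : {C : Set} (τ : Triple C) (a b c : Bool) → last (arrange τ a b c) ≡ first (arrange τ c (not a) (not b))
rotate τ true  true  true  = refl
rotate τ true  true  false = refl
rotate τ false true  true  = refl
rotate τ true  false false = refl
rotate τ false false true  = refl
rotate τ false false false = refl
rotate τ true  false true  = refl
rotate τ false true  false = refl

<ᵇ-true : ∀ {a b} → a < b → (a <ᵇ b) ≡ true
<ᵇ-true {a} {b} a<b with a <ᵇ b | <⇒<ᵇ a<b
... | true | _ = refl

<ᵇ-false : ∀ {a b} → b ≤ a → (a <ᵇ b) ≡ false
<ᵇ-false {a} {b} b≤a with a <ᵇ b in eq
... | false = refl
... | true = ⊥-elim (<⇒≱ (<ᵇ⇒< a b (subst Bool.T (sym eq) _)) b≤a)

<ᵇ-not : ∀ {a b} → a ≢ b → (b <ᵇ a) ≡ not (a <ᵇ b)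
<ᵇ-not {a} {b} a≢b with <-cmp a b
... | tri< a<b _ _ = trans (<ᵇ-false (<⇒≤ a<b)) (cong not (sym (<ᵇ-true a<b)))
... | tri≈ _ a≡b _ = ⊥-elim (a≢b a≡b)
... | tri> _ _ b<a = trans (<ᵇ-true b<a) (cong not (sym (<ᵇ-false (<⇒≤ b<a))))

-- Doubling makes room for a copy of each vertex directly below the original. Copies and originals
-- of different vertices compare as the vertices themselves do.
double : ℕ → ℕ → ℕ
double a ε = ε + 2 * a

double-mono : ∀ {a b ε ε′} → a < b → ε ≤ 1 → double a ε < double b ε′
double-mono {a} {b} {ε} {ε′} a<b ε≤1 = begin
  suc (ε + 2 * a) ≤⟨ s≤s (+-monoˡ-≤ (2 * a) ε≤1) ⟩
  2 + 2 * a ≡⟨ sym (*-suc 2 a) ⟩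
  2 * suc a ≤⟨ *-monoʳ-≤ 2 a<b ⟩
  2 * b ≤⟨ m≤n+m (2 * b) ε′ ⟩
  ε′ + 2 * b ∎
  where open ≤-Reasoning

double-≢ : ∀ {a b ε ε′} → a ≢ b → ε ≤ 1 → ε′ ≤ 1 → double a ε ≢ double b ε′
double-≢ {a} {b} {ε} {ε′} a≢b ε≤1 ε′≤1 eq with <-cmp a b
... | tri< a<b _ _ = <⇒≢ (double-mono {ε′ = ε′} a<b ε≤1) eq
... | tri≈ _ a≡b _ = a≢b a≡b
... | tri> _ _ b<a = <⇒≢ (double-mono {ε′ = ε} b<a ε′≤1) (sym eq)

double-<ᵇ : ∀ {a b ε ε′} → a ≢ b → ε ≤ 1 → ε′ ≤ 1 → (double a ε <ᵇ double b ε′) ≡ (a <ᵇ b)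
double-<ᵇ {a} {b} {ε} {ε′} a≢b ε≤1 ε′≤1 with <-cmp a b
... | tri< a<b _ _ = trans (<ᵇ-true (double-mono {ε′ = ε′} a<b ε≤1)) (sym (<ᵇ-true a<b))
... | tri≈ _ a≡b _ = ⊥-elim (a≢b a≡b)
... | tri> _ _ b<a = trans (<ᵇ-false (<⇒≤ (double-mono {ε′ = ε} b<a ε′≤1))) (sym (<ᵇ-false (<⇒≤ b<a)))

module _ {C : Set} where

  at : (ℕ → Triple C) → (ℕ → ℕ) → ℕ → Triple C
  at τ rank t = arrange (τ t) (rank t <ᵇ rank (1 + t)) (rank t <ᵇ rank (2 + t)) (rank (1 + t) <ᵇ rank (2 + t))

  -- A closed tight walk of length ℓ: triangle t has vertices t, t + 1, t + 2, and vertex ℓ + s is vertex s.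
  record IsStrip (ℓ bound : ℕ) (τ : ℕ → Triple C) (rank : ℕ → ℕ) : Set where
    field
      closed-τ    : τ ℓ ≡ τ 0
      closed-rank : ∀ s → s < 3 → rank (s + ℓ) ≡ rank s
      shared      : ∀ t → t < ℓ → last (at τ rank t) ≡ first (at τ rank (1 + t))
      distinct₁   : ∀ t → t < 2 + ℓ → rank t ≢ rank (1 + t)
      distinct₂   : ∀ t → t < 1 + ℓ → rank t ≢ rank (2 + t)
      injective   : ∀ s t → s < ℓ → t < ℓ → rank s ≡ rank t → s ≡ t
      bounded     : ∀ t → t < ℓ → rank t < bound

-- In the lengthened walk the old vertices take odd ranks and the three new ones even ranks.
-- Positions from ℓ on denote the vertices 0, 1, 2 again; the walk must now close up at their new
-- copies, so these positions get the value 0.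
late : ℕ → ℕ → ℕ
late ℓ t with t <ᵇ ℓ
... | true  = 1
... | false = 0

late≤1 : ∀ ℓ t → late ℓ t ≤ 1
late≤1 ℓ t with t <ᵇ ℓ
... | true  = s≤s z≤n
... | false = z≤n

late-< : ∀ {ℓ t} → t < ℓ → late ℓ t ≡ 1
late-< t<ℓ rewrite <ᵇ-true t<ℓ = refl

late-≥ : ∀ {ℓ t} → ℓ ≤ t → late ℓ t ≡ 0
late-≥ ℓ≤t rewrite <ᵇ-false ℓ≤t = refl

module _ {C : Set} (ℓ : ℕ) (τ : ℕ → Triple C) (rank : ℕ → ℕ) where

  insertτ : ℕ → Triple C
  insertτ 0 = τ 0
  insertτ 1 = τ 0
  insertτ 2 = τ 0
  insertτ (suc (suc (suc t))) = τ t

  insertRank : ℕ → ℕ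
  insertRank 0 = double (rank 0) 0
  insertRank 1 = double (rank 1) 0
  insertRank 2 = double (rank 2) 0
  insertRank (suc (suc (suc t))) = double (rank t) (late ℓ t)

-- Going around the first triangle once more lengthens a closed tight walk by three.
insertTriangle : {C : Set} {ℓ bound : ℕ} {τ : ℕ → Triple C} {rank : ℕ → ℕ} → 3 ≤ ℓ → IsStrip ℓ bound τ rank →
  IsStrip (3 + ℓ) (2 * bound) (insertτ ℓ τ rank) (insertRank ℓ τ rank)
insertTriangle {C} {ℓ} {bound} {τ} {rank} 3≤ℓ strip = record
  { closed-τ    = closed-τ
  ; closed-rank = λ s s<3 → close s s<3
  ; shared      = share
  ; distinct₁   = dist₁
  ; distinct₂   = dist₂
  ; injective   = inj
  ; bounded     = bnd }
  where
  open IsStrip strip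
  r : ℕ → ℕ
  r = insertRank ℓ τ rank
  0≤1 : 0 ≤ 1
  0≤1 = z≤n
  l : ∀ t → late ℓ t ≤ 1
  l = late≤1 ℓ
  0≢1 : rank 0 ≢ rank 1
  0≢1 = distinct₁ 0 (s≤s z≤n)
  1≢2 : rank 1 ≢ rank 2
  1≢2 = distinct₁ 1 (s≤s (s≤s z≤n))
  0≢2 : rank 0 ≢ rank 2
  0≢2 = distinct₂ 0 (s≤s z≤n)
  1≢0 : rank 1 ≢ rank 0
  1≢0 = ≢-sym 0≢1
  2≢1 : rank 2 ≢ rank 1
  2≢1 = ≢-sym 1≢2
  2≢0 : rank 2 ≢ rank 0
  2≢0 = ≢-sym 0≢2

  close : ∀ s → s < 3 → r (s + (3 + ℓ)) ≡ r s
  close 0 _ = trans (cong₂ double (closed-rank 0 (s≤s z≤n)) (late-≥ {ℓ} ≤-refl)) refl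
  close 1 _ = cong₂ double (closed-rank 1 (s≤s (s≤s z≤n))) (late-≥ {ℓ} (n≤1+n ℓ))
  close 2 _ = cong₂ double (closed-rank 2 (s≤s (s≤s (s≤s z≤n)))) (late-≥ {ℓ} (m≤n+m ℓ 2))
  close (suc (suc (suc s))) (s≤s (s≤s (s≤s ())))

  arrange-cong : ∀ {τ : Triple C} {a a′ b b′ c c′} → a ≡ a′ → b ≡ b′ → c ≡ c′ → arrange τ a b c ≡ arrange τ a′ b′ c′
  arrange-cong refl refl refl = refl

  at-shift : ∀ t → t < 1 + ℓ → at (insertτ ℓ τ rank) r (3 + t) ≡ at τ rank t
  at-shift t t≤ℓ = arrange-cong
    (double-<ᵇ (distinct₁ t (≤-trans t≤ℓ (n≤1+n _))) (l t) (l (1 + t)))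
    (double-<ᵇ (distinct₂ t t≤ℓ) (l t) (l (2 + t)))
    (double-<ᵇ (distinct₁ (1 + t) (s≤s t≤ℓ)) (l (1 + t)) (l (2 + t)))

  share : ∀ t → t < 3 + ℓ → last (at (insertτ ℓ τ rank) r t) ≡ first (at (insertτ ℓ τ rank) r (1 + t))
  -- With primes for copies, triangles 0, 1, 2, 3 of the new walk lie on 0′1′2′, 1′2′0, 2′01 and
  -- 012, and all carry `τ 0`. As copies are ordered like their originals, each transition is an
  -- instance of `rotate`.
  share 0 _ = trans (cong last (arrange-cong {τ 0} (double-<ᵇ 0≢1 0≤1 0≤1) (double-<ᵇ 0≢2 0≤1 0≤1) (double-<ᵇ 1≢2 0≤1 0≤1)))
    (trans (rotate (τ 0) (rank 0 <ᵇ rank 1) (rank 0 <ᵇ rank 2) (rank 1 <ᵇ rank 2))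
    (cong first (sym (arrange-cong {τ 0} (double-<ᵇ 1≢2 0≤1 0≤1)
      (trans (double-<ᵇ 1≢0 0≤1 (l 0)) (<ᵇ-not 0≢1)) (trans (double-<ᵇ 2≢0 0≤1 (l 0)) (<ᵇ-not 0≢2))))))
  share 1 _ = trans (cong last (arrange-cong {τ 0} (double-<ᵇ 1≢2 0≤1 0≤1) (double-<ᵇ 1≢0 0≤1 (l 0)) (double-<ᵇ 2≢0 0≤1 (l 0))))
    (trans (rotate (τ 0) (rank 1 <ᵇ rank 2) (rank 1 <ᵇ rank 0) (rank 2 <ᵇ rank 0))
    (cong first (sym (arrange-cong {τ 0} (double-<ᵇ 2≢0 0≤1 (l 0))
      (trans (double-<ᵇ 2≢1 0≤1 (l 1)) (<ᵇ-not 1≢2)) (trans (double-<ᵇ 0≢1 (l 0) (l 1)) (<ᵇ-not 1≢0))))))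
  share 2 _ = trans (cong last (arrange-cong {τ 0} (double-<ᵇ 2≢0 0≤1 (l 0)) (double-<ᵇ 2≢1 0≤1 (l 1)) (double-<ᵇ 0≢1 (l 0) (l 1))))
    (trans (rotate (τ 0) (rank 2 <ᵇ rank 0) (rank 2 <ᵇ rank 1) (rank 0 <ᵇ rank 1))
    (cong first (sym (arrange-cong {τ 0} (double-<ᵇ 0≢1 (l 0) (l 1))
      (trans (double-<ᵇ 0≢2 (l 0) (l 2)) (<ᵇ-not 2≢0)) (trans (double-<ᵇ 1≢2 (l 1) (l 2)) (<ᵇ-not 2≢1))))))
  share (suc (suc (suc t))) (s≤s (s≤s (s≤s t<ℓ))) = trans (cong last (at-shift t (<-trans t<ℓ (n<1+n ℓ))))
    (trans (shared t t<ℓ) (cong first (sym (at-shift (1 + t) (s≤s t<ℓ)))))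

  dist₁ : ∀ t → t < 2 + (3 + ℓ) → r t ≢ r (1 + t)
  dist₁ 0 _ = double-≢ 0≢1 0≤1 0≤1
  dist₁ 1 _ = double-≢ 1≢2 0≤1 0≤1
  dist₁ 2 _ = double-≢ 2≢0 0≤1 (l 0)
  dist₁ (suc (suc (suc t))) (s≤s (s≤s (s≤s t<))) = double-≢ (distinct₁ t t<) (l t) (l (1 + t))

  dist₂ : ∀ t → t < 1 + (3 + ℓ) → r t ≢ r (2 + t)
  dist₂ 0 _ = double-≢ 0≢2 0≤1 0≤1
  dist₂ 1 _ = double-≢ 1≢0 0≤1 (l 0)
  dist₂ 2 _ = double-≢ 2≢1 0≤1 (l 1)
  dist₂ (suc (suc (suc t))) (s≤s (s≤s (s≤s t<))) = double-≢ (distinct₂ t t<) (l t) (l (2 + t))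

  early : ∀ s → s < 3 → r s ≡ double (rank s) 0
  early 0 _ = refl
  early 1 _ = refl
  early 2 _ = refl
  early (suc (suc (suc s))) (s≤s (s≤s (s≤s ())))

  halve : ∀ {a b ε} → ε ≤ 1 → double a ε ≡ double b ε → a ≡ b
  halve {a} {b} ε≤1 eq with a ≟ b
  ... | yes a≡b = a≡b
  ... | no a≢b = ⊥-elim (double-≢ a≢b ε≤1 ε≤1 eq)

  separate : ∀ s t → s < 3 → t < ℓ → r s ≢ r (3 + t)
  separate s t s<3 t<ℓ eq = even≢odd (rank s) (rank t)
    (trans (sym (early s s<3)) (trans eq (cong (double (rank t)) (late-< t<ℓ))))

  inj : ∀ s t → s < 3 + ℓ → t < 3 + ℓ → r s ≡ r t → s ≡ t
  inj s t s< t< eq with s <? 3 | t <? 3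
  ... | yes s<3 | yes t<3 = injective s t (<-≤-trans s<3 3≤ℓ) (<-≤-trans t<3 3≤ℓ)
    (halve 0≤1 (trans (sym (early s s<3)) (trans eq (early t t<3))))
  inj s (suc (suc (suc t))) s< (s≤s (s≤s (s≤s t<))) eq | yes s<3 | no _ = ⊥-elim (separate s t s<3 t< eq)
  inj s 0 s< t< eq | _ | no t≥ = ⊥-elim (t≥ (s≤s z≤n))
  inj s 1 s< t< eq | _ | no t≥ = ⊥-elim (t≥ (s≤s (s≤s z≤n)))
  inj s 2 s< t< eq | _ | no t≥ = ⊥-elim (t≥ (s≤s (s≤s (s≤s z≤n))))
  inj 0 t s< t< eq | no s≥ | _ = ⊥-elim (s≥ (s≤s z≤n))
  inj 1 t s< t< eq | no s≥ | _ = ⊥-elim (s≥ (s≤s (s≤s z≤n)))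
  inj 2 t s< t< eq | no s≥ | _ = ⊥-elim (s≥ (s≤s (s≤s (s≤s z≤n))))
  inj (suc (suc (suc s))) t (s≤s (s≤s (s≤s s<))) t< eq | no _ | yes t<3 = ⊥-elim (separate t s t<3 s< (sym eq))
  inj (suc (suc (suc s))) (suc (suc (suc t))) (s≤s (s≤s (s≤s s<))) (s≤s (s≤s (s≤s t<))) eq | no _ | no _ =
    cong (3 +_) (injective s t s< t< (halve {ε = 1} ≤-refl
      (trans (sym (cong (double (rank s)) (late-< s<))) (trans eq (cong (double (rank t)) (late-< t<))))))

  bnd : ∀ t → t < 3 + ℓ → r t < 2 * bound
  bnd t t< with t <? 3
  ... | yes t<3 = subst (_< 2 * bound) (sym (early t t<3)) (double-mono {ε′ = 0} (bounded t (<-≤-trans t<3 3≤ℓ)) 0≤1)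
  bnd 0 t< | no t≥ = ⊥-elim (t≥ (s≤s z≤n))
  bnd 1 t< | no t≥ = ⊥-elim (t≥ (s≤s (s≤s z≤n)))
  bnd 2 t< | no t≥ = ⊥-elim (t≥ (s≤s (s≤s (s≤s z≤n))))
  bnd (suc (suc (suc t))) (s≤s (s≤s (s≤s t<ℓ))) | no _ = double-mono {ε′ = 0} (bounded t t<ℓ) (l t)

-- Dense palettes contain closed tight walks

-- Every condition on a strip is an equality or a bounded quantification, so a concrete walk can be
-- verified by evaluation.
isStrip? : ∀ ℓ bound (τ : ℕ → Triple (Fin 6)) rank → Dec (IsStrip ℓ bound τ rank)
isStrip? ℓ bound τ rank = map′
  (λ { (ct , cr , sh , d₁ , d₂ , inj , bd) → record
    { closed-τ = ct ; closed-rank = λ s → cr {s} ; shared = λ t → sh {t} ; distinct₁ = λ t → d₁ {t}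
    ; distinct₂ = λ t → d₂ {t} ; injective = λ s t s<ℓ t<ℓ → inj {s} s<ℓ {t} t<ℓ ; bounded = λ t → bd {t} } })
  (λ strip → let open IsStrip strip in closed-τ , (λ {s} → closed-rank s) , (λ {t} → shared t) , (λ {t} → distinct₁ t) ,
    (λ {t} → distinct₂ t) , (λ {s} s<ℓ {t} t<ℓ → injective s t s<ℓ t<ℓ) , (λ {t} → bounded t))
  (triple≟ (τ ℓ) (τ 0)
    ×-dec allUpTo? (λ s → rank (s + ℓ) ≟ rank s) 3
    ×-dec allUpTo? (λ t → last (at τ rank t) Finₚ.≟ first (at τ rank (1 + t))) ℓ
    ×-dec allUpTo? (λ t → ¬? (rank t ≟ rank (1 + t))) (2 + ℓ)
    ×-dec allUpTo? (λ t → ¬? (rank t ≟ rank (2 + t))) (1 + ℓ)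
    ×-dec allUpTo? (λ s → allUpTo? (λ t → (rank s ≟ rank t) →-dec (s ≟ t)) ℓ) ℓ
    ×-dec allUpTo? (λ t → rank t <? bound) ℓ)
  where
  triple≟ : (σ τ : Triple (Fin 6)) → Dec (σ ≡ τ)
  triple≟ (a , b , c) (a′ , b′ , c′) = map′ (λ { (refl , refl , refl) → refl }) (λ { refl → refl , refl , refl })
    (a Finₚ.≟ a′ ×-dec b Finₚ.≟ b′ ×-dec c Finₚ.≟ c′)

-- pij places the first colour in role i and the second in role j of a triple.
data Placement : Set where
  p12 p13 p21 p23 p31 p32 : Placement

place : {C : Set} → Placement → C → C → C → Triple C
place p12 s u a = s , u , a
place p13 s u a = s , a , u
place p21 s u a = u , s , a
place p23 s u a = a , s , u
place p31 s u a = u , a , s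
place p32 s u a = a , u , s

-- A wing is a triple sharing a colour with the base triple: its index in the base and its placement in the wing.
Wing : Set
Wing = Fin 3 × Placement

-- A wing (s , p) with second colour u identifies the three vertices of the base triple with the two ends of u and
-- a third vertex. The wings are grouped by this bijection: even₁, even₂, even₃ differ by rotations of the base
-- triple, and so do odd₁, odd₂, odd₃.
even₁ even₂ even₃ odd₁ odd₂ odd₃ : List Wing
even₁ = (0F , p13) ∷ (1F , p23) ∷ (1F , p32) ∷ []
even₂ = (0F , p31) ∷ (2F , p13) ∷ []
even₃ = (1F , p12) ∷ (1F , p21) ∷ (2F , p31) ∷ []
odd₁ = (0F , p12) ∷ (0F , p21) ∷ (2F , p23) ∷ (2F , p32) ∷ []
odd₂ = (0F , p23) ∷ (0F , p32) ∷ (1F , p13) ∷ []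
odd₃ = (1F , p31) ∷ (2F , p12) ∷ (2F , p21) ∷ []

conflicts : List (List Wing × List Wing)
conflicts = (even₁ , even₂) ∷ (even₁ , even₃) ∷ (even₂ , even₃) ∷ (odd₁ , odd₂) ∷ (odd₁ , odd₃) ∷ (odd₂ , odd₃) ∷ []

-- Colours 0, 1, 2 form the base triple, 3 is common to both wings.
triangle : Wing → Wing → ℕ → Triple (Fin 6)
triangle (s , p) (s′ , p′) 0 = 0F , 1F , 2F
triangle (s , p) (s′ , p′) 1 = place p (Fin.inject≤ s (s≤s (s≤s (s≤s z≤n)))) 3F 4F
triangle (s , p) (s′ , p′) _ = place p′ (Fin.inject≤ s′ (s≤s (s≤s (s≤s z≤n)))) 3F 5F

-- Position 0 is the leading one of seven decimal digits. Reading positions modulo 7 makes the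
-- sequences periodic, which closes the walk.
digit : ℕ → ℕ → ℕ
digit n t with 6 ∸ t % 7
... | 0 = n % 10
... | 1 = n div 10 % 10
... | 2 = n div 100 % 10
... | 3 = n div 1000 % 10
... | 4 = n div 10000 % 10
... | 5 = n div 100000 % 10
... | _ = n div 1000000 % 10

WingStrip : Wing → Wing → ℕ × ℕ → Set
WingStrip v v′ (triangles , ranks) = IsStrip 7 7 (λ t → triangle v v′ (digit triangles t)) (digit ranks)

-- Closed tight walks of length 7 through the base triple and two conflicting wings, found by computer search:
-- seven digits (leading zeros omitted) give the triangle used at each step, and seven more the relative order of the
-- vertices.
strips : List (ℕ × ℕ)
strips =
  (1212 , 4560123) ∷ (211 , 241356) ∷ (2210 , 362514) ∷ (210 , 241356) ∷ (2210 , 1362504) ∷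
  (210 , 3450126) ∷ (1220 , 241365) ∷ (1220 , 241356) ∷ (1200 , 241356) ∷ (11220 , 241365) ∷
  (11220 , 241356) ∷ (11200 , 241356) ∷ (11220 , 342165) ∷ (11220 , 352146) ∷ (11200 , 352146) ∷
  (21 , 4560231) ∷ (21 , 2460351) ∷ (221 , 2460351) ∷ (21100 , 342615) ∷ (21100 , 362514) ∷
  (121200 , 123456) ∷ (1122 , 351462) ∷ (1122 , 2460351) ∷ (1120 , 251463) ∷ (1122 , 361542) ∷
  (1122 , 2360541) ∷ (1120 , 261543) ∷ (122 , 461253) ∷ (122 , 3460152) ∷ (120 , 241365) ∷
  (122 , 351462) ∷ (122 , 2460351) ∷ (120 , 251463) ∷ (21 , 251463) ∷ (221 , 241356) ∷
  (221 , 241365) ∷ (21 , 351462) ∷ (221 , 561234) ∷ (221 , 461253) ∷ (21100 , 453216) ∷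
  (121200 , 162534) ∷ (121200 , 132546) ∷ (21100 , 453126) ∷ (121200 , 362514) ∷ (121200 , 342516) ∷
  (1220 , 2450316) ∷ (1200 , 261534) ∷ (1200 , 251436) ∷ (1220 , 1352406) ∷ (1200 , 362514) ∷
  (1200 , 352416) ∷ (11220 , 2340516) ∷ (11200 , 241635) ∷ (11200 , 241536) ∷
  []

-- A finite check over 54 pairs of wings, 21 even and 33 odd. For each pair the list is searched for
-- a suitable walk, so the correctness of the data is established by the evaluation itself.
strips-complete : All (λ { (vs , vs′) → All (λ v → All (λ v′ → Any (WingStrip v v′) strips) vs′) vs }) conflicts
strips-complete = from-yes (all? (λ { (vs , vs′) → all? (λ v → all? (λ v′ →
  Any.any? (λ r → isStrip? 7 7 (λ t → triangle v v′ (digit (proj₁ r) t)) (digit (proj₂ r))) strips) vs′) vs }) conflicts)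

mapTriple : {B C : Set} → (B → C) → Triple B → Triple C
mapTriple ρ (x , y , z) = ρ x , ρ y , ρ z

arrange-map : {B C : Set} (ρ : B → C) (τ : Triple B) (a b c : Bool) →
  arrange (mapTriple ρ τ) a b c ≡ mapTriple ρ (arrange τ a b c)
arrange-map ρ τ true  true  true  = refl
arrange-map ρ τ true  true  false = refl
arrange-map ρ τ false true  true  = refl
arrange-map ρ τ true  false false = refl
arrange-map ρ τ false false true  = refl
arrange-map ρ τ false false false = refl
arrange-map ρ τ true  false true  = refl
arrange-map ρ τ false true  false = refl

-- Renaming may identify colours, for instance when a wing repeats a colour of the base. This is
-- harmless: a strip requires some colours to agree and none to differ, and the order of its
-- vertices is untouched.
IsStrip-map : ∀ {B C : Set} (ρ : B → C) {ℓ bound τ rank} → IsStrip ℓ bound τ rank →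
  IsStrip ℓ bound (λ t → mapTriple ρ (τ t)) rank
IsStrip-map ρ {τ = τ} {rank = rank} strip = record
  { closed-τ = cong (mapTriple ρ) closed-τ ; closed-rank = closed-rank
  ; shared = λ t t<ℓ → trans (cong last (at-map t)) (trans (cong ρ (shared t t<ℓ)) (cong first (sym (at-map (1 + t)))))
  ; distinct₁ = distinct₁ ; distinct₂ = distinct₂ ; injective = injective ; bounded = bounded }
  where
  open IsStrip strip
  at-map : ∀ t → at (λ t → mapTriple ρ (τ t)) rank t ≡ mapTriple ρ (at τ rank t)
  at-map t = arrange-map ρ (τ t) (rank t <ᵇ rank (1 + t)) (rank t <ᵇ rank (2 + t)) (rank (1 + t) <ᵇ rank (2 + t))

module _ {q : ℕ} (T : Fin q → Fin q → Fin q → Bool) where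

  InPalette : Triple (Fin q) → Set
  InPalette (x , y , z) = T x y z ≡ true

  PaletteStrip : ℕ → ℕ → Set
  PaletteStrip ℓ bound = Σ (ℕ → Triple (Fin q)) λ τ → ∃[ rank ] (IsStrip ℓ bound τ rank × ∀ t → InPalette (τ t))

  insertPaletteTriangle : ∀ {ℓ bound} → 3 ≤ ℓ → PaletteStrip ℓ bound → PaletteStrip (3 + ℓ) (2 * bound)
  insertPaletteTriangle {ℓ} 3≤ℓ (τ , rank , strip , inT) =
    insertτ ℓ τ rank , insertRank ℓ τ rank , insertTriangle 3≤ℓ strip ,
    λ { 0 → inT 0 ; 1 → inT 0 ; 2 → inT 0 ; (suc (suc (suc t))) → inT t }

  -- The walk of length 7 is the shortest one required, 3 · 1 + 4. Every further triangle doubles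
  -- the range of the ranks, whence the factor 2 ^ m.
  extendStrip : ∀ m → PaletteStrip 7 7 → PaletteStrip (m * 3 + 7) (2 ^ m * 7)
  extendStrip zero    strip = strip
  extendStrip (suc m) strip = subst (PaletteStrip _) (sym (*-assoc 2 (2 ^ m) 7))
    (insertPaletteTriangle (≤-trans (s≤s (s≤s (s≤s z≤n))) (m≤n+m 7 (m * 3))) (extendStrip m strip))

  module _ (g d f : Fin q) where

    baseColour : Fin 3 → Fin q
    baseColour 0F = g
    baseColour 1F = d
    baseColour 2F = f

    HasWing : Fin q → Wing → Set
    HasWing u (s , p) = ∃[ a ] InPalette (place p (baseColour s) u a)

    Covers : List Wing → Fin q → Set
    Covers vs u = Any (HasWing u) vs

    covers? : ∀ vs u → Dec (Covers vs u)
    covers? vs u = Any.any? (λ { (s , p) → Finₚ.any? (λ a → inPalette? (place p (baseColour s) u a)) }) vs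
      where
      inPalette? : ∀ τ → Dec (InPalette τ)
      inPalette? (x , y , z) = T x y z Bool.≟ true

    covered : List Wing → Fin q → ℕ
    covered vs u = indicator ⌊ covers? vs u ⌋

    weight : List Wing → ℕ
    weight vs = ∑ q (covered vs)

    wingStrip : InPalette (g , d , f) → ∀ {u} v v′ → HasWing u v → HasWing u v′ → ∀ {r} → WingStrip v v′ r → PaletteStrip 7 7
    wingStrip base {u} (s , p) (s′ , p′) (a , w) (b , w′) {r} strip =
      _ , digit (proj₂ r) , IsStrip-map ρ strip , λ t → valid (digit (proj₁ r) t)
      where
      ρ : Fin 6 → Fin q
      ρ 0F = g
      ρ 1F = d
      ρ 2F = f
      ρ 3F = u
      ρ 4F = a
      ρ 5F = b
      valid-place : ∀ s p a i → ρ i ≡ a → InPalette (place p (baseColour s) u a) →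
        InPalette (mapTriple ρ (place p (Fin.inject≤ s (s≤s (s≤s (s≤s z≤n)))) 3F i))
      valid-place 0F p12 _ _ refl w = w
      valid-place 0F p13 _ _ refl w = w
      valid-place 0F p21 _ _ refl w = w
      valid-place 0F p23 _ _ refl w = w
      valid-place 0F p31 _ _ refl w = w
      valid-place 0F p32 _ _ refl w = w
      valid-place 1F p12 _ _ refl w = w
      valid-place 1F p13 _ _ refl w = w
      valid-place 1F p21 _ _ refl w = w
      valid-place 1F p23 _ _ refl w = w
      valid-place 1F p31 _ _ refl w = w
      valid-place 1F p32 _ _ refl w = w
      valid-place 2F p12 _ _ refl w = w
      valid-place 2F p13 _ _ refl w = w
      valid-place 2F p21 _ _ refl w = w
      valid-place 2F p23 _ _ refl w = w
      valid-place 2F p31 _ _ refl w = w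
      valid-place 2F p32 _ _ refl w = w
      valid : ∀ k → InPalette (mapTriple ρ (triangle (s , p) (s′ , p′) k))
      valid 0 = base
      valid 1 = valid-place s p a 4F refl w
      valid (suc (suc _)) = valid-place s′ p′ b 5F refl w′

    conflictStrip : InPalette (g , d , f) → ∀ {vs vs′} → (vs , vs′) ∈ conflicts → ∀ {u} → Covers vs u → Covers vs′ u →
      PaletteStrip 7 7
    conflictStrip base {vs} {vs′} c {u} cov cov′ =
      let v , v∈ , w = find cov
          v′ , v′∈ , w′ = find cov′
          r , _ , strip = find (All.lookup (All.lookup (All.lookup strips-complete c) v∈) v′∈)
      in wingStrip base v v′ w w′ {r} strip

    Conflict : List Wing × List Wing → Set
    Conflict (vs , vs′) = ∃[ u ] (Covers vs u × Covers vs′ u)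

    conflict? : ∀ c → Dec (Conflict c)
    conflict? (vs , vs′) = Finₚ.any? (λ u → covers? vs u ×-dec covers? vs′ u)

    disjointWeights : ∀ {vs₁ vs₂ vs₃} → ¬ Conflict (vs₁ , vs₂) → ¬ Conflict (vs₁ , vs₃) → ¬ Conflict (vs₂ , vs₃) →
      weight vs₁ + weight vs₂ + weight vs₃ ≤ q
    disjointWeights {vs₁} {vs₂} {vs₃} ¬12 ¬13 ¬23 = begin
      weight vs₁ + weight vs₂ + weight vs₃ ≡⟨ cong (_+ weight vs₃) (sym (∑-+ (covered vs₁) (covered vs₂))) ⟩
      ∑ q (λ u → covered vs₁ u + covered vs₂ u) + weight vs₃ ≡⟨ sym (∑-+ (λ u → covered vs₁ u + covered vs₂ u) (covered vs₃)) ⟩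
      ∑ q (λ u → covered vs₁ u + covered vs₂ u + covered vs₃ u) ≤⟨ ∑-mono atMostOnce ⟩
      ∑ q (λ _ → 1) ≡⟨ trans (∑-const q 1) (*-identityʳ q) ⟩
      q ∎
      where
      open ≤-Reasoning
      atMostOnce : ∀ u → covered vs₁ u + covered vs₂ u + covered vs₃ u ≤ 1
      atMostOnce u with covers? vs₁ u | covers? vs₂ u | covers? vs₃ u
      ... | yes a | yes b | _     = ⊥-elim (¬12 (u , a , b))
      ... | yes a | no _  | yes c = ⊥-elim (¬13 (u , a , c))
      ... | no _  | yes b | yes c = ⊥-elim (¬23 (u , b , c))
      ... | yes _ | no _  | no _  = ≤-refl
      ... | no _  | yes _ | no _  = ≤-refl
      ... | no _  | no _  | yes _ = ≤-refl
      ... | no _  | no _  | no _  = z≤n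

    -- A triple through a base colour in a fixed role is a wing in two ways, as either of the other
    -- two colours may be the second colour. The pairs of other colours therefore lie in the product
    -- of two covered sets.
    linkBound : ∀ (F : Fin q → Fin q → Bool) vs vs′ → (∀ u v → F u v ≡ true → Covers vs u × Covers vs′ v) →
      ∑ q (λ u → ∑ q (λ v → indicator (F u v))) ≤ weight vs * weight vs′
    linkBound F vs vs′ cov = begin
      ∑ q (λ u → ∑ q (λ v → indicator (F u v))) ≤⟨ ∑-mono (λ u → ∑-mono (λ v → pointwise u v)) ⟩
      ∑ q (λ u → ∑ q (λ v → covered vs u * covered vs′ v)) ≡⟨ ∑-cong (λ u → ∑-*ˡ (covered vs u) (covered vs′)) ⟩
      ∑ q (λ u → covered vs u * weight vs′) ≡⟨ ∑-*ʳ (weight vs′) (covered vs) ⟩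
      weight vs * weight vs′ ∎
      where
      open ≤-Reasoning
      pointwise : ∀ u v → indicator (F u v) ≤ covered vs u * covered vs′ v
      pointwise u v with F u v in eq
      ... | false = z≤n
      ... | true with covers? vs u | covers? vs′ v
      ...   | yes _ | yes _ = ≤-refl
      ...   | no ¬c | _     = ⊥-elim (¬c (proj₁ (cov u v eq)))
      ...   | yes _ | no ¬c = ⊥-elim (¬c (proj₂ (cov u v eq)))

  degree₁ degree₂ degree₃ degree : Fin q → ℕ
  degree₁ x = ∑ q (λ u → ∑ q (λ v → indicator (T x u v)))
  degree₂ x = ∑ q (λ u → ∑ q (λ v → indicator (T u x v)))
  degree₃ x = ∑ q (λ u → ∑ q (λ v → indicator (T u v x)))
  degree x = degree₁ x + degree₂ x + degree₃ x

-- The quadratic form in the class sizes and the degree count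

2ab≤a²+b² : ∀ a b → 2 * (a * b) ≤ a * a + b * b
2ab≤a²+b² a b with ≤-total a b
... | inj₁ a≤b = subst (λ b → 2 * (a * b) ≤ a * a + b * b) (m+[n∸m]≡n a≤b) (shifted a (b ∸ a))
  where
  shifted : ∀ a k → 2 * (a * (a + k)) ≤ a * a + (a + k) * (a + k)
  shifted a k = ≤-trans (m≤m+n _ (k * k)) (≤-reflexive (identity a k))
    where
    identity : ∀ a k → 2 * (a * (a + k)) + k * k ≡ a * a + (a + k) * (a + k)
    identity = solve-∀
... | inj₂ b≤a = subst (λ a → 2 * (a * b) ≤ a * a + b * b) (m+[n∸m]≡n b≤a) (shifted b (a ∸ b))
  where
  shifted : ∀ b k → 2 * ((b + k) * b) ≤ (b + k) * (b + k) + b * b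
  shifted b k = ≤-trans (m≤m+n _ (k * k)) (≤-reflexive (identity b k))
    where
    identity : ∀ b k → 2 * ((b + k) * b) + k * k ≡ (b + k) * (b + k) + b * b
    identity = solve-∀

-- With q = a + p + d = b + c + r one has
-- 16 q² = 12 F + 3 ((2b + c) - (2d + a))² + (3 (a + c) - 2q)² + 12 p d + 12 c (b + r).
linkForm≤ : ∀ a p d b c r → a + p + d ≡ b + c + r →
  3 * (a * b + a * p + c * p + (r * p + r * b + d * b) + (d * c + d * a + r * a)) ≤ 4 * ((a + p + d) * (a + p + d))
linkForm≤ a p d b c r eq = *-cancelˡ-≤ 4 (+-cancelʳ-≤ (S + (6 * (X * Y) + 12 * (U * Q))) _ _ (begin
  4 * (3 * F) + (S + (6 * (X * Y) + 12 * (U * Q))) ≤⟨ +-monoʳ-≤ (4 * (3 * F)) (+-monoʳ-≤ S (+-mono-≤ 6XY 12UQ)) ⟩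
  4 * (3 * F) + (S + (3 * (X * X + Y * Y) + (9 * (U * U) + 4 * (Q * Q)))) ≤⟨ m≤m+n _ (12 * (p * d) + 12 * (c * (b + r))) ⟩
  4 * (3 * F) + (S + (3 * (X * X + Y * Y) + (9 * (U * U) + 4 * (Q * Q)))) + (12 * (p * d) + 12 * (c * (b + r)))
    ≡⟨ identity a p d b c r ⟩
  4 * (4 * (Q * Q)) + (12 * (a + p + b + c) * (b + c + r) + (6 * (X * Y) + 12 * (U * Q)))
    ≡⟨ cong (λ t → 4 * (4 * (Q * Q)) + (12 * (a + p + b + c) * t + (6 * (X * Y) + 12 * (U * Q)))) (sym eq) ⟩
  4 * (4 * (Q * Q)) + (S + (6 * (X * Y) + 12 * (U * Q))) ∎))
  where
  open ≤-Reasoning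
  F = a * b + a * p + c * p + (r * p + r * b + d * b) + (d * c + d * a + r * a)
  X = 2 * b + c
  Y = 2 * d + a
  U = a + c
  Q = a + p + d
  S = 12 * (a + p + b + c) * (a + p + d)
  6XY : 6 * (X * Y) ≤ 3 * (X * X + Y * Y)
  6XY = ≤-trans (≤-reflexive (lemma (X * Y))) (*-monoʳ-≤ 3 (2ab≤a²+b² X Y))
    where
    lemma : ∀ t → 6 * t ≡ 3 * (2 * t)
    lemma = solve-∀
  12UQ : 12 * (U * Q) ≤ 9 * (U * U) + 4 * (Q * Q)
  12UQ = ≤-trans (≤-reflexive (lemma U Q)) (≤-trans (2ab≤a²+b² (3 * U) (2 * Q)) (≤-reflexive (lemma₂ U Q)))
    where
    lemma : ∀ u q → 12 * (u * q) ≡ 2 * (3 * u * (2 * q))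
    lemma = solve-∀
    lemma₂ : ∀ u q → 3 * u * (3 * u) + 2 * q * (2 * q) ≡ 9 * (u * u) + 4 * (q * q)
    lemma₂ = solve-∀
  identity : ∀ a p d b c r →
    4 * (3 * (a * b + a * p + c * p + (r * p + r * b + d * b) + (d * c + d * a + r * a)))
      + (12 * (a + p + b + c) * (a + p + d) + (3 * ((2 * b + c) * (2 * b + c) + (2 * d + a) * (2 * d + a))
        + (9 * ((a + c) * (a + c)) + 4 * ((a + p + d) * (a + p + d))))) + (12 * (p * d) + 12 * (c * (b + r)))
    ≡ 4 * (4 * ((a + p + d) * (a + p + d))) + (12 * (a + p + b + c) * (b + c + r)
      + (6 * ((2 * b + c) * (2 * d + a)) + 12 * ((a + c) * (a + p + d))))
  identity = solve-∀

-- The form is monotone in every class size, so one odd and one even class may be enlarged until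
-- both parities sum to exactly q, as `linkForm≤` requires.
linkForm-bound : ∀ q a p d b c r → a + p + d ≤ q → b + c + r ≤ q →
  3 * (a * b + a * p + c * p + (r * p + r * b + d * b) + (d * c + d * a + r * a)) ≤ 4 * (q * q)
linkForm-bound q a p d b c r o≤ e≤ = ≤-trans (*-monoʳ-≤ 3 grow) (≤-trans (linkForm≤ a′ p d b c r′ (trans o≡ (sym e≡)))
  (≤-reflexive (cong (λ t → 4 * (t * t)) o≡)))
  where
  a′ = q ∸ (p + d)
  r′ = q ∸ (b + c)
  o≡ : a′ + p + d ≡ q
  o≡ = trans (+-assoc a′ p d) (m∸n+n≡m (≤-trans (m≤n+m (p + d) a) (≤-trans (≤-reflexive (sym (+-assoc a p d))) o≤)))
  e≡ : b + c + r′ ≡ q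
  e≡ = m+[n∸m]≡n (≤-trans (m≤m+n (b + c) r) e≤)
  a≤ : a ≤ a′
  a≤ = m+n≤o⇒m≤o∸n a (≤-trans (≤-reflexive (sym (+-assoc a p d))) o≤)
  r≤ : r ≤ r′
  r≤ = m+n≤o⇒m≤o∸n r (≤-trans (≤-reflexive (+-comm r (b + c))) e≤)
  grow : a * b + a * p + c * p + (r * p + r * b + d * b) + (d * c + d * a + r * a) ≤
    a′ * b + a′ * p + c * p + (r′ * p + r′ * b + d * b) + (d * c + d * a′ + r′ * a′)
  grow = +-mono-≤ (+-mono-≤ (+-monoˡ-≤ (c * p) (+-mono-≤ (*-monoˡ-≤ b a≤) (*-monoˡ-≤ p a≤)))
      (+-monoˡ-≤ (d * b) (+-mono-≤ (*-monoˡ-≤ p r≤) (*-monoˡ-≤ b r≤))))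
    (+-mono-≤ (+-monoʳ-≤ (d * c) (*-monoʳ-≤ d a≤)) (*-mono-≤ r≤ a≤))

module _ {q : ℕ} (T : Fin q → Fin q → Fin q → Bool) where

  -- Without a conflict, each of the nine links (a base colour in one of three roles) is bounded by
  -- the product of the classes that contain its two wings; the chains of `here` and `there` locate
  -- the wings in these classes. The result is the form of `linkForm-bound`, where `a`, `p`, `d` are
  -- the odd and `b`, `c`, `r` the even weights.
  baseStrip : ∀ g d f → T g d f ≡ true → 4 * (q * q) < 3 * (degree T g + degree T d + degree T f) → PaletteStrip T 7 7
  baseStrip g d f base heavy with Any.any? (conflict? T g d f) conflicts
  ... | yes c = let _ , c∈ , u , cov , cov′ = find c in conflictStrip T g d f base c∈ cov cov′
  ... | no ¬c = ⊥-elim (<⇒≱ heavy (≤-trans (*-monoʳ-≤ 3 (begin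
      degree T g + degree T d + degree T f
        ≤⟨ +-mono-≤ (+-mono-≤
             (+-mono-≤ (+-mono-≤
               (link (λ u v → T g u v) odd₁ even₁ λ u v t → here (v , t) , here (u , t))
               (link (λ u v → T u g v) odd₁ odd₂ λ u v t → there (here (v , t)) , here (u , t)))
               (link (λ u v → T u v g) even₂ odd₂ λ u v t → here (v , t) , there (here (u , t))))
             (+-mono-≤ (+-mono-≤
               (link (λ u v → T d u v) even₃ odd₂ λ u v t → here (v , t) , there (there (here (u , t))))
               (link (λ u v → T u d v) even₃ even₁ λ u v t → there (here (v , t)) , there (here (u , t))))
               (link (λ u v → T u v d) odd₃ even₁ λ u v t → here (v , t) , there (there (here (u , t))))))
             (+-mono-≤ (+-mono-≤
               (link (λ u v → T f u v) odd₃ even₂ λ u v t → there (here (v , t)) , there (here (u , t)))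
               (link (λ u v → T u f v) odd₃ odd₁ λ u v t → there (there (here (v , t))) , there (there (here (u , t)))))
               (link (λ u v → T u v f) even₃ odd₁ λ u v t → there (there (here (v , t))) , there (there (there (here (u , t)))))) ⟩
      W odd₁ * W even₁ + W odd₁ * W odd₂ + W even₂ * W odd₂ + (W even₃ * W odd₂ + W even₃ * W even₁ + W odd₃ * W even₁)
        + (W odd₃ * W even₂ + W odd₃ * W odd₁ + W even₃ * W odd₁) ∎))
    (linkForm-bound q (W odd₁) (W odd₂) (W odd₃) (W even₁) (W even₂) (W even₃)
      (disjointWeights T g d f {odd₁} {odd₂} {odd₃} (λ c → ¬c (there (there (there (here c)))))
        (λ c → ¬c (there (there (there (there (here c)))))) (λ c → ¬c (there (there (there (there (there (here c))))))))
      (disjointWeights T g d f {even₁} {even₂} {even₃} (λ c → ¬c (here c)) (λ c → ¬c (there (here c)))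
        (λ c → ¬c (there (there (here c))))))))
    where
    open ≤-Reasoning
    W = weight T g d f
    link = linkBound T g d f

  -- Cauchy-Schwarz against the constant function, obtained by summing `2ab≤a²+b²` over all pairs of
  -- values.
  ∑-square : ∀ (h : Fin q → ℕ) → ∑ q h * ∑ q h ≤ q * ∑ q (λ x → h x * h x)
  ∑-square h = *-cancelˡ-≤ 2 (begin
    2 * (∑ q h * ∑ q h) ≡⟨ cong (2 *_) (sym (∑-*ʳ (∑ q h) h)) ⟩
    2 * ∑ q (λ x → h x * ∑ q h) ≡⟨ sym (∑-*ˡ 2 (λ x → h x * ∑ q h)) ⟩
    ∑ q (λ x → 2 * (h x * ∑ q h)) ≡⟨ ∑-cong (λ x → trans (cong (2 *_) (sym (∑-*ˡ (h x) h))) (sym (∑-*ˡ 2 (λ y → h x * h y)))) ⟩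
    ∑ q (λ x → ∑ q (λ y → 2 * (h x * h y))) ≤⟨ ∑-mono (λ x → ∑-mono (λ y → 2ab≤a²+b² (h x) (h y))) ⟩
    ∑ q (λ x → ∑ q (λ y → h x * h x + h y * h y)) ≡⟨ ∑-cong (λ x → trans (∑-+ (λ _ → h x * h x) (λ y → h y * h y))
        (cong (_+ s) (∑-const q (h x * h x)))) ⟩
    ∑ q (λ x → q * (h x * h x) + s) ≡⟨ ∑-+ (λ x → q * (h x * h x)) (λ _ → s) ⟩
    ∑ q (λ x → q * (h x * h x)) + ∑ q (λ _ → s) ≡⟨ cong₂ _+_ (∑-*ˡ q (λ x → h x * h x)) (∑-const q s) ⟩
    q * s + q * s ≡⟨ cong (q * s +_) (sym (+-identityʳ (q * s))) ⟩
    2 * (q * s) ∎)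
    where
    open ≤-Reasoning
    s = ∑ q (λ x → h x * h x)

  private
    t : Fin q → Fin q → Fin q → ℕ
    t a b c = indicator (T a b c)
    ∑³ : (Fin q → Fin q → Fin q → ℕ) → ℕ
    ∑³ h = ∑ q (λ a → ∑ q (λ b → ∑ q (λ c → h a b c)))

  ∑-by₁ : ∀ (h : Fin q → ℕ) → ∑³ (λ a b c → h a * t a b c) ≡ ∑ q (λ x → h x * degree₁ T x)
  ∑-by₁ h = ∑-cong (λ a → trans (∑-cong (λ b → ∑-*ˡ (h a) (t a b))) (∑-*ˡ (h a) (λ b → ∑ q (t a b))))

  ∑-by₂ : ∀ (h : Fin q → ℕ) → ∑³ (λ a b c → h b * t a b c) ≡ ∑ q (λ x → h x * degree₂ T x)
  ∑-by₂ h = trans (∑-swap (λ a b → ∑ q (λ c → h b * t a b c)))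
    (∑-cong (λ b → trans (∑-cong (λ a → ∑-*ˡ (h b) (t a b))) (∑-*ˡ (h b) (λ a → ∑ q (t a b)))))

  ∑-by₃ : ∀ (h : Fin q → ℕ) → ∑³ (λ a b c → h c * t a b c) ≡ ∑ q (λ x → h x * degree₃ T x)
  ∑-by₃ h = trans (∑-cong (λ a → ∑-swap (λ b c → h c * t a b c)))
    (trans (∑-swap (λ a c → ∑ q (λ b → h c * t a b c)))
      (∑-cong (λ c → trans (∑-cong (λ a → ∑-*ˡ (h c) (λ b → t a b c))) (∑-*ˡ (h c) (λ a → ∑ q (λ b → t a b c))))))

  ∑³-+ : ∀ h k → ∑³ (λ a b c → h a b c + k a b c) ≡ ∑³ h + ∑³ k
  ∑³-+ h k = trans (∑-cong (λ a → trans (∑-cong (λ b → ∑-+ (h a b) (k a b)))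
    (∑-+ (λ b → ∑ q (h a b)) (λ b → ∑ q (k a b))))) (∑-+ (λ a → ∑ q (λ b → ∑ q (h a b))) (λ a → ∑ q (λ b → ∑ q (k a b))))

  ∑³-*ˡ : ∀ k h → ∑³ (λ a b c → k * h a b c) ≡ k * ∑³ h
  ∑³-*ˡ k h = trans (∑-cong (λ a → trans (∑-cong (λ b → ∑-*ˡ k (h a b))) (∑-*ˡ k (λ b → ∑ q (h a b)))))
    (∑-*ˡ k (λ a → ∑ q (λ b → ∑ q (h a b))))

  -- Double counting of colours in triples. It is used twice: h = 1 gives the sum of the degrees,
  -- and h = `degree T` the sum of their squares.
  ∑-degrees : ∀ (h : Fin q → ℕ) → ∑³ (λ a b c → (h a + h b + h c) * t a b c) ≡ ∑ q (λ x → h x * degree T x)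
  ∑-degrees h = begin
    ∑³ (λ a b c → (h a + h b + h c) * t a b c)
      ≡⟨ ∑-cong (λ a → ∑-cong (λ b → ∑-cong (λ c → distrib (h a) (h b) (h c) (t a b c)))) ⟩
    ∑³ (λ a b c → h a * t a b c + h b * t a b c + h c * t a b c)
      ≡⟨ ∑³-+ (λ a b c → h a * t a b c + h b * t a b c) (λ a b c → h c * t a b c) ⟩
    ∑³ (λ a b c → h a * t a b c + h b * t a b c) + ∑³ (λ a b c → h c * t a b c)
      ≡⟨ cong (_+ ∑³ (λ a b c → h c * t a b c)) (∑³-+ (λ a b c → h a * t a b c) (λ a b c → h b * t a b c)) ⟩
    ∑³ (λ a b c → h a * t a b c) + ∑³ (λ a b c → h b * t a b c) + ∑³ (λ a b c → h c * t a b c)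
      ≡⟨ cong₂ _+_ (cong₂ _+_ (∑-by₁ h) (∑-by₂ h)) (∑-by₃ h) ⟩
    ∑ q (λ x → h x * degree₁ T x) + ∑ q (λ x → h x * degree₂ T x) + ∑ q (λ x → h x * degree₃ T x)
      ≡⟨ cong (_+ ∑ q (λ x → h x * degree₃ T x)) (sym (∑-+ (λ x → h x * degree₁ T x) (λ x → h x * degree₂ T x))) ⟩
    ∑ q (λ x → h x * degree₁ T x + h x * degree₂ T x) + ∑ q (λ x → h x * degree₃ T x)
      ≡⟨ sym (∑-+ (λ x → h x * degree₁ T x + h x * degree₂ T x) (λ x → h x * degree₃ T x)) ⟩
    ∑ q (λ x → h x * degree₁ T x + h x * degree₂ T x + h x * degree₃ T x)
      ≡⟨ ∑-cong (λ x → collect (h x) (degree₁ T x) (degree₂ T x) (degree₃ T x)) ⟩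
    ∑ q (λ x → h x * degree T x) ∎
    where
    open ≡-Reasoning
    distrib : ∀ a b c t → (a + b + c) * t ≡ a * t + b * t + c * t
    distrib = solve-∀
    collect : ∀ h a b c → h * a + h * b + h * c ≡ h * (a + b + c)
    collect = solve-∀

  paletteStrip : 4 * (q * q * q) < 27 * tripleCount T → PaletteStrip T 7 7
  paletteStrip dense with Finₚ.any? (λ g → Finₚ.any? (λ d → Finₚ.any? (λ f →
    (T g d f Bool.≟ true) ×-dec (4 * (q * q) <? 3 * (degree T g + degree T d + degree T f)))))
  ... | yes (g , d , f , base , heavy) = baseStrip g d f base heavy
  -- If every triple of the palette is light, the degree count gives 27 n² ≤ 4 q³ n. One factor n
  -- cancels because the strict density hypothesis excludes an empty palette.
  ... | no light = ⊥-elim (<⇒≱ dense (*-cancelʳ-≤ (27 * n) (4 * (q * q * q)) n {{n≢0}} (begin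
      27 * n * n ≡⟨ square n ⟩
      3 * ((3 * n) * (3 * n)) ≡⟨ cong (λ s → 3 * (s * s)) (sym ∑-degree) ⟩
      3 * (∑ q (degree T) * ∑ q (degree T)) ≤⟨ *-monoʳ-≤ 3 (∑-square (degree T)) ⟩
      3 * (q * ∑ q (λ x → degree T x * degree T x)) ≡⟨ swap q (∑ q (λ x → degree T x * degree T x)) ⟩
      q * (3 * ∑ q (λ x → degree T x * degree T x)) ≡⟨ cong (λ s → q * (3 * s)) (sym (∑-degrees (degree T))) ⟩
      q * (3 * ∑³ (λ a b c → D a b c * t a b c)) ≡⟨ cong (q *_) (sym (∑³-*ˡ 3 (λ a b c → D a b c * t a b c))) ⟩
      q * ∑³ (λ a b c → 3 * (D a b c * t a b c)) ≤⟨ *-monoʳ-≤ q (∑-mono (λ a → ∑-mono (λ b → ∑-mono (λ c → lightTriple a b c)))) ⟩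
      q * ∑³ (λ a b c → 4 * (q * q) * t a b c) ≡⟨ cong (q *_) (∑³-*ˡ (4 * (q * q)) t) ⟩
      q * (4 * (q * q) * n) ≡⟨ cube q n ⟩
      4 * (q * q * q) * n ∎)))
    where
    open ≤-Reasoning
    n = tripleCount T
    D : Fin q → Fin q → Fin q → ℕ
    D a b c = degree T a + degree T b + degree T c
    n≢0 : NonZero n
    n≢0 = ≢-nonZero λ n≡0 → n≮0 (subst (λ n → 4 * (q * q * q) < 27 * n) n≡0 dense)
    lightTriple : ∀ a b c → 3 * (D a b c * t a b c) ≤ 4 * (q * q) * t a b c
    lightTriple a b c with T a b c in eq
    ... | false = ≤-reflexive (trans (cong (3 *_) (*-zeroʳ (D a b c))) (sym (*-zeroʳ (4 * (q * q)))))
    ... | true = ≤-trans (≤-reflexive (cong (3 *_) (*-identityʳ (D a b c))))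
      (≤-trans (≮⇒≥ (λ heavy → light (a , b , c , eq , heavy))) (≤-reflexive (sym (*-identityʳ (4 * (q * q))))))
    ∑-degree : ∑ q (degree T) ≡ 3 * n
    ∑-degree = begin-equality
      ∑ q (degree T) ≡⟨ ∑-cong (λ x → sym (*-identityˡ (degree T x))) ⟩
      ∑ q (λ x → 1 * degree T x) ≡⟨ sym (∑-degrees (λ _ → 1)) ⟩
      ∑³ (λ a b c → 3 * t a b c) ≡⟨ ∑³-*ˡ 3 t ⟩
      3 * n ∎
    square : ∀ n → 27 * n * n ≡ 3 * ((3 * n) * (3 * n))
    square = solve-∀
    swap : ∀ q s → 3 * (q * s) ≡ q * (3 * s)
    swap = solve-∀
    cube : ∀ q n → q * (4 * (q * q) * n) ≡ 4 * (q * q * q) * n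
    cube = solve-∀

-- Embedding tight cycles

lookup-mono : ∀ {N} {J : List (Fin N)} → Sorted J → ∀ {s t : Fin (length J)} → s Fin.< t → lookup J s Fin.< lookup J t
lookup-mono {J = x ∷ J} (a ∷ _) {Fin.zero} {Fin.suc t} _ = All.lookup a (∈-lookup t)
lookup-mono {J = x ∷ J} (_ ∷ s) {Fin.suc i} {Fin.suc j} (s≤s i<j) = lookup-mono s i<j

sortedTriple : ∀ {x y z i j k} → x < y → y < z → i < j → j < k →
  (i ≡ x ⊎ i ≡ y ⊎ i ≡ z) → (j ≡ x ⊎ j ≡ y ⊎ j ≡ z) → (k ≡ x ⊎ k ≡ y ⊎ k ≡ z) → i ≡ x × j ≡ y × k ≡ z
sortedTriple {x} {y} {z} {i} {j} {k} x<y y<z i<j j<k i∈ j∈ k∈ = atBottom i∈ , j≡y , atTop k∈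
  where
  x≤ : ∀ {n} → (n ≡ x ⊎ n ≡ y ⊎ n ≡ z) → x ≤ n
  x≤ (inj₁ refl)        = ≤-refl
  x≤ (inj₂ (inj₁ refl)) = <⇒≤ x<y
  x≤ (inj₂ (inj₂ refl)) = <⇒≤ (<-trans x<y y<z)
  ≤z : ∀ {n} → (n ≡ x ⊎ n ≡ y ⊎ n ≡ z) → n ≤ z
  ≤z (inj₁ refl)        = <⇒≤ (<-trans x<y y<z)
  ≤z (inj₂ (inj₁ refl)) = <⇒≤ y<z
  ≤z (inj₂ (inj₂ refl)) = ≤-refl
  middle : (j ≡ x ⊎ j ≡ y ⊎ j ≡ z) → j ≡ y
  middle (inj₁ refl)        = ⊥-elim (<⇒≱ i<j (x≤ i∈))
  middle (inj₂ (inj₁ eq))   = eq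
  middle (inj₂ (inj₂ refl)) = ⊥-elim (<⇒≱ j<k (≤z k∈))
  j≡y : j ≡ y
  j≡y = middle j∈
  i<y : i < y
  i<y = subst (i <_) j≡y i<j
  y<k : y < k
  y<k = subst (_< k) j≡y j<k
  atBottom : (i ≡ x ⊎ i ≡ y ⊎ i ≡ z) → i ≡ x
  atBottom (inj₁ eq)          = eq
  atBottom (inj₂ (inj₁ refl)) = ⊥-elim (<-irrefl refl i<y)
  atBottom (inj₂ (inj₂ refl)) = ⊥-elim (<-asym i<y y<z)
  atTop : (k ≡ x ⊎ k ≡ y ⊎ k ≡ z) → k ≡ z
  atTop (inj₁ refl)        = ⊥-elim (<-asym x<y y<k)
  atTop (inj₂ (inj₁ refl)) = ⊥-elim (<-irrefl refl y<k)
  atTop (inj₂ (inj₂ eq))   = eq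

cycleRight : ∀ {A B C : Set} → A ⊎ B ⊎ C → C ⊎ A ⊎ B
cycleRight (inj₁ a)        = inj₂ (inj₁ a)
cycleRight (inj₂ (inj₁ b)) = inj₂ (inj₂ b)
cycleRight (inj₂ (inj₂ c)) = inj₁ c

-- The cycle has n + 2 vertices. Sorted by label, the edges starting at n and at n + 1 run across
-- the end and become `wrap₁` and `wrap₂`.
data Consecutive (n : ℕ) (i j k : ℕ) : Set where
  inner : i < n → j ≡ 1 + i → k ≡ 2 + i → Consecutive n i j k
  wrap₁ : i ≡ 0 → j ≡ n → k ≡ 1 + n → Consecutive n i j k
  wrap₂ : i ≡ 0 → j ≡ 1 → k ≡ 1 + n → Consecutive n i j k

consecutive : ∀ n → 1 < n → ∀ {i j k : Fin (2 + n)} → i Fin.< j → j Fin.< k → TightCycleEdge (2 + n) i j k →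
  Consecutive n (toℕ i) (toℕ j) (toℕ k)
consecutive n 1<n {i} {j} {k} i<j j<k (t , i∈ , j∈ , k∈ , _) = byPosition (<-cmp s n)
  where
  s = toℕ t
  s<ℓ : s < 2 + n
  s<ℓ = Finₚ.toℕ<n t
  small : ∀ {m} → m < 2 + n → m % (2 + n) ≡ m
  small = m<n⇒m%n≡m
  result : ∀ {x₀ x₁ x₂} → s % (2 + n) ≡ x₀ → (s + 1) % (2 + n) ≡ x₁ → (s + 2) % (2 + n) ≡ x₂ →
    ∀ {m} → (m ≡ s % (2 + n) ⊎ m ≡ (s + 1) % (2 + n) ⊎ m ≡ (s + 2) % (2 + n)) → m ≡ x₀ ⊎ m ≡ x₁ ⊎ m ≡ x₂
  result refl refl refl m∈ = m∈
  byPosition : Tri (s < n) (s ≡ n) (n < s) → Consecutive n (toℕ i) (toℕ j) (toℕ k)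
  byPosition (tri< s<n _ _) =
    let r = result (small s<ℓ) (trans (small (≤-trans (≤-reflexive (cong suc (+-comm s 1))) (s≤s (<⇒≤ (s≤s s<n))))) (+-comm s 1))
              (trans (small (≤-trans (≤-reflexive (cong suc (+-comm s 2))) (s≤s (s≤s s<n)))) (+-comm s 2))
        i≡ , j≡ , k≡ = sortedTriple (n<1+n s) (n<1+n (1 + s)) i<j j<k (r i∈) (r j∈) (r k∈)
    in inner (subst (_< n) (sym i≡) s<n) (trans j≡ (cong suc (sym i≡))) (trans k≡ (cong (2 +_) (sym i≡)))
  byPosition (tri≈ _ s≡n _) =
    let r = result (trans (small s<ℓ) s≡n) (trans (cong (λ s → (s + 1) % (2 + n)) s≡n) (trans (cong (_% (2 + n)) (+-comm n 1)) (small ≤-refl)))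
              (trans (cong (λ s → (s + 2) % (2 + n)) s≡n) (trans (cong (_% (2 + n)) (+-comm n 2)) (n%n≡0 (2 + n))))
        i≡ , j≡ , k≡ = sortedTriple (<-trans (s≤s z≤n) 1<n) (n<1+n n) i<j j<k (cycleRight (r i∈)) (cycleRight (r j∈)) (cycleRight (r k∈))
    in wrap₁ i≡ j≡ k≡
  byPosition (tri> _ _ n<s) =
    let s≡ = ≤-antisym (≤-pred s<ℓ) n<s
        r = result (trans (small s<ℓ) s≡) (trans (cong (λ s → (s + 1) % (2 + n)) s≡) (trans (cong (_% (2 + n)) (+-comm (1 + n) 1)) (n%n≡0 (2 + n))))
              (trans (cong (λ s → (s + 2) % (2 + n)) s≡) (trans (cong (_% (2 + n)) (trans (+-comm (1 + n) 2) (+-comm 1 (2 + n))))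
                (trans overflow (small (s≤s (s≤s z≤n))))))
        i≡ , j≡ , k≡ = sortedTriple (s≤s z≤n) (s≤s (<-trans (s≤s z≤n) 1<n)) i<j j<k
          (cycleRight (cycleRight (r i∈))) (cycleRight (cycleRight (r j∈))) (cycleRight (cycleRight (r k∈)))
    in wrap₂ i≡ j≡ k≡
    where
    overflow : (2 + n + 1) % (2 + n) ≡ 1 % (2 + n)
    overflow = trans (cong (_% (2 + n)) (+-comm (2 + n) 1)) ([m+n]%n≡m%n 1 (2 + n))

≤-∑ : ∀ {n} (f : Fin n → ℕ) x → f x ≤ ∑ n f
≤-∑ f Fin.zero    = m≤m+n _ _
≤-∑ f (Fin.suc x) = ≤-trans (≤-∑ (λ y → f (Fin.suc y)) x) (m≤n+m _ _)

IsEdge-rotate : ∀ {N} (H : PartHypergraph N) {x y z} → IsEdge H x y z → IsEdge H y z x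
IsEdge-rotate H (inj₁ e)                                  = inj₂ (inj₂ (inj₂ (inj₂ (inj₁ e))))
IsEdge-rotate H (inj₂ (inj₁ e))                           = inj₂ (inj₂ (inj₂ (inj₂ (inj₂ e))))
IsEdge-rotate H (inj₂ (inj₂ (inj₁ e)))                    = inj₂ (inj₁ e)
IsEdge-rotate H (inj₂ (inj₂ (inj₂ (inj₁ e))))             = inj₁ e
IsEdge-rotate H (inj₂ (inj₂ (inj₂ (inj₂ (inj₁ e)))))      = inj₂ (inj₂ (inj₂ (inj₁ e)))
IsEdge-rotate H (inj₂ (inj₂ (inj₂ (inj₂ (inj₂ e)))))      = inj₂ (inj₂ (inj₁ e))

module _ {N : ℕ} (H : PartHypergraph N) where
  open PartHypergraph H

  membership : Fin N → Fin N → Fin M → ℕ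
  membership i j x = indicator (inPartᵇ H x i j)

  membership⇒part : ∀ {i j x} → 0 < membership i j x → part x ≡ (i , j)
  membership⇒part {i} {j} {x} 0<w with proj₁ (part x) Fin.≟ i | proj₂ (part x) Fin.≟ j
  ... | yes refl | yes refl = refl

  part⇒membership : ∀ {i j x} → part x ≡ (i , j) → 0 < membership i j x
  part⇒membership {i} {j} {x} eq with proj₁ (part x) Fin.≟ i | proj₂ (part x) Fin.≟ j
  ... | yes _ | yes _ = s≤s z≤n
  ... | no ≢i | _     = ⊥-elim (≢i (cong proj₁ eq))
  ... | yes _ | no ≢j = ⊥-elim (≢j (cong proj₂ eq))

  partSize>0 : ∀ {i j} → i Fin.< j → 0 < ∑ M (membership i j)
  partSize>0 {i} {j} i<j with x , eq ← nonempty i j i<j = ≤-trans (part⇒membership eq) (≤-∑ (membership i j) x)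

  module _ {q : ℕ} (T : Fin q → Fin q → Fin q → Bool) (ys : Fin q → Fin N → Fin N → Fin M) (J : List (Fin N))
    (sorted : Sorted J) (palette : IsPalette membership edge T ys J) where

    vertex : Fin q → Fin N → Fin N → Fin M
    vertex c s t = if toℕ s <ᵇ toℕ t then ys c s t else ys c t s

    vertex-< : ∀ c {s t} → s Fin.< t → vertex c s t ≡ ys c s t
    vertex-< c s<t rewrite <ᵇ-true s<t = refl

    vertex-> : ∀ c {s t} → t Fin.< s → vertex c s t ≡ ys c t s
    vertex-> c t<s rewrite <ᵇ-false (<⇒≤ t<s) = refl

    vertex-sym : ∀ c {s t} → s ≢ t → vertex c s t ≡ vertex c t s
    vertex-sym c {s} {t} s≢t with Finₚ.<-cmp s t
    ... | tri< s<t _ _ = trans (vertex-< c s<t) (sym (vertex-> c s<t))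
    ... | tri≈ _ s≡t _ = ⊥-elim (s≢t s≡t)
    ... | tri> _ _ t<s = trans (vertex-> c t<s) (sym (vertex-< c t<s))

    vertex-inPart : ∀ c {s t} → s ∈ J → t ∈ J → s ≢ t → InPart H (vertex c s t) s t
    vertex-inPart c {s} {t} s∈ t∈ s≢t with Finₚ.<-cmp s t
    ... | tri< s<t _ _ = inj₁ (trans (cong part (vertex-< c s<t)) (membership⇒part (proj₁ palette c s∈ t∈ s<t)))
    ... | tri≈ _ s≡t _ = ⊥-elim (s≢t s≡t)
    ... | tri> _ _ t<s = inj₂ (trans (cong part (vertex-> c t<s)) (membership⇒part (proj₁ palette c t∈ s∈ t<s)))

    -- Six orders of the three indices are possible, and in each of them `arrange` assigns the
    -- colours so that sorting the indices restores τ. The two cyclic comparison patterns contradict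
    -- transitivity.
    triangleEdge : ∀ {τ} → InPalette T τ → ∀ {s₀ s₁ s₂} → s₀ ∈ J → s₁ ∈ J → s₂ ∈ J → s₀ ≢ s₁ → s₀ ≢ s₂ → s₁ ≢ s₂ →
      let (c₀₁ , c₀₂ , c₁₂) = arrange τ (toℕ s₀ <ᵇ toℕ s₁) (toℕ s₀ <ᵇ toℕ s₂) (toℕ s₁ <ᵇ toℕ s₂) in
      IsEdge H (vertex c₀₁ s₀ s₁) (vertex c₀₂ s₀ s₂) (vertex c₁₂ s₁ s₂)
    triangleEdge {x , y , z} inT {s₀} {s₁} {s₂} ∈₀ ∈₁ ∈₂ 0≢1 0≢2 1≢2
      with Finₚ.<-cmp s₀ s₁ | Finₚ.<-cmp s₀ s₂ | Finₚ.<-cmp s₁ s₂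
    ... | tri≈ _ eq _ | _ | _ = ⊥-elim (0≢1 eq)
    ... | tri< _ _ _ | tri≈ _ eq _ | _ = ⊥-elim (0≢2 eq)
    ... | tri> _ _ _ | tri≈ _ eq _ | _ = ⊥-elim (0≢2 eq)
    ... | tri< _ _ _ | tri< _ _ _ | tri≈ _ eq _ = ⊥-elim (1≢2 eq)
    ... | tri< _ _ _ | tri> _ _ _ | tri≈ _ eq _ = ⊥-elim (1≢2 eq)
    ... | tri> _ _ _ | tri< _ _ _ | tri≈ _ eq _ = ⊥-elim (1≢2 eq)
    ... | tri> _ _ _ | tri> _ _ _ | tri≈ _ eq _ = ⊥-elim (1≢2 eq)
    ... | tri< a _ _ | tri> _ _ b | tri< c _ _ = ⊥-elim (<-asym (<-trans a c) b)
    ... | tri> _ _ a | tri< b _ _ | tri> _ _ c = ⊥-elim (<-asym (<-trans a b) c)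
    ... | tri< a _ _ | tri< b _ _ | tri< c _ _ rewrite <ᵇ-true a | <ᵇ-true b | <ᵇ-true c =
      inj₁ (trans (proj₂ palette ∈₀ ∈₁ ∈₂ a c x y z) inT)
    ... | tri< a _ _ | tri< b _ _ | tri> _ _ c rewrite <ᵇ-true a | <ᵇ-true b | <ᵇ-false (<⇒≤ c) =
      inj₂ (inj₂ (inj₁ (trans (proj₂ palette ∈₀ ∈₂ ∈₁ b c x y z) inT)))
    ... | tri> _ _ a | tri< b _ _ | tri< c _ _ rewrite <ᵇ-false (<⇒≤ a) | <ᵇ-true b | <ᵇ-true c =
      inj₂ (inj₁ (trans (proj₂ palette ∈₁ ∈₀ ∈₂ a b x y z) inT))
    ... | tri< a _ _ | tri> _ _ b | tri> _ _ c rewrite <ᵇ-true a | <ᵇ-false (<⇒≤ b) | <ᵇ-false (<⇒≤ c) =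
      inj₂ (inj₂ (inj₂ (inj₁ (trans (proj₂ palette ∈₂ ∈₀ ∈₁ b a x y z) inT))))
    ... | tri> _ _ a | tri> _ _ b | tri< c _ _ rewrite <ᵇ-false (<⇒≤ a) | <ᵇ-false (<⇒≤ b) | <ᵇ-true c =
      inj₂ (inj₂ (inj₂ (inj₂ (inj₁ (trans (proj₂ palette ∈₁ ∈₂ ∈₀ c b x y z) inT)))))
    ... | tri> _ _ a | tri> _ _ b | tri> _ _ c rewrite <ᵇ-false (<⇒≤ a) | <ᵇ-false (<⇒≤ b) | <ᵇ-false (<⇒≤ c) =
      inj₂ (inj₂ (inj₂ (inj₂ (inj₂ (trans (proj₂ palette ∈₂ ∈₁ ∈₀ c a x y z) inT)))))

    module _ (n bound : ℕ) (3<n : 3 < n) (bound≤ : bound ≤ length J) (τ : ℕ → Triple (Fin q)) (rank : ℕ → ℕ)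
      (strip : IsStrip (2 + n) bound τ rank) (inT : ∀ t → InPalette T (τ t)) where
      open IsStrip strip

      private
        ℓ = 2 + n

      index : (t : ℕ) → t < ℓ → Fin N
      index t t<ℓ = lookup J (fromℕ< (≤-trans (bounded t t<ℓ) bound≤))

      index∈ : ∀ t t<ℓ → index t t<ℓ ∈ J
      index∈ t t<ℓ = ∈-lookup (fromℕ< (≤-trans (bounded t t<ℓ) bound≤))

      index-mono : ∀ {s t} s<ℓ t<ℓ → rank s < rank t → index s s<ℓ Fin.< index t t<ℓ
      index-mono s<ℓ t<ℓ lt = lookup-mono sorted (subst₂ _<_ (sym (Finₚ.toℕ-fromℕ< _)) (sym (Finₚ.toℕ-fromℕ< _)) lt)

      index-≢ : ∀ {s t} s<ℓ t<ℓ → s ≢ t → index s s<ℓ ≢ index t t<ℓ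
      index-≢ {s} {t} s<ℓ t<ℓ s≢t eq with <-cmp (rank s) (rank t)
      ... | tri< lt _ _ = Finₚ.<-irrefl eq (index-mono s<ℓ t<ℓ lt)
      ... | tri≈ _ r≡ _ = s≢t (injective s t s<ℓ t<ℓ r≡)
      ... | tri> _ _ gt = Finₚ.<-irrefl (sym eq) (index-mono t<ℓ s<ℓ gt)

      index-<ᵇ : ∀ {s t} s<ℓ t<ℓ → s ≢ t → (toℕ (index s s<ℓ) <ᵇ toℕ (index t t<ℓ)) ≡ (rank s <ᵇ rank t)
      index-<ᵇ {s} {t} s<ℓ t<ℓ s≢t with <-cmp (rank s) (rank t)
      ... | tri< lt _ _ = trans (<ᵇ-true (index-mono s<ℓ t<ℓ lt)) (sym (<ᵇ-true lt))
      ... | tri≈ _ r≡ _ = ⊥-elim (s≢t (injective s t s<ℓ t<ℓ r≡))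
      ... | tri> _ _ gt = trans (<ᵇ-false (<⇒≤ (index-mono t<ℓ s<ℓ gt))) (sym (<ᵇ-false (<⇒≤ gt)))

      shareColour diagonalColour : ℕ → Fin q
      shareColour t    = proj₁ (at τ rank t)
      diagonalColour t = proj₁ (proj₂ (at τ rank t))

      -- An embedding needs a vertex for every pair i < j. The relevant pairs are at cyclic distance
      -- 1 or 2; the last two cases are meant for (0 , n) and (1 , n + 1), and also serve as
      -- defaults for pairs that lie in no edge of the cycle.
      pairColour : ℕ → ℕ → Fin q
      pairColour i j with j ≟ 1 + i | j ≟ 2 + i | i ≟ 0 | j ≟ 1 + n
      ... | yes _ | _     | _     | _     = shareColour i
      ... | no _  | yes _ | _     | _     = diagonalColour i
      ... | no _  | no _  | yes _ | yes _ = shareColour (1 + n)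
      ... | no _  | no _  | yes _ | no _  = diagonalColour n
      ... | no _  | no _  | no _  | _     = diagonalColour (1 + n)

      -- The vertices u and v stand for t + 1 and t + 2 and are tied to them by rank only. Thus a
      -- triangle that runs across the end of the walk, where t + 1 or t + 2 exceeds the range of
      -- indices, needs no separate treatment.
      stripEdge : ∀ t {u v} t<ℓ u<ℓ v<ℓ → t < ℓ → rank u ≡ rank (1 + t) → rank v ≡ rank (2 + t) →
        t ≢ u → t ≢ v → u ≢ v →
        IsEdge H (vertex (shareColour t) (index t t<ℓ) (index u u<ℓ)) (vertex (diagonalColour t) (index t t<ℓ) (index v v<ℓ))
          (vertex (shareColour (1 + t)) (index u u<ℓ) (index v v<ℓ))
      stripEdge t {u} {v} t<ℓ u<ℓ v<ℓ t<ℓ′ u≡ v≡ t≢u t≢v u≢v =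
        recolour arranged (shared t t<ℓ′) (triangleEdge {τ t} (inT t) (index∈ t t<ℓ) (index∈ u u<ℓ) (index∈ v v<ℓ)
          (index-≢ t<ℓ u<ℓ t≢u) (index-≢ t<ℓ v<ℓ t≢v) (index-≢ u<ℓ v<ℓ u≢v))
        where
        arranged : arrange (τ t) (toℕ (index t t<ℓ) <ᵇ toℕ (index u u<ℓ)) (toℕ (index t t<ℓ) <ᵇ toℕ (index v v<ℓ))
          (toℕ (index u u<ℓ) <ᵇ toℕ (index v v<ℓ)) ≡ at τ rank t
        arranged rewrite index-<ᵇ t<ℓ u<ℓ t≢u | index-<ᵇ t<ℓ v<ℓ t≢v | index-<ᵇ u<ℓ v<ℓ u≢v | u≡ | v≡ = refl
        recolour : ∀ {σ σ′ : Triple (Fin q)} {c} → σ ≡ σ′ → last σ′ ≡ c →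
          IsEdge H (vertex (proj₁ σ) (index t t<ℓ) (index u u<ℓ)) (vertex (proj₁ (proj₂ σ)) (index t t<ℓ) (index v v<ℓ))
            (vertex (proj₂ (proj₂ σ)) (index u u<ℓ) (index v v<ℓ)) →
          IsEdge H (vertex (proj₁ σ′) (index t t<ℓ) (index u u<ℓ)) (vertex (proj₁ (proj₂ σ′)) (index t t<ℓ) (index v v<ℓ))
            (vertex c (index u u<ℓ) (index v v<ℓ))
        recolour refl refl e = e

      pairColour-share : ∀ i → pairColour i (1 + i) ≡ shareColour i
      pairColour-share i with (1 + i) ≟ (1 + i) | (1 + i) ≟ (2 + i) | i ≟ 0 | (1 + i) ≟ (1 + n)
      ... | yes _ | _ | _ | _ = refl
      ... | no ≢  | _ | _ | _ = ⊥-elim (≢ refl)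

      pairColour-diagonal : ∀ i → pairColour i (2 + i) ≡ diagonalColour i
      pairColour-diagonal i with (2 + i) ≟ (1 + i) | (2 + i) ≟ (2 + i) | i ≟ 0 | (2 + i) ≟ (1 + n)
      ... | yes eq | _     | _ | _ = ⊥-elim (<-irrefl (sym eq) (n<1+n (1 + i)))
      ... | no _   | yes _ | _ | _ = refl
      ... | no _   | no ≢  | _ | _ = ⊥-elim (≢ refl)

      pairColour-wrap : pairColour 0 (1 + n) ≡ shareColour (1 + n)
      pairColour-wrap with (1 + n) ≟ 1 | (1 + n) ≟ 2 | 0 ≟ 0 | (1 + n) ≟ (1 + n)
      ... | yes eq | _      | _     | _     = ⊥-elim (<-irrefl (sym eq) (s≤s (<-trans (s≤s z≤n) 3<n)))
      ... | no _   | yes eq | _     | _     = ⊥-elim (<-irrefl (sym eq) (s≤s (<-trans (s≤s (s≤s z≤n)) 3<n)))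
      ... | no _   | no _   | yes _ | yes _ = refl
      ... | no _   | no _   | no ≢  | _     = ⊥-elim (≢ refl)
      ... | no _   | no _   | yes _ | no ≢  = ⊥-elim (≢ refl)

      pairColour-wrap₁ : pairColour 0 n ≡ diagonalColour n
      pairColour-wrap₁ with n ≟ 1 | n ≟ 2 | 0 ≟ 0 | n ≟ (1 + n)
      ... | yes eq | _      | _     | _      = ⊥-elim (<-irrefl (sym eq) (<-trans (s≤s (s≤s z≤n)) 3<n))
      ... | no _   | yes eq | _     | _      = ⊥-elim (<-irrefl (sym eq) (<-trans (s≤s (s≤s (s≤s z≤n))) 3<n))
      ... | no _   | no _   | yes _ | yes eq = ⊥-elim (<-irrefl eq (n<1+n n))
      ... | no _   | no _   | no ≢  | _      = ⊥-elim (≢ refl)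
      ... | no _   | no _   | yes _ | no _   = refl

      pairColour-wrap₂ : pairColour 1 (1 + n) ≡ diagonalColour (1 + n)
      pairColour-wrap₂ with (1 + n) ≟ 2 | (1 + n) ≟ 3 | 1 ≟ 0 | (1 + n) ≟ (1 + n)
      ... | yes eq | _      | _    | _ = ⊥-elim (<-irrefl (sym eq) (s≤s (<-trans (s≤s (s≤s z≤n)) 3<n)))
      ... | no _   | yes eq | _    | _ = ⊥-elim (<-irrefl (sym eq) (s≤s (<-trans (s≤s (s≤s (s≤s z≤n))) 3<n)))
      ... | no _   | no _   | no _ | _ = refl

      shareColour-closed : shareColour ℓ ≡ shareColour 0
      shareColour-closed rewrite closed-τ | closed-rank 0 (s≤s z≤n) | closed-rank 1 (s≤s (s≤s z≤n)) | closed-rank 2 (s≤s (s≤s (s≤s z≤n))) = refl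

      0≢n : 0 ≢ n
      0≢n = <⇒≢ (<-trans (s≤s z≤n) 3<n)

      1≢1+n : 1 ≢ 1 + n
      1≢1+n eq = 0≢n (suc-injective eq)

      cycleVertex : ∀ i j → i < ℓ → j < ℓ → Fin M
      cycleVertex i j i<ℓ j<ℓ = vertex (pairColour i j) (index i i<ℓ) (index j j<ℓ)

      cycleEdge : ∀ {i j k} (i<ℓ : i < ℓ) (j<ℓ : j < ℓ) (k<ℓ : k < ℓ) → Consecutive n i j k →
        IsEdge H (cycleVertex i j i<ℓ j<ℓ) (cycleVertex i k i<ℓ k<ℓ) (cycleVertex j k j<ℓ k<ℓ)
      cycleEdge {i} i<ℓ j<ℓ k<ℓ (inner i<n refl refl)
        rewrite pairColour-share i | pairColour-diagonal i | pairColour-share (1 + i) =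
        stripEdge i i<ℓ j<ℓ k<ℓ i<ℓ refl refl (<⇒≢ (n<1+n i)) (<⇒≢ (≤-trans (n<1+n i) (n≤1+n _))) (<⇒≢ (n<1+n (1 + i)))
      -- The walk visits n, n + 1, 0, whereas the edge is listed by increasing labels: `vertex-sym`
      -- exchanges the ends of the pairs with 0, and `IsEdge-rotate` reorders the three vertices of
      -- the hypergraph.
      cycleEdge 0<ℓ n<ℓ 1+n<ℓ (wrap₁ refl refl refl)
        rewrite pairColour-wrap₁ | pairColour-wrap | pairColour-share n
              | vertex-sym (diagonalColour n) (index-≢ 0<ℓ n<ℓ 0≢n)
              | vertex-sym (shareColour (1 + n)) (index-≢ 0<ℓ 1+n<ℓ 0≢1+n) =
        IsEdge-rotate H (stripEdge n n<ℓ 1+n<ℓ 0<ℓ n<ℓ refl (sym (closed-rank 0 (s≤s z≤n))) (<⇒≢ (n<1+n n))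
          (≢-sym 0≢n) (≢-sym 0≢1+n))
      cycleEdge 0<ℓ 1<ℓ 1+n<ℓ (wrap₂ refl refl refl)
        rewrite pairColour-share 0 | pairColour-wrap | pairColour-wrap₂
              | vertex-sym (shareColour (1 + n)) (index-≢ 0<ℓ 1+n<ℓ 0≢1+n)
              | vertex-sym (diagonalColour (1 + n)) (index-≢ 1<ℓ 1+n<ℓ 1≢1+n)
              | sym shareColour-closed =
        IsEdge-rotate H (IsEdge-rotate H (stripEdge (1 + n) 1+n<ℓ 0<ℓ 1<ℓ 1+n<ℓ (sym (closed-rank 0 (s≤s z≤n)))
          (sym (closed-rank 1 (s≤s (s≤s z≤n)))) (≢-sym 0≢1+n) (≢-sym 1≢1+n) (λ ())))

      embedCycle : Embeds H ℓ (TightCycleEdge ℓ)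
      embedCycle = (λ i → index (toℕ i) (Finₚ.toℕ<n i)) , inj ,
        (λ i j _ → cycleVertex (toℕ i) (toℕ j) (Finₚ.toℕ<n i) (Finₚ.toℕ<n j)) ,
        (λ i j i<j → vertex-inPart _ (index∈ (toℕ i) (Finₚ.toℕ<n i)) (index∈ (toℕ j) (Finₚ.toℕ<n j))
          (index-≢ (Finₚ.toℕ<n i) (Finₚ.toℕ<n j) (<⇒≢ i<j))) ,
        (λ i j k i<j j<k _ e → cycleEdge (Finₚ.toℕ<n i) (Finₚ.toℕ<n j) (Finₚ.toℕ<n k)
          (consecutive n (<-trans (s≤s (s≤s z≤n)) 3<n) i<j j<k e))
        where
        inj : ∀ {i j : Fin ℓ} → index (toℕ i) (Finₚ.toℕ<n i) ≡ index (toℕ j) (Finₚ.toℕ<n j) → i ≡ j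
        inj {i} {j} eq with i Finₚ.≟ j
        ... | yes i≡j = i≡j
        ... | no i≢j = ⊥-elim (index-≢ (Finₚ.toℕ<n i) (Finₚ.toℕ<n j) (λ t≡ → i≢j (Finₚ.toℕ-injective t≡)) eq)

-- From rational densities to natural numbers, and the assembly of the proof

open import Data.Integer as ℤ using (+_; -[1+_])
import Data.Integer.Properties as ℤₚ
open import Data.Rational as ℚ using (ℚ; 0ℚ; mkℚ; _/_) renaming (_+_ to _+ℚ_; _<_ to _<ℚ_)
import Data.Rational.Properties as ℚₚ
open import Data.Rational.Unnormalised as ℚᵘ using (mkℚᵘ)
import Data.Rational.Unnormalised.Properties as ℚᵘₚ

-- Unnormalised rationals keep the denominators 27 and d + 1 visible, so the density hypothesis can
-- be multiplied out. Of δ only the part 1/(d + 1) is retained, which makes all later bounds depend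
-- on the denominator alone.
density-ℕ : ∀ p d .(cop : Coprime (suc p) (suc d)) S E → ((+ 4 / 27) +ℚ mkℚ (+ suc p) d cop) ℚ.* ℕ→ℚ S ℚ.≤ ℕ→ℚ E →
  (4 * suc d + 27) * S ≤ 27 * suc d * E
density-ℕ p d cop S E le = begin
  (4 * suc d + 27) * S ≤⟨ *-monoˡ-≤ S (+-monoʳ-≤ (4 * suc d) (m≤m+n 27 (p * 27))) ⟩
  (4 * suc d + suc p * 27) * S ≡⟨ sym (*-identityʳ _) ⟩
  (4 * suc d + suc p * 27) * S * 1 ≤⟨ ℤₚ.drop‿+≤+ (subst₂ ℤ._≤_ lhs rhs (ℚᵘₚ.drop-*≤* unnormalised)) ⟩
  E * (27 * suc d * 1) ≡⟨ trans (cong (E *_) (*-identityʳ (27 * suc d))) (*-comm E (27 * suc d)) ⟩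
  27 * suc d * E ∎
  where
  open ≤-Reasoning
  δᵘ = mkℚᵘ (+ suc p) d
  unnormalised : (mkℚᵘ (+ 4) 26 ℚᵘ.+ δᵘ) ℚᵘ.* mkℚᵘ (+ S) 0 ℚᵘ.≤ mkℚᵘ (+ E) 0
  unnormalised = ℚᵘₚ.≤-respˡ-≃ (ℚᵘₚ.≃-trans (ℚₚ.toℚᵘ-homo-* ((+ 4 / 27) +ℚ mkℚ (+ suc p) d cop) (ℕ→ℚ S))
      (ℚᵘₚ.*-cong (ℚₚ.toℚᵘ-homo-+ (+ 4 / 27) (mkℚ (+ suc p) d cop)) (ℚₚ.toℚᵘ-fromℚᵘ (mkℚᵘ (+ S) 0))))
    (ℚᵘₚ.≤-respʳ-≃ (ℚₚ.toℚᵘ-fromℚᵘ (mkℚᵘ (+ E) 0)) (ℚₚ.toℚᵘ-mono-≤ le))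
  lhs : (+ 4 ℤ.* + suc d ℤ.+ + suc p ℤ.* + 27) ℤ.* + S ℤ.* + 1 ≡ + ((4 * suc d + suc p * 27) * S * 1)
  lhs = sym (trans (ℤₚ.pos-* ((4 * suc d + suc p * 27) * S) 1) (cong (ℤ._* + 1) (trans (ℤₚ.pos-* (4 * suc d + suc p * 27) S)
    (cong (ℤ._* + S) (trans (ℤₚ.pos-+ (4 * suc d) (suc p * 27)) (cong₂ ℤ._+_ (ℤₚ.pos-* 4 (suc d)) (ℤₚ.pos-* (suc p) 27)))))))
  rhs : + E ℤ.* + (27 * suc d * 1) ≡ + (E * (27 * suc d * 1))
  rhs = sym (ℤₚ.pos-* E (27 * suc d * 1))

-- With q = 3e + 1 the losses of the q sampling stages stay below the gain from δ ≥ 1/e.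
palette-dense : ∀ e t → let q = 3 * e + 1 in
  (4 * e + 27) * (q * q * q) ≤ 27 * e * t + q * (3 + 27 * e * (3 * q)) → 4 * (q * q * q) < 27 * t
palette-dense e t le = ≰⇒> λ light → <⇒≱ 3q<27q² (+-cancelˡ-≤ (4 * e * c + 81 * e * (q * q)) (27 * (q * q)) (3 * q) (begin
  4 * e * c + 81 * e * (q * q) + 27 * (q * q) ≡⟨ expand e ⟩
  (4 * e + 27) * c ≤⟨ le ⟩
  27 * e * t + q * (3 + 27 * e * (3 * q)) ≡⟨ cong (_+ q * (3 + 27 * e * (3 * q))) (swap e t) ⟩
  e * (27 * t) + q * (3 + 27 * e * (3 * q)) ≤⟨ +-monoˡ-≤ _ (*-monoʳ-≤ e light) ⟩
  e * (4 * c) + q * (3 + 27 * e * (3 * q)) ≡⟨ collect e q c ⟩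
  4 * e * c + 81 * e * (q * q) + 3 * q ∎))
  where
  open ≤-Reasoning
  q = 3 * e + 1
  c = q * q * q
  expand : ∀ e → 4 * e * ((3 * e + 1) * (3 * e + 1) * (3 * e + 1)) + 81 * e * ((3 * e + 1) * (3 * e + 1)) + 27 * ((3 * e + 1) * (3 * e + 1))
    ≡ (4 * e + 27) * ((3 * e + 1) * (3 * e + 1) * (3 * e + 1))
  expand = solve-∀
  swap : ∀ e t → 27 * e * t ≡ e * (27 * t)
  swap = solve-∀
  collect : ∀ e q c → e * (4 * c) + q * (3 + 27 * e * (3 * q)) ≡ 4 * e * c + 81 * e * (q * q) + 3 * q
  collect = solve-∀
  0<q : 0 < q
  0<q = m≤n+m 1 (3 * e)
  3q<27q² : 3 * q < 27 * (q * q)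
  3q<27q² = begin-strict
    3 * q ≡⟨ sym (*-identityʳ (3 * q)) ⟩
    3 * q * 1 <⟨ *-monoʳ-< (3 * q) {{>-nonZero (*-mono-≤ (s≤s (z≤n {2})) 0<q)}} {1} {9 * q} (*-mono-≤ (s≤s (s≤s (z≤n {7}))) 0<q) ⟩
    3 * q * (9 * q) ≡⟨ nine q ⟩
    27 * (q * q) ∎
    where
    nine : ∀ q → 3 * q * (9 * q) ≡ 27 * (q * q)
    nine = solve-∀

module _ {N : ℕ} (H : PartHypergraph N) where
  open PartHypergraph H

  triadEdges≡form : ∀ i j k → triadEdges H i j k ≡
    form (λ x y z → indicator (edge x y z)) (membership H i j) (membership H i k) (membership H j k)
  triadEdges≡form i j k = ∑-cong λ x → trans (∑-cong λ y → trans (∑-cong λ z →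
      conjunction (inPartᵇ H x i j) (inPartᵇ H y i k) (inPartᵇ H z j k) (edge x y z))
        (trans (∑-*ˡ (membership H i j x) (λ z → membership H i k y * (membership H j k z * indicator (edge x y z))))
          (cong (membership H i j x *_) (∑-*ˡ (membership H i k y) (λ z → membership H j k z * indicator (edge x y z))))))
    (∑-*ˡ (membership H i j x) (λ y → membership H i k y * ∑ M (λ z → membership H j k z * indicator (edge x y z))))
    where
    conjunction : ∀ a b c d → indicator (a ∧ b ∧ c ∧ d) ≡ indicator a * (indicator b * (indicator c * indicator d))
    conjunction false _     _     _     = refl
    conjunction true  false _     _     = refl
    conjunction true  true  false _     = refl
    conjunction true  true  true  false = refl
    conjunction true  true  true  true  = refl

-- The scale 27e clears the denominators of 4/27 + 1/e, the number 3e + 1 of colours is that of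
-- `palette-dense`, and the final list must accommodate the ranks of the lengthened strip, which are
-- below 2 ^ m * 7.
indexBound : ℕ → ℕ → ℕ
indexBound m e = sampleBound (27 * e) (3 * e + 1) (homogeneousBound (3 * e + 1) (3 + 2 ^ m * 7)) (3 * e + 1)

embedTightCycle : ∀ m p d .(cop : Coprime (suc p) (suc d)) (H : PartHypergraph (2 + indexBound m (suc d))) →
  DensityAtLeast H ((+ 4 / 27) +ℚ mkℚ (+ suc p) d cop) → Embeds H (4 + 3 * suc m) (TightCycleEdge (4 + 3 * suc m))
embedTightCycle m p d cop H dense = fromPalette
  (findPalette (membership H) edge (partSize>0 H) (27 * e) (3 * e + 1) (s≤s z≤n) x₀ (4 * e + 27) (2 ^ m * 7)
    (λ {i} {j} {k} i<j j<k → subst (λ E → (4 * e + 27) * (partSize H i j * partSize H i k * partSize H j k) ≤ 27 * e * E)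
      (triadEdges≡form H i j k) (density-ℕ p d cop _ _ (dense i j k i<j j<k)))
    I sortedI lengthI)
  where
  open PartHypergraph H
  e = suc d
  x₀ : Fin M
  -- The two indices added to `indexBound` ensure that there is a part at all, and hence a default
  -- vertex.
  x₀ = proj₁ (nonempty Fin.zero (Fin.suc Fin.zero) (s≤s z≤n))
  I : List (Fin (2 + indexBound m e))
  I = take (indexBound m e) (allFin _)
  sortedI : Sorted I
  sortedI = Sorted-⊆ (take-⊆ (indexBound m e) (allFin _)) (AllPairsₚ.tabulate⁺-< λ i<j → i<j)
  lengthI : length I ≡ indexBound m e
  lengthI = proj₂ (take-sublist (indexBound m e) (allFin _) (≤-trans (m≤n+m _ 2) (≤-reflexive (sym (length-tabulate {n = 2 + indexBound m e} (λ i → i))))))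
  lengthen : ∀ m → m * 3 + 7 ≡ 2 + (2 + 3 * suc m)
  lengthen = solve-∀
  fromPalette : Palette (membership H) edge (27 * e) (4 * e + 27) (3 * e + 1) (3 + 2 ^ m * 7) I →
    Embeds H (4 + 3 * suc m) (TightCycleEdge (4 + 3 * suc m))
  fromPalette (J , ys , T , (J⊆ , lenJ) , palette , count) = fromStrip
    (subst (λ ℓ → PaletteStrip T ℓ (2 ^ m * 7)) (lengthen m) (extendStrip T m (paletteStrip T (palette-dense e _ count))))
    where
    fromStrip : PaletteStrip T (2 + (2 + 3 * suc m)) (2 ^ m * 7) → Embeds H (4 + 3 * suc m) (TightCycleEdge (4 + 3 * suc m))
    fromStrip (τ , rank , strip , inT) = embedCycle H T ys J (Sorted-⊆ J⊆ sortedI) palette (2 + 3 * suc m) (2 ^ m * 7)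
      (s≤s (s≤s (≤-trans (s≤s (s≤s z≤n)) (*-monoʳ-≤ 3 (s≤s (z≤n {m})))))) (≤-trans (m≤n+m _ 3) (≤-reflexive (sym lenJ)))
      τ rank strip inT

theorem31 : ∀ (m : ℕ) → 1 ≤ m → ∀ (δ : ℚ) → 0ℚ <ℚ δ →
    ∃[ N ] ∀ (H : PartHypergraph N) → DensityAtLeast H ((+ 4 / 27) +ℚ δ) →
    Embeds H (4 + 3 * m) (TightCycleEdge (4 + 3 * m))
theorem31 (suc m) _ (mkℚ (+ suc p) d cop) _ = 2 + indexBound m (suc d) , embedTightCycle m p d cop
theorem31 (suc m) _ (mkℚ (+ zero) d cop) 0<δ with ℤ.+<+ () ← ℚₚ.drop-*<* 0<δ
theorem31 (suc m) _ (mkℚ -[1+ n ] d cop) 0<δ with () ← ℚₚ.drop-*<* 0<δ
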